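{- Let $q$ be a prime power with $q\equiv 1\pmod 6$. If there exists a large set of Kirkman triple systems of order $q+2$ (an LKTS$(q+2)$), then there exists an LKTS$(q^n+2)$ for every integer $n\geq 2$.
   Context: A Steiner triple system STS$(v)$ is a pair $(X,\mathcal{B})$ with $|X|=v$ and $\mathcal{B}$ a collection of 3-subsets (blocks) of $X$ such that every 2-subset of $X$ lies in exactly one block. A Kirkman triple system KTS$(v)$ is an STS$(v)$ whose block set admits a partition into parallel classes, i.e. classes each of which is a partition of $X$. Two STS$(v)$ on the same set are disjoint if they share no block. A large set of Kirkman triple systems of order $v$, LKTS$(v)$, is a collection of $v-2$ pairwise disjoint STS$(v)$ on the same $v$-set (hence together containing every 3-subset exactly once) each of which is resolvable (a KTS$(v)$). -}

module Defs where

open import Data.Nat using (ℕ; _<_; _^_; _≥_; _∸_; _%_)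
open import Data.Nat.Primality using (Prime)
open import Data.Fin using (Fin; toℕ)
open import Data.Product using (_×_; _,_; ∃; ∃-syntax; Σ-syntax)
open import Data.List using (List; length; concat)
open import Data.List.Membership.Propositional using (_∈_)
open import Data.List.Relation.Unary.All using (All)
open import Data.List.Relation.Unary.Unique.Propositional using (Unique)
open import Data.List.Relation.Binary.Permutation.Propositional using (_↭_)
open import Relation.Binary.PropositionalEquality using (_≡_; _≢_)
open import Relation.Nullary using (¬_)

IsPrimePower : ℕ → Set
IsPrimePower q = ∃[ p ] ∃[ k ] (Prime p × k ≥ 1 × q ≡ p ^ k)

-- A block (3-subset) of Fin v, represented canonically as an increasing triple.
record Triple (v : ℕ) : Set where
  constructor triple
  field
    a b c : Fin v
    a<b : toℕ a < toℕ b
    b<c : toℕ b < toℕ c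
open Triple public

_∈ᵇ_ : {v : ℕ} → Fin v → Triple v → Set
x ∈ᵇ t = (x ≡ a t) Data.Sum.⊎ ((x ≡ b t) Data.Sum.⊎ (x ≡ c t))
  where import Data.Sum

IsSTS : (v : ℕ) → List (Triple v) → Set
IsSTS v B =
  Unique B ×
  ((x y : Fin v) → x ≢ y →
     (∃[ t ] (t ∈ B × x ∈ᵇ t × y ∈ᵇ t)) ×
     ((t u : Triple v) → t ∈ B → u ∈ B →
        x ∈ᵇ t → y ∈ᵇ t → x ∈ᵇ u → y ∈ᵇ u → t ≡ u))

IsParallelClass : (v : ℕ) → List (Triple v) → Set
IsParallelClass v P =
  Unique P ×
  ((x : Fin v) →
     (∃[ t ] (t ∈ P × x ∈ᵇ t)) ×
     ((t u : Triple v) → t ∈ P → u ∈ P → x ∈ᵇ t → x ∈ᵇ u → t ≡ u))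

IsResolvable : (v : ℕ) → List (Triple v) → Set
IsResolvable v B =
  ∃[ R ] (All (IsParallelClass v) R × concat R ↭ B)

IsKTS : (v : ℕ) → List (Triple v) → Set
IsKTS v B = IsSTS v B × IsResolvable v B

Disjoint : {v : ℕ} → List (Triple v) → List (Triple v) → Set
Disjoint B C = ∀ t → t ∈ B → ¬ (t ∈ C)

LKTS : ℕ → Set
LKTS v =
  Σ[ S ∈ (Fin (v ∸ 2) → List (Triple v)) ]
    (((i : Fin (v ∸ 2)) → IsKTS v (S i)) ×
     ((i j : Fin (v ∸ 2)) → i ≢ j → Disjoint (S i) (S j)))

{-# OPTIONS --safe #-}

-- Let F = GF(q) with q = 6t + 1, let ω ∈ F be a primitive cube root of unity and V = Fⁿ. The new
-- systems live on V ∪ {∞₁, ∞₂} and are indexed by x ∈ V; the given ones, on F ∪ {∞₁, ∞₂}, are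
-- indexed so that the one at a ∈ F contains {∞₁, ∞₂, a}. For a line ℓ = x + ⟨e⟩, with e normalised to
-- have leading entry 1, the entry of a point at the position of this 1 identifies ℓ with F, and the
-- system at x contains on ℓ ∪ {∞₁, ∞₂} the copy of the given system at the coordinate of x. Its other
-- blocks are the non-collinear triples with centroid x, so a block determines x.
--
-- A parallel class of the system at x joins the classes through {∞₁, ∞₂, x} on all lines through x.
-- The remaining 3t classes on a line ℓ = x + ⟨e⟩ are extended to V by non-collinear triples: class j
-- uses the orbits of the map x + v ↦ x + ωv + βⱼ d(v, e)⁻¹ e of order three, where β₁, …, β₃ₜ represent
-- the non-zero elements of F up to sign and d is an alternating Plücker coordinate. If w is the image
-- of v then d(v, w) = βⱼ, so a pair v, w of independent vectors is joined in exactly one class: j and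
-- the orientation are determined by d(v, w) = ± βⱼ, and e by w - ωv (or v - ωw).
--
-- The field is obtained from the group algebra over ℤ/p of a cyclic group of order q - 1. There
-- y^q = y for all y, so powers y^(q-1) are idempotent, and a suitable idempotent e cuts out a quotient
-- in which the generator still has order q - 1 and every element is zero or one of its powers.

module Submission where

open import Algebra.Bundles using (CommutativeRing)
open import Algebra.Structures using (IsCommutativeRing)
open import Data.Empty using (⊥-elim)
open import Data.Fin.Base as Fin using (Fin; toℕ; punchIn; punchOut; combine; remQuot; splitAt; join; _↑ˡ_; _↑ʳ_)
import Data.Fin.Properties as Fin
open import Data.Integer.Base as ℤ using (ℤ; -[1+_]) renaming (+_ to pos)
import Data.Integer.Divisibility.Signed as ℤ∣
import Data.Integer.Properties as ℤ
open import Data.Integer.Tactic.RingSolver using (solve-∀)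
open import Data.List.Base as List
  using (List; []; _∷_; _++_; map; concat; length; lookup; deduplicate; allFin; cartesianProduct)
open import Data.List.Membership.Propositional using (_∈_)
open import Data.List.Membership.Propositional.Properties
  using (∈-map⁺; ∈-map⁻; ∈-++⁺ˡ; ∈-++⁺ʳ; ∈-concat⁺′; ∈-concat⁻; ∈-concat⁻′; ∈-lookup; ∈-tabulate⁺; ∈-allFin;
         ∈-cartesianProduct⁺; ∈-cartesianProductWith⁺; ∈-deduplicate⁺; ∈-deduplicate⁻)
open import Data.List.Relation.Binary.Permutation.Propositional using (↭-refl; ↭-sym; ↭⇒↭ₛ)
open import Data.List.Relation.Binary.Permutation.Propositional.Properties using (∈-resp-↭)
import Data.List.Relation.Binary.Permutation.Setoid.Properties as ↭ₛ
open import Data.List.Relation.Unary.All as All using (All; []; _∷_)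
import Data.List.Relation.Unary.All.Properties as All
import Data.List.Relation.Unary.AllPairs as AllPairs
import Data.List.Relation.Unary.AllPairs.Properties as AllPairs
import Data.List.Relation.Unary.Any as Any
open import Data.List.Relation.Unary.Any.Properties using (lookup-index)
open import Data.List.Relation.Unary.Unique.Propositional using (Unique)
import Data.List.Relation.Unary.Unique.DecPropositional.Properties as UniqueDec
import Data.List.Relation.Unary.Unique.Propositional.Properties as Unique
open import Data.Maybe.Base using (Maybe; just; nothing)
open import Data.Maybe.Properties using (just-injective)
open import Data.Nat.Base as ℕ using (ℕ; zero; suc; _!; _≤_; _<_; _∸_; s≤s; z≤n; NonZero)
open import Data.Nat.Combinatorics using (_C_; nCk≡n!/k![n-k]!; k![n∸k]!∣n!; nCn≡1)
open import Data.Nat.Divisibility as Div using (_∣_; divides; ∣⇒≤; m∣m*n; m%n≡0⇒n∣m)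
open import Data.Nat.DivMod using (_%_; _/_; m≡m%n+[m/n]*n; m%n<n; [m+n]%n≡m%n; m/n*n≡m)
open import Data.Nat.GCD using (gcd; gcd-GCD; gcd[m,n]∣m; gcd[m,n]∣n; module Bézout)
open import Data.Nat.ListAction using (product)
open import Data.Nat.Primality using (Prime; prime?; euclidsLemma; prime⇒nonZero; prime⇒nonTrivial)
open import Data.Nat.Primality.Factorisation using (factorise)
import Data.Nat.Properties as ℕ
import Data.Nat.Tactic.RingSolver as ℕ-Solver
open import Data.Product.Base using (∃-syntax; _×_; _,_; proj₁; proj₂)
open import Data.Sum.Base using (_⊎_; inj₁; inj₂; [_,_]′)
open import Data.Vec.Base as Vec using (Vec; []; _∷_)
open import Data.Vec.Properties using (∷-injective)
open import Defs using (IsPrimePower)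
open import Function.Bundles using (_↔_; Inverse; mk↔ₛ′)
open import Level using (0ℓ)
open import Relation.Binary.Definitions using (tri<; tri≈; tri>; DecidableEquality)
open import Relation.Binary.PropositionalEquality as ≡
  using (_≡_; _≢_; refl; sym; trans; cong; cong₂; subst; subst₂)
open import Relation.Nullary using (¬_; Dec; yes; no)

-- The finite field of order q

-- A fixed Plücker coordinate vanishes on some independent pairs, hence `d` is the first non-zero
-- one. It depends on v ∧ w only and vanishes exactly on dependent pairs, but it is not bilinear:
-- the computations with it rest on homogeneity, antisymmetry and invariance under shears. The
-- congruence q ≡ 1 (mod 6) has three effects. It provides ω, and 1 + ω + ω² = 0 makes x the
-- centroid of each orbit; it makes 3 invertible, so that the centroid is determined; and it matches
-- two counts: a given system has (q + 1)/2 = 3t + 1 classes, one of them holding {∞₁, ∞₂, a}, while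
-- F has 3t pairs ± β. The group algebra has several residue fields, and in some of them the
-- generator has smaller order, for instance 1. The idempotent is therefore taken below a power of
-- an element `ε` ≠ 0 that is a multiple of 1 - 𝕏^((q-1)/ℓ) for every prime ℓ dividing q - 1. Where
-- `ε` is invertible, none of these factors vanishes.

module IntegerSolver (R : CommutativeRing 0ℓ 0ℓ) where
  open CommutativeRing R hiding (refl; sym; trans)
  open CommutativeRing R using () renaming (refl to ≈-refl; sym to ≈-sym; trans to ≈-trans)
  open import Algebra.Solver.Ring.AlmostCommutativeRing
    using (fromCommutativeRing; _-Raw-AlmostCommutative⟶_)
  open import Algebra.Properties.Ring ring
    using (-0#≈0#; -‿distribˡ-*; -‿distribʳ-*; -‿involutive; -‿+-comm)
  open import Algebra.Properties.Semiring.Mult.TCOptimised semiring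
    using (1+×; ×-homo-+; ×1-homo-*) renaming (_×_ to _×′_)
  open import Relation.Binary.Reasoning.Setoid setoid

  -- Solver coefficients are integers and are compared in ℤ, so numerals and signs can be normalised
  -- in a ring whose own equality is not assumed decidable.
  fromℤ : ℤ → Carrier
  fromℤ (pos n)    = n ×′ 1#
  fromℤ -[1+ n ] = - (suc n ×′ 1#)

  private
    ⊖-homo : ∀ m n → fromℤ (m ℤ.⊖ n) ≈ m ×′ 1# + - (n ×′ 1#)
    ⊖-homo zero    zero    = ≈-sym (-‿inverseʳ 0#)
    ⊖-homo zero    (suc n) = ≈-sym (+-identityˡ _)
    ⊖-homo (suc m) zero    = ≈-sym (≈-trans (+-congˡ -0#≈0#) (+-identityʳ _))
    ⊖-homo (suc m) (suc n) = begin
      fromℤ (suc m ℤ.⊖ suc n)          ≡⟨ cong fromℤ (ℤ.[1+m]⊖[1+n]≡m⊖n m n) ⟩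
      fromℤ (m ℤ.⊖ n)                  ≈⟨ ⊖-homo m n ⟩
      a + - b                          ≈⟨ +-congʳ (+-identityˡ a) ⟨
      0# + a + - b                     ≈⟨ +-congʳ (+-congʳ (-‿inverseʳ 1#)) ⟨
      1# + - 1# + a + - b              ≈⟨ +-congʳ (≈-trans (+-assoc _ _ _) (≈-trans (+-congˡ (+-comm _ _)) (≈-sym (+-assoc _ _ _)))) ⟩
      1# + a + - 1# + - b              ≈⟨ +-assoc _ _ _ ⟩
      1# + a + (- 1# + - b)            ≈⟨ +-congˡ (-‿+-comm 1# b) ⟩
      1# + a + - (1# + b)              ≈⟨ +-cong (1+× m 1#) (-‿cong (1+× n 1#)) ⟨
      suc m ×′ 1# + - (suc n ×′ 1#)      ∎
      where
      a = m ×′ 1#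
      b = n ×′ 1#

    +-homo : ∀ i j → fromℤ (i ℤ.+ j) ≈ fromℤ i + fromℤ j
    +-homo (pos m)    (pos n)    = ×-homo-+ 1# m n
    +-homo (pos m)    -[1+ n ] = ⊖-homo m (suc n)
    +-homo -[1+ m ] (pos n)    = ≈-trans (⊖-homo n (suc m)) (+-comm _ _)
    +-homo -[1+ m ] -[1+ n ] = begin
      - (suc (suc (m ℕ.+ n)) ×′ 1#)        ≡⟨ cong (λ k → - (k ×′ 1#)) (ℕ.+-suc (suc m) n) ⟨
      - ((suc m ℕ.+ suc n) ×′ 1#)          ≈⟨ -‿cong (×-homo-+ 1# (suc m) (suc n)) ⟩
      - (suc m ×′ 1# + suc n ×′ 1#)         ≈⟨ -‿+-comm _ _ ⟨
      - (suc m ×′ 1#) + - (suc n ×′ 1#)     ∎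

    -‿homo : ∀ i → fromℤ (ℤ.- i) ≈ - fromℤ i
    -‿homo (pos zero)  = ≈-sym -0#≈0#
    -‿homo (pos (suc n)) = ≈-refl
    -‿homo -[1+ n ]  = ≈-sym (-‿involutive _)

    *-homo⁺ : ∀ m n → fromℤ (pos m ℤ.* pos n) ≈ fromℤ (pos m) * fromℤ (pos n)
    *-homo⁺ m n = ≈-trans (reflexive (cong fromℤ (≡.sym (ℤ.pos-* m n)))) (×1-homo-* m n)

    *-homo : ∀ i j → fromℤ (i ℤ.* j) ≈ fromℤ i * fromℤ j
    *-homo (pos m) (pos n) = *-homo⁺ m n
    *-homo (pos m) -[1+ n ] = begin
      fromℤ (pos m ℤ.* ℤ.- pos (suc n))       ≡⟨ cong fromℤ (ℤ.neg-distribʳ-* (pos m) (pos (suc n))) ⟨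
      fromℤ (ℤ.- (pos m ℤ.* pos (suc n)))     ≈⟨ -‿homo (pos m ℤ.* pos (suc n)) ⟩
      - fromℤ (pos m ℤ.* pos (suc n))         ≈⟨ -‿cong (*-homo⁺ m (suc n)) ⟩
      - (m ×′ 1# * (suc n ×′ 1#))         ≈⟨ -‿distribʳ-* _ _ ⟩
      m ×′ 1# * - (suc n ×′ 1#)           ∎
    *-homo -[1+ m ] (pos n) = begin
      fromℤ (ℤ.- pos (suc m) ℤ.* pos n)       ≡⟨ cong fromℤ (ℤ.neg-distribˡ-* (pos (suc m)) (pos n)) ⟨
      fromℤ (ℤ.- (pos (suc m) ℤ.* pos n))     ≈⟨ -‿homo (pos (suc m) ℤ.* pos n) ⟩
      - fromℤ (pos (suc m) ℤ.* pos n)         ≈⟨ -‿cong (*-homo⁺ (suc m) n) ⟩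
      - (suc m ×′ 1# * (n ×′ 1#))         ≈⟨ -‿distribˡ-* _ _ ⟩
      - (suc m ×′ 1#) * (n ×′ 1#)         ∎
    *-homo -[1+ m ] -[1+ n ] = begin
      fromℤ (pos (suc m) ℤ.* pos (suc n))             ≈⟨ *-homo⁺ (suc m) (suc n) ⟩
      suc m ×′ 1# * (suc n ×′ 1#)               ≈⟨ -‿involutive _ ⟨
      - - (suc m ×′ 1# * (suc n ×′ 1#))         ≈⟨ -‿cong (-‿distribˡ-* _ _) ⟩
      - (- (suc m ×′ 1#) * (suc n ×′ 1#))       ≈⟨ -‿distribʳ-* _ _ ⟩
      - (suc m ×′ 1#) * - (suc n ×′ 1#)         ∎

    morphism : ℤ.+-*-rawRing -Raw-AlmostCommutative⟶ fromCommutativeRing R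
    morphism = record
      { ⟦_⟧ = fromℤ ; +-homo = +-homo ; *-homo = *-homo ; -‿homo = -‿homo
      ; 0-homo = ≈-refl ; 1-homo = ≈-refl }

    weaklyDecidable : ∀ i j → Maybe (fromℤ i ≈ fromℤ j)
    weaklyDecidable i j with i ℤ.≟ j
    ... | yes i≡j = just (reflexive (cong fromℤ i≡j))
    ... | no  _   = nothing

  open import Algebra.Solver.Ring ℤ.+-*-rawRing (fromCommutativeRing R) morphism weaklyDecidable public
    using (solve; _:=_; _:+_; _:*_; :-_; _:-_; con)

-- Binomial coefficients and the Frobenius map

prime∤! : ∀ {p} → Prime p → ∀ k → k < p → ¬ (p ∣ k !)
prime∤! {p} p-prime zero    _   p∣1 = ℕ.<⇒≱ (ℕ.nonTrivial⇒n>1 p) (∣⇒≤ p∣1)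
  where instance _ = prime⇒nonTrivial p-prime
prime∤! p-prime (suc k) k<p p∣k! with euclidsLemma (suc k) (k !) p-prime p∣k!
... | inj₁ p∣1+k = ℕ.<⇒≱ k<p (∣⇒≤ p∣1+k)
... | inj₂ p∣k!′ = prime∤! p-prime k (ℕ.<-trans (ℕ.n<1+n k) k<p) p∣k!′

-- `p` divides p! = (p C k) · k! (p - k)!, but neither of the factorials k! and (p - k)!.
prime∣C : ∀ {p} → Prime p → ∀ k → 0 < k → k < p → p ∣ p C k
prime∣C {p} p-prime k 0<k k<p with euclidsLemma (p C k) (k ! ℕ.* (p ∸ k) !) p-prime p∣prod
  where
  instance
    _ = k ℕ.!* (p ∸ k) !≢0
  p!≡ : (p C k) ℕ.* (k ! ℕ.* (p ∸ k) !) ≡ p !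
  p!≡ = trans (cong (ℕ._* (k ! ℕ.* (p ∸ k) !)) (nCk≡n!/k![n-k]! (ℕ.<⇒≤ k<p)))
              (m/n*n≡m (k![n∸k]!∣n! (ℕ.<⇒≤ k<p)))
  p∣p! : ∀ {n} → 0 < n → n ∣ n !
  p∣p! {suc n} _ = m∣m*n (n !)
  p∣prod : p ∣ (p C k) ℕ.* (k ! ℕ.* (p ∸ k) !)
  p∣prod = subst (p ∣_) (sym p!≡) (p∣p! (ℕ.<-trans 0<k k<p))
... | inj₁ p∣C = p∣C
... | inj₂ p∣k![p-k]! with euclidsLemma (k !) ((p ∸ k) !) p-prime p∣k![p-k]!
...   | inj₁ p∣k! = ⊥-elim (prime∤! p-prime k k<p p∣k!)
...   | inj₂ p∣[p-k]! = ⊥-elim (prime∤! p-prime (p ∸ k) (ℕ.∸-monoʳ-< 0<k (ℕ.<⇒≤ k<p)) p∣[p-k]!)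


CharDivides : CommutativeRing 0ℓ 0ℓ → ℕ → Set
CharDivides R n = n ×′ 1# ≈ 0#
  where
  open CommutativeRing R
  open import Algebra.Properties.Semiring.Mult semiring renaming (_×_ to _×′_)

module Frobenius (R : CommutativeRing 0ℓ 0ℓ) (p : ℕ) (p-prime : Prime p) (char : CharDivides R p) where
  open CommutativeRing R hiding (refl; sym; trans)
  open CommutativeRing R using () renaming (sym to ≈-sym; trans to ≈-trans)
  open import Algebra.Properties.CommutativeSemiring.Exp commutativeSemiring
  open import Algebra.Properties.Semiring.Mult semiring
    using (×-assocˡ; ×-congʳ; ×-congˡ; ×-assoc-*) renaming (_×_ to _×′_)
  open import Algebra.Properties.Semiring.Sum semiring
    using (sum; sum-init-last; sum-cong-≋; sum-replicate-zero)
  open import Algebra.Properties.CommutativeSemiring.Binomial commutativeSemiring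
    using (theorem; binomialTerm)
  open import Relation.Binary.Reasoning.Setoid setoid

  multiple-vanishes : ∀ n → p ∣ n → ∀ x → n ×′ x ≈ 0#
  multiple-vanishes n (divides k n≡k*p) x = begin
    n ×′ x               ≈⟨ ×-congˡ (trans n≡k*p (ℕ.*-comm k p)) ⟩
    (p ℕ.* k) ×′ x       ≈⟨ ×-assocˡ x p k ⟨
    p ×′ (k ×′ x)        ≈⟨ ×-congʳ p (*-identityˡ (k ×′ x)) ⟨
    p ×′ (1# * k ×′ x)   ≈⟨ ×-assoc-* p 1# (k ×′ x) ⟨
    p ×′ 1# * k ×′ x     ≈⟨ *-congʳ char ⟩
    0# * k ×′ x          ≈⟨ zeroˡ _ ⟩
    0#                   ∎

  ^p-homo-+ : ∀ x y → (x + y) ^ p ≈ x ^ p + y ^ p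
  ^p-homo-+ x y = expand p ≡.refl
    where
    -- `p` is a parameter and cannot be split; a variable equal to it can, which exposes the first
    -- and the last term of the binomial sum.
    expand : ∀ n → n ≡ p → (x + y) ^ n ≈ x ^ n + y ^ n
    expand zero 0≡p = ⊥-elim (ℕ.≢-nonZero⁻¹ p {{prime⇒nonZero p-prime}} (sym 0≡p))
    expand (suc n) ≡.refl = begin
      (x + y) ^ suc n
        ≈⟨ theorem (suc n) x y ⟩
      t Fin.zero + sum (λ i → t (Fin.suc i))
        ≈⟨ +-congˡ (sum-init-last (λ i → t (Fin.suc i))) ⟩
      t Fin.zero + (sum (λ i → t (Fin.suc (Fin.inject₁ i))) + t (Fin.fromℕ (suc n)))
        ≈⟨ +-congˡ (+-congʳ (≈-trans (sum-cong-≋ middle) (sum-replicate-zero n))) ⟩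
      t Fin.zero + (0# + t (Fin.fromℕ (suc n)))
        ≈⟨ +-cong first (≈-trans (+-identityˡ _) last) ⟩
      y ^ suc n + x ^ suc n
        ≈⟨ +-comm _ _ ⟩
      x ^ suc n + y ^ suc n ∎
      where
      t = binomialTerm x y (suc n)
      middle : ∀ (i : Fin n) → t (Fin.suc (Fin.inject₁ i)) ≈ 0#
      middle i = multiple-vanishes _ (prime∣C p-prime (suc (toℕ (Fin.inject₁ i))) ℕ.z<s
        (s≤s (subst (_< n) (sym (Fin.toℕ-inject₁ i)) (Fin.toℕ<n i)))) _
      first : t Fin.zero ≈ y ^ suc n
      first = ≈-trans (+-identityʳ _) (*-identityˡ _)
      last : t (Fin.fromℕ (suc n)) ≈ x ^ suc n
      last rewrite Fin.toℕ-fromℕ n | nCn≡1 (suc n) | ℕ.n∸n≡0 n = ≈-trans (+-identityʳ _) (*-identityʳ _)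

  ^p^k-homo-+ : ∀ k x y → (x + y) ^ (p ℕ.^ k) ≈ x ^ (p ℕ.^ k) + y ^ (p ℕ.^ k)
  ^p^k-homo-+ zero x y = ≈-trans (*-identityʳ _) (≈-sym (+-cong (*-identityʳ x) (*-identityʳ y)))
  ^p^k-homo-+ (suc k) x y = begin
    (x + y) ^ (p ℕ.* p ℕ.^ k)                            ≈⟨ ^-assocʳ (x + y) p (p ℕ.^ k) ⟨
    ((x + y) ^ p) ^ (p ℕ.^ k)                            ≈⟨ ^-congˡ (p ℕ.^ k) (^p-homo-+ x y) ⟩
    (x ^ p + y ^ p) ^ (p ℕ.^ k)                          ≈⟨ ^p^k-homo-+ k (x ^ p) (y ^ p) ⟩
    (x ^ p) ^ (p ℕ.^ k) + (y ^ p) ^ (p ℕ.^ k)            ≈⟨ +-cong (^-assocʳ x p _) (^-assocʳ y p _) ⟩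
    x ^ (p ℕ.^ suc k) + y ^ (p ℕ.^ suc k)                ∎

-- Idempotents and quotients

module _ (R : CommutativeRing 0ℓ 0ℓ) where
  open CommutativeRing R hiding (refl; sym; trans)
  open CommutativeRing R using () renaming (refl to ≈-refl; sym to ≈-sym; trans to ≈-trans)
  open import Relation.Binary.Reasoning.Setoid setoid
  open IntegerSolver R using (solve; _:=_; _:*_)

  module _ (e : Carrier) where

    -- The quotient by the annihilator of e.
    quotientRing : CommutativeRing 0ℓ 0ℓ
    quotientRing = record
      { Carrier = Carrier
      ; _≈_ = λ a b → e * a ≈ e * b
      ; _+_ = _+_ ; _*_ = _*_ ; -_ = -_ ; 0# = 0# ; 1# = 1#
      ; isCommutativeRing = record
        { isRing = record
          { +-isAbelianGroup = record
            { isGroup = record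
              { isMonoid = record
                { isSemigroup = record
                  { isMagma = record
                    { isEquivalence = record { refl = ≈-refl ; sym = ≈-sym ; trans = ≈-trans }
                    ; ∙-cong = λ p q → ≈-trans (distribˡ _ _ _) (≈-trans (+-cong p q) (≈-sym (distribˡ _ _ _))) }
                  ; assoc = λ a b c → *-congˡ (+-assoc a b c) }
                ; identity = (λ a → *-congˡ (+-identityˡ a)) , (λ a → *-congˡ (+-identityʳ a)) }
              ; inverse = (λ a → *-congˡ (-‿inverseˡ a)) , (λ a → *-congˡ (-‿inverseʳ a))
              ; ⁻¹-cong = λ p → ≈-trans (≈-sym (-‿distribʳ-* _ _)) (≈-trans (-‿cong p) (-‿distribʳ-* _ _)) }
            ; comm = λ a b → *-congˡ (+-comm a b) }
          ; *-cong = λ {a} {b} {c} {d} p q → ≈-trans (≈-sym (*-assoc e a c)) (≈-trans (*-congʳ p)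
              (≈-trans (swap e b c) (≈-trans (*-congʳ q) (≈-trans (swap e d b) (*-assoc e b d)))))
          ; *-assoc = λ a b c → *-congˡ (*-assoc a b c)
          ; *-identity = (λ a → *-congˡ (*-identityˡ a)) , (λ a → *-congˡ (*-identityʳ a))
          ; distrib = (λ a b c → *-congˡ (distribˡ a b c)) , (λ a b c → *-congˡ (distribʳ a b c)) }
        ; *-comm = λ a b → *-congˡ (*-comm a b) } }
      where
      open import Algebra.Properties.Ring ring using (-‿distribʳ-*)
      swap : ∀ a b c → a * b * c ≈ a * c * b
      swap = solve 3 (λ a b c → a :* b :* c := a :* c :* b) ≈-refl

    quotientRing-≈ : ∀ {a b} → a ≈ b → CommutativeRing._≈_ quotientRing a b
    quotientRing-≈ = *-congˡ

  open import Algebra.Properties.CommutativeSemiring.Exp commutativeSemiring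

  module Separation (≈0? : ∀ x → Dec (x ≈ 0#)) (m : ℕ) (^q≈id : ∀ x → x ^ suc (suc m) ≈ x) where

    NonzeroIdempotent : Carrier → Set
    NonzeroIdempotent e = e * e ≈ e × ¬ (e ≈ 0#)

    power-idempotent : ∀ x → x ^ suc m * x ^ suc m ≈ x ^ suc m
    power-idempotent x = begin
      (x * x ^ m) * (x * x ^ m)      ≈⟨ solve 2 (λ a b → (a :* b) :* (a :* b) := (a :* (a :* b)) :* b) ≈-refl x (x ^ m) ⟩
      x ^ suc (suc m) * x ^ m        ≈⟨ *-congʳ (^q≈id x) ⟩
      x * x ^ m                      ∎

    power-nonzero : ∀ {x} → ¬ (x ≈ 0#) → ¬ (x ^ suc m ≈ 0#)
    power-nonzero {x} x≉0 x^m≈0 = x≉0 (begin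
      x               ≈⟨ ^q≈id x ⟨
      x * x ^ suc m   ≈⟨ *-congˡ x^m≈0 ⟩
      x * 0#          ≈⟨ zeroʳ x ⟩
      0#              ∎)

    -- In the quotient by the annihilator of `e`, the element `x` is zero or has the inverse
    -- `x ^ m`.
    ZeroOrUnit : Carrier → Carrier → Set
    ZeroOrUnit e x = e * x ≈ 0# ⊎ e * x ^ suc m ≈ e

    -- The power `g = x ^ suc m` is idempotent and acts as the identity on `x`. If `e * g` is zero,
    -- then `x` vanishes in the quotient; otherwise `e` is replaced by `e * g`, where `x` is a unit.
    -- Later refinements keep what has been achieved, because `f * e ≈ f`.
    refine : ∀ e → NonzeroIdempotent e → (xs : List Carrier) →
             ∃[ f ] (NonzeroIdempotent f × f * e ≈ f × All (ZeroOrUnit f) xs)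
    refine e e-idem [] = e , e-idem , proj₁ e-idem , []
    refine e (ee≈e , e≉0) (x ∷ xs) with ≈0? (e * x ^ suc m)
    ... | yes ex^m≈0 =
      let f , f-idem , fe≈f , all = refine e (ee≈e , e≉0) xs in
      f , f-idem , fe≈f , inj₁ (begin
        f * x                              ≈⟨ *-cong fe≈f (^q≈id x) ⟨
        f * e * (x * x ^ suc m)            ≈⟨ solve 4 (λ a b c d → a :* b :* (c :* d) := a :* c :* (b :* d)) ≈-refl f e x (x ^ suc m) ⟩
        f * x * (e * x ^ suc m)            ≈⟨ *-congˡ ex^m≈0 ⟩
        f * x * 0#                         ≈⟨ zeroʳ _ ⟩
        0#                                 ∎) ∷ all
    ... | no ex^m≉0 =
      let g = x ^ suc m
          f , f-idem , feg≈f , all = refine (e * g) (eg-idem , ex^m≉0) xs in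
      f , f-idem , (begin
        f * e                 ≈⟨ *-congʳ feg≈f ⟨
        f * (e * g) * e       ≈⟨ solve 3 (λ a b c → a :* (b :* c) :* b := a :* (b :* b :* c)) ≈-refl f e g ⟩
        f * (e * e * g)       ≈⟨ *-congˡ (*-congʳ ee≈e) ⟩
        f * (e * g)           ≈⟨ feg≈f ⟩
        f                     ∎) , inj₂ (begin
        f * g                 ≈⟨ *-congʳ feg≈f ⟨
        f * (e * g) * g       ≈⟨ solve 3 (λ a b c → a :* (b :* c) :* c := a :* (b :* (c :* c))) ≈-refl f e g ⟩
        f * (e * (g * g))     ≈⟨ *-congˡ (*-congˡ (power-idempotent x)) ⟩
        f * (e * g)           ≈⟨ feg≈f ⟩
        f                     ∎) ∷ all
      where
      eg-idem : (e * x ^ suc m) * (e * x ^ suc m) ≈ e * x ^ suc m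
      eg-idem = ≈-trans
        (solve 2 (λ a b → (a :* b) :* (a :* b) := (a :* a) :* (b :* b)) ≈-refl e (x ^ suc m))
        (*-cong ee≈e (power-idempotent x))

-- Roots of unity and geometric sums

search : ∀ {n} {P Q : Fin n → Set} → (∀ i → P i ⊎ Q i) → (∃[ i ] P i) ⊎ (∀ i → Q i)
search {zero} _ = inj₂ λ ()
search {suc n} P⊎Q with P⊎Q Fin.zero | search (λ i → P⊎Q (Fin.suc i))
... | inj₁ p | _              = inj₁ (Fin.zero , p)
... | inj₂ _ | inj₁ (i , p)   = inj₁ (Fin.suc i , p)
... | inj₂ q | inj₂ all-q     = inj₂ λ { Fin.zero → q ; (Fin.suc i) → all-q i }

module RootOfUnity (R : CommutativeRing 0ℓ 0ℓ) where
  open CommutativeRing R hiding (refl; sym; trans)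
  open CommutativeRing R using () renaming (refl to ≈-refl; sym to ≈-sym; trans to ≈-trans)
  open import Algebra.Properties.CommutativeSemiring.Exp commutativeSemiring
  open import Algebra.Properties.Semiring.Mult semiring using () renaming (_×_ to _×′_)
  open import Algebra.Properties.Semiring.Sum semiring
  open import Relation.Binary.Reasoning.Setoid setoid
  open IntegerSolver R using (solve; _:=_; _:+_; _:*_; :-_; _:-_; con)

  1^n≈1 : ∀ n → 1# ^ n ≈ 1#
  1^n≈1 zero = ≈-refl
  1^n≈1 (suc n) = ≈-trans (*-identityˡ _) (1^n≈1 n)

  ^-swap : ∀ x a b → (x ^ a) ^ b ≈ (x ^ b) ^ a
  ^-swap x a b = ≈-trans (^-assocʳ x a b) (≈-trans (^-congʳ x (ℕ.*-comm a b)) (≈-sym (^-assocʳ x b a)))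

  ^-mod : ∀ {x} m .{{_ : NonZero m}} → x ^ m ≈ 1# → ∀ n → x ^ n ≈ x ^ (n % m)
  ^-mod {x} m x^m≈1 n = begin
    x ^ n                                   ≈⟨ ^-congʳ x (trans (m≡m%n+[m/n]*n n m) (cong (n % m ℕ.+_) (ℕ.*-comm (n / m) m))) ⟩
    x ^ (n % m ℕ.+ m ℕ.* (n / m))           ≈⟨ ^-homo-* x (n % m) (m ℕ.* (n / m)) ⟩
    x ^ (n % m) * x ^ (m ℕ.* (n / m))       ≈⟨ *-congˡ (^-assocʳ x m (n / m)) ⟨
    x ^ (n % m) * (x ^ m) ^ (n / m)         ≈⟨ *-congˡ (≈-trans (^-congˡ (n / m) x^m≈1) (1^n≈1 (n / m))) ⟩
    x ^ (n % m) * 1#                        ≈⟨ *-identityʳ _ ⟩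
    x ^ (n % m)                             ∎

  powers : Carrier → ∀ n → Fin n → Carrier
  powers z n i = z ^ toℕ i

  geometric : ∀ z n → (1# - z) * sum (powers z n) ≈ 1# - z ^ n
  geometric z zero = ≈-trans (zeroʳ _) (≈-sym (-‿inverseʳ 1#))
  geometric z (suc n) = begin
    (1# - z) * (1# + sum {n} (λ i → z * z ^ toℕ i))
      ≈⟨ *-congˡ (+-congˡ (*-distribˡ-sum z (powers z n))) ⟨
    (1# - z) * (1# + z * sum (powers z n))
      ≈⟨ solve 2 (λ z s → (con ℤ.1ℤ :- z) :* (con ℤ.1ℤ :+ z :* s) := con ℤ.1ℤ :- z :+ z :* ((con ℤ.1ℤ :- z) :* s)) ≈-refl z (sum (powers z n)) ⟩
    1# - z + z * ((1# - z) * sum (powers z n))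
      ≈⟨ +-congˡ (*-congˡ (geometric z n)) ⟩
    1# - z + z * (1# - z ^ n)
      ≈⟨ solve 2 (λ z w → con ℤ.1ℤ :- z :+ z :* (con ℤ.1ℤ :- w) := con ℤ.1ℤ :- z :* w) ≈-refl z (z ^ n) ⟩
    1# - z * z ^ n ∎

  module _ (m : ℕ) where

    ZeroOrRoot : Carrier → Set
    ZeroOrRoot x = x ≈ 0# ⊎ x ^ suc m ≈ 1#

    -- By the geometric series `1# - z` annihilates the sum, and it can be cancelled as a unit. That
    -- it is non-zero would not suffice, since zero divisors are not excluded here.
    root-sum-vanishes : ∀ {z} → z ^ suc m ≈ 1# → (1# - z) ^ suc m ≈ 1# → sum (powers z (suc m)) ≈ 0#
    root-sum-vanishes {z} z^m≈1 unit = begin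
      s                                       ≈⟨ *-identityˡ s ⟨
      1# * s                                  ≈⟨ *-congʳ unit ⟨
      (1# - z) ^ suc m * s                    ≈⟨ solve 3 (λ a b s → a :* b :* s := b :* (a :* s)) ≈-refl (1# - z) ((1# - z) ^ m) s ⟩
      (1# - z) ^ m * ((1# - z) * s)           ≈⟨ *-congˡ (geometric z (suc m)) ⟩
      (1# - z) ^ m * (1# - z ^ suc m)         ≈⟨ *-congˡ (+-congˡ (-‿cong z^m≈1)) ⟩
      (1# - z) ^ m * (1# - 1#)                ≈⟨ *-congˡ (-‿inverseʳ 1#) ⟩
      (1# - z) ^ m * 0#                       ≈⟨ zeroʳ _ ⟩
      0#                                      ∎
      where s = sum (powers z (suc m))

    module _ (ζ : Carrier) (ζ^m≈1 : ζ ^ suc m ≈ 1#) (1≉0 : ¬ (1# ≈ 0#)) (q×1≈0 : suc (suc m) ×′ 1# ≈ 0#)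
             (ζ-faithful : ∀ (i : Fin m) → (1# - ζ ^ suc (toℕ i)) ^ suc m ≈ 1#) where

      -- Were every 1 - y ζˡ invertible, all Σⱼ (y ζˡ)ʲ would vanish; but their sum over l is m = -1.
      root-is-power : ∀ {y} → y ^ suc m ≈ 1# → (∀ (l : Fin (suc m)) → ZeroOrRoot (1# - y * ζ ^ toℕ l)) →
                      ∃[ k ] y ≈ ζ ^ k
      root-is-power {y} y^m≈1 dichotomy with search dichotomy
      ... | inj₁ (l , 1-yζˡ≈0) = suc m ∸ toℕ l , (begin
        y                                               ≈⟨ *-identityʳ y ⟨
        y * 1#                                          ≈⟨ *-congˡ ζ^m≈1 ⟨
        y * ζ ^ suc m                                   ≈⟨ *-congˡ (^-congʳ ζ (sym (ℕ.m+[n∸m]≡n (ℕ.<⇒≤ (Fin.toℕ<n l))))) ⟩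
        y * ζ ^ (toℕ l ℕ.+ (suc m ∸ toℕ l))             ≈⟨ *-congˡ (^-homo-* ζ (toℕ l) _) ⟩
        y * (ζ ^ toℕ l * ζ ^ (suc m ∸ toℕ l))           ≈⟨ *-assoc _ _ _ ⟨
        y * ζ ^ toℕ l * ζ ^ (suc m ∸ toℕ l)             ≈⟨ solve 2 (λ a b → a :* b := b :- (con ℤ.1ℤ :- a) :* b) ≈-refl (y * ζ ^ toℕ l) (ζ ^ (suc m ∸ toℕ l)) ⟩
        w - (1# - y * ζ ^ toℕ l) * w                    ≈⟨ +-congˡ (-‿cong (*-congʳ 1-yζˡ≈0)) ⟩
        w - 0# * w                                      ≈⟨ solve 1 (λ w → w :- con ℤ.0ℤ :* w := w) ≈-refl w ⟩
        w ∎)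
        where w = ζ ^ (suc m ∸ toℕ l)
      ... | inj₂ units = ⊥-elim (1≉0 (begin
        1#                                    ≈⟨ +-identityʳ 1# ⟨
        1# + 0#                               ≈⟨ +-congˡ sum-vanishes ⟨
        1# + suc m ×′ 1#                      ≈⟨ q×1≈0 ⟩
        0#                                    ∎))
        where
        term : Fin (suc m) → Fin (suc m) → Carrier
        term l j = (y * ζ ^ toℕ l) ^ toℕ j
        rows : ∀ l → sum (term l) ≈ 0#
        rows l = root-sum-vanishes (begin
          (y * ζ ^ toℕ l) ^ suc m                ≈⟨ ^-distrib-* y (ζ ^ toℕ l) (suc m) ⟩
          y ^ suc m * (ζ ^ toℕ l) ^ suc m        ≈⟨ *-cong y^m≈1 (^-swap ζ (toℕ l) (suc m)) ⟩
          1# * (ζ ^ suc m) ^ toℕ l               ≈⟨ *-identityˡ _ ⟩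
          (ζ ^ suc m) ^ toℕ l                    ≈⟨ ≈-trans (^-congˡ (toℕ l) ζ^m≈1) (1^n≈1 (toℕ l)) ⟩
          1#                                     ∎) (units l)
        column : ∀ j → sum (λ l → term l j) ≈ y ^ toℕ j * sum (powers (ζ ^ toℕ j) (suc m))
        column j = begin
          sum {suc m} (λ l → (y * ζ ^ toℕ l) ^ toℕ j)
            ≈⟨ sum-cong-≋ {suc m} (λ l → ≈-trans (^-distrib-* y _ (toℕ j)) (*-congˡ (^-swap ζ (toℕ l) (toℕ j)))) ⟩
          sum {suc m} (λ l → y ^ toℕ j * (ζ ^ toℕ j) ^ toℕ l)
            ≈⟨ *-distribˡ-sum (y ^ toℕ j) (powers (ζ ^ toℕ j) (suc m)) ⟨
          y ^ toℕ j * sum (powers (ζ ^ toℕ j) (suc m)) ∎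
        column-0 : sum (λ l → term l Fin.zero) ≈ suc m ×′ 1#
        column-0 = sum-replicate (suc m)
        column-suc : ∀ j → sum (λ l → term l (Fin.suc j)) ≈ 0#
        column-suc j = ≈-trans (column (Fin.suc j)) (≈-trans (*-congˡ (root-sum-vanishes
          (≈-trans (^-swap ζ (suc (toℕ j)) (suc m)) (≈-trans (^-congˡ (suc (toℕ j)) ζ^m≈1) (1^n≈1 (suc (toℕ j)))))
          (ζ-faithful j))) (zeroʳ _))
        sum-vanishes : suc m ×′ 1# ≈ 0#
        sum-vanishes = begin
          suc m ×′ 1#                                                             ≈⟨ column-0 ⟨
          sum (λ l → term l Fin.zero)                                             ≈⟨ +-identityʳ _ ⟨
          sum (λ l → term l Fin.zero) + 0#                                        ≈⟨ +-congˡ (sum-replicate-zero m) ⟨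
          sum (λ l → term l Fin.zero) + sum {m} (λ _ → 0#)
            ≈⟨ +-congˡ (sum-cong-≋ {m} (λ j → ≈-sym (column-suc j))) ⟩
          sum (λ l → term l Fin.zero) + sum {m} (λ j → sum (λ l → term l (Fin.suc j))) ≈⟨ ∑-comm term ⟨
          sum (λ l → sum (term l))                                                ≈⟨ sum-cong-≋ {suc m} rows ⟩
          sum {suc m} (λ _ → 0#)                                                  ≈⟨ sum-replicate-zero (suc m) ⟩
          0# ∎

-- The group algebra of a cyclic group over ℤ/p

data Poly : Set where
  𝟘 𝟙 𝕏   : Poly
  _⊕_ _⊗_ : Poly → Poly → Poly
  ⊝_      : Poly → Poly

Sequence : Set
Sequence = ℕ → ℤ

-- `𝕏` acts as the shift and a product as a composition. Ring elements being expressions, a property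
-- closed under the operations holds for all of them by induction; `^q≈id` and `power` are obtained
-- in this way.
⟦_⟧ : Poly → Sequence → Sequence
⟦ 𝟘 ⟧ s i     = ℤ.0ℤ
⟦ 𝟙 ⟧ s i     = s i
⟦ 𝕏 ⟧ s i     = s (suc i)
⟦ a ⊕ b ⟧ s i = ⟦ a ⟧ s i ℤ.+ ⟦ b ⟧ s i
⟦ a ⊗ b ⟧ s   = ⟦ a ⟧ (⟦ b ⟧ s)
⟦ ⊝ a ⟧ s i   = ℤ.- ⟦ a ⟧ s i

indicator₀ : Sequence
indicator₀ zero    = ℤ.1ℤ
indicator₀ (suc _) = ℤ.0ℤ

-- Applying an expression to `δ m` lists its coefficients: entry `i` of `⟦ a ⟧ (δ m)` is the
-- coefficient of 𝕏⁻ⁱ in `a`, with exponents modulo m + 1.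
δ : (m : ℕ) → Sequence
δ m i = indicator₀ (i % suc m)

module CyclicAlgebra (p m : ℕ) where

  infix 4 _~_ _≃_

  -- A record, so that `x` and `y` can be inferred from a congruence; their difference alone does
  -- not determine them.
  record _~_ (x y : ℤ) : Set where
    constructor mod
    field difference : pos p ℤ∣.∣ x ℤ.- y
  open _~_

  ~-reflexive : ∀ {x y} → x ≡ y → x ~ y
  ~-reflexive {x} refl = mod (ℤ∣.divides ℤ.0ℤ (ℤ.+-inverseʳ x))

  ~-refl : ∀ {x} → x ~ x
  ~-refl = ~-reflexive refl

  ~-sym : ∀ {x y} → x ~ y → y ~ x
  ~-sym {x} {y} (mod d) = mod (subst (pos p ℤ∣.∣_) (lemma x y) (ℤ∣.∣m⇒∣-m d))
    where
    lemma : ∀ x y → ℤ.- (x ℤ.- y) ≡ y ℤ.- x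
    lemma = solve-∀

  ~-trans : ∀ {x y z} → x ~ y → y ~ z → x ~ z
  ~-trans {x} {y} {z} (mod d) (mod d′) = mod (subst (pos p ℤ∣.∣_) (lemma x y z) (ℤ∣.∣m∣n⇒∣m+n d d′))
    where
    lemma : ∀ x y z → x ℤ.- y ℤ.+ (y ℤ.- z) ≡ x ℤ.- z
    lemma = solve-∀

  ~-+ : ∀ {x y z w} → x ~ y → z ~ w → x ℤ.+ z ~ y ℤ.+ w
  ~-+ {x} {y} {z} {w} (mod d) (mod d′) = mod (subst (pos p ℤ∣.∣_) (lemma x y z w) (ℤ∣.∣m∣n⇒∣m+n d d′))
    where
    lemma : ∀ x y z w → x ℤ.- y ℤ.+ (z ℤ.- w) ≡ x ℤ.+ z ℤ.- (y ℤ.+ w)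
    lemma = solve-∀

  ~-neg : ∀ {x y} → x ~ y → ℤ.- x ~ ℤ.- y
  ~-neg {x} {y} (mod d) = mod (subst (pos p ℤ∣.∣_) (lemma x y) (ℤ∣.∣m⇒∣-m d))
    where
    lemma : ∀ x y → ℤ.- (x ℤ.- y) ≡ ℤ.- x ℤ.- ℤ.- y
    lemma = solve-∀

  ~0? : ∀ x → Dec (x ~ ℤ.0ℤ)
  ~0? x with (pos p) ℤ∣.∣? (x ℤ.- ℤ.0ℤ)
  ... | yes d = yes (mod d)
  ... | no ¬d = no λ { (mod d) → ¬d d }

  _≃_ : Sequence → Sequence → Set
  s ≃ t = ∀ i → s i ~ t i

  act-cong : ∀ a {s t} → s ≃ t → ⟦ a ⟧ s ≃ ⟦ a ⟧ t
  act-cong 𝟘 s≃t i = ~-refl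
  act-cong 𝟙 s≃t i = s≃t i
  act-cong 𝕏 s≃t i = s≃t (suc i)
  act-cong (a ⊕ b) s≃t i = ~-+ (act-cong a s≃t i) (act-cong b s≃t i)
  act-cong (a ⊗ b) s≃t = act-cong a (act-cong b s≃t)
  act-cong (⊝ a) s≃t i = ~-neg (act-cong a s≃t i)

  act-0 : ∀ a → ⟦ a ⟧ (λ _ → ℤ.0ℤ) ≃ (λ _ → ℤ.0ℤ)
  act-0 𝟘 i = ~-refl
  act-0 𝟙 i = ~-refl
  act-0 𝕏 i = ~-refl
  act-0 (a ⊕ b) i = ~-+ (act-0 a i) (act-0 b i)
  act-0 (a ⊗ b) i = ~-trans (act-cong a (act-0 b) i) (act-0 a i)
  act-0 (⊝ a) i = ~-neg (act-0 a i)

  act-+ : ∀ a s t → ⟦ a ⟧ (λ i → s i ℤ.+ t i) ≃ (λ i → ⟦ a ⟧ s i ℤ.+ ⟦ a ⟧ t i)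
  act-+ 𝟘 s t i = ~-refl
  act-+ 𝟙 s t i = ~-refl
  act-+ 𝕏 s t i = ~-refl
  act-+ (a ⊕ b) s t i = ~-trans (~-+ (act-+ a s t i) (act-+ b s t i))
    (~-reflexive (lemma (⟦ a ⟧ s i) (⟦ a ⟧ t i) (⟦ b ⟧ s i) (⟦ b ⟧ t i)))
    where
    lemma : ∀ x y z w → x ℤ.+ y ℤ.+ (z ℤ.+ w) ≡ x ℤ.+ z ℤ.+ (y ℤ.+ w)
    lemma = solve-∀
  act-+ (a ⊗ b) s t i = ~-trans (act-cong a (act-+ b s t) i) (act-+ a _ _ i)
  act-+ (⊝ a) s t i = ~-trans (~-neg (act-+ a s t i)) (~-reflexive (ℤ.neg-distrib-+ (⟦ a ⟧ s i) (⟦ a ⟧ t i)))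

  act-neg : ∀ a s → ⟦ a ⟧ (λ i → ℤ.- s i) ≃ (λ i → ℤ.- ⟦ a ⟧ s i)
  act-neg 𝟘 s i = ~-refl
  act-neg 𝟙 s i = ~-refl
  act-neg 𝕏 s i = ~-refl
  act-neg (a ⊕ b) s i = ~-trans (~-+ (act-neg a s i) (act-neg b s i))
    (~-reflexive (sym (ℤ.neg-distrib-+ (⟦ a ⟧ s i) (⟦ b ⟧ s i))))
  act-neg (a ⊗ b) s i = ~-trans (act-cong a (act-neg b s) i) (act-neg a _ i)
  act-neg (⊝ a) s i = ~-neg (act-neg a s i)

  act-X : ∀ a s → ⟦ a ⟧ (λ i → s (suc i)) ≃ (λ i → ⟦ a ⟧ s (suc i))
  act-X 𝟘 s i = ~-refl
  act-X 𝟙 s i = ~-refl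
  act-X 𝕏 s i = ~-refl
  act-X (a ⊕ b) s i = ~-+ (act-X a s i) (act-X b s i)
  act-X (a ⊗ b) s i = ~-trans (act-cong a (act-X b s) i) (act-X a _ i)
  act-X (⊝ a) s i = ~-neg (act-X a s i)

  -- Induction on `b`: every expression acts linearly and commutes with the shift, and `b` is built
  -- from the shift by linear operations and composition.
  act-comm : ∀ a b s → ⟦ a ⟧ (⟦ b ⟧ s) ≃ ⟦ b ⟧ (⟦ a ⟧ s)
  act-comm a 𝟘 s i = act-0 a i
  act-comm a 𝟙 s i = ~-refl
  act-comm a 𝕏 s i = act-X a s i
  act-comm a (b ⊕ c) s i = ~-trans (act-+ a _ _ i) (~-+ (act-comm a b s i) (act-comm a c s i))
  act-comm a (b ⊗ c) s i = ~-trans (act-comm a b (⟦ c ⟧ s) i) (act-cong b (act-comm a c s) i)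
  act-comm a (⊝ b) s i = ~-trans (act-neg a _ i) (~-neg (act-comm a b s i))

  infix 4 _≈ₚ_

  record _≈ₚ_ (a b : Poly) : Set where
    constructor pointwise
    field at : ⟦ a ⟧ (δ m) ≃ ⟦ b ⟧ (δ m)
  open _≈ₚ_ public

  -- The group algebra of a cyclic group of order m + 1 over ℤ/p, presented as the
  -- polynomials in 𝕏 modulo the annihilator of δ.
  R : CommutativeRing 0ℓ 0ℓ
  R = record
    { Carrier = Poly
    ; _≈_ = _≈ₚ_
    ; _+_ = _⊕_ ; _*_ = _⊗_ ; -_ = ⊝_ ; 0# = 𝟘 ; 1# = 𝟙
    ; isCommutativeRing = record
      { isRing = record
        { +-isAbelianGroup = record
          { isGroup = record
            { isMonoid = record
              { isSemigroup = record
                { isMagma = record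
                  { isEquivalence = record
                    { refl = pointwise λ _ → ~-refl ; sym = λ e → pointwise λ i → ~-sym (at e i)
                    ; trans = λ e f → pointwise λ i → ~-trans (at e i) (at f i) }
                  ; ∙-cong = λ e f → pointwise λ i → ~-+ (at e i) (at f i) }
                ; assoc = λ a b c → pointwise λ i → ~-reflexive (ℤ.+-assoc (⟦ a ⟧ (δ m) i) _ _) }
              ; identity = (λ a → pointwise λ i → ~-reflexive (ℤ.+-identityˡ _)) , (λ a → pointwise λ i → ~-reflexive (ℤ.+-identityʳ _)) }
            ; inverse = (λ a → pointwise λ i → ~-reflexive (ℤ.+-inverseˡ (⟦ a ⟧ (δ m) i)))
                      , (λ a → pointwise λ i → ~-reflexive (ℤ.+-inverseʳ (⟦ a ⟧ (δ m) i)))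
            ; ⁻¹-cong = λ e → pointwise λ i → ~-neg (at e i) }
          ; comm = λ a b → pointwise λ i → ~-reflexive (ℤ.+-comm (⟦ a ⟧ (δ m) i) _) }
        -- `a` and `a′` agree on `δ m`, but a priori not on `⟦ b ⟧ (δ m)`; commuting the factors
        -- brings the one to be replaced next to `δ m`.
        ; *-cong = λ {a} {a′} {b} {b′} e f → pointwise λ i → ~-trans (act-cong a (at f) i) (~-trans (act-comm a b′ _ i)
            (~-trans (act-cong b′ (at e) i) (act-comm b′ a′ _ i)))
        ; *-assoc = λ a b c → pointwise λ i → ~-refl
        ; *-identity = (λ a → pointwise λ i → ~-refl) , (λ a → pointwise λ i → ~-refl)
        ; distrib = (λ a b c → pointwise λ i → act-+ a _ _ i) , (λ a b c → pointwise λ i → ~-refl) }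
      ; *-comm = λ a b → pointwise λ i → act-comm a b (δ m) i } }

δ-periodic : ∀ m i → δ m (suc m ℕ.+ i) ≡ δ m i
δ-periodic m i = cong indicator₀ (trans (cong (_% suc m) (ℕ.+-comm (suc m) i)) ([m+n]%n≡m%n i (suc m)))

δ-zero : ∀ m i → ¬ (suc m ∣ i) → δ m i ≡ ℤ.0ℤ
δ-zero m i ¬m∣i with i % suc m in eq
... | zero  = ⊥-elim (¬m∣i (m%n≡0⇒n∣m i (suc m) eq))
... | suc _ = refl

module GroupAlgebra (p m k : ℕ) (p-prime : Prime p) (p^k≡q : p ℕ.^ k ≡ suc (suc m)) where
  open CyclicAlgebra p m
  open CommutativeRing R hiding (refl; sym; trans)
  open CommutativeRing R using () renaming (refl to ≈-refl; trans to ≈-trans)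
  open import Algebra.Properties.CommutativeSemiring.Exp commutativeSemiring
  open import Algebra.Properties.Semiring.Mult semiring using () renaming (_×_ to _×′_)
  open import Algebra.Properties.Group +-group using (inverseˡ-unique)
  open import Relation.Binary.Reasoning.Setoid setoid
  open IntegerSolver R using (solve; _:=_; _:*_)
  open RootOfUnity R using (1^n≈1; ^-mod)

  act-^ : ∀ n s i → ⟦ 𝕏 ^ n ⟧ s i ≡ s (n ℕ.+ i)
  act-^ zero    s i = refl
  act-^ (suc n) s i = trans (act-^ n s (suc i)) (cong s (ℕ.+-suc n i))

  X^m≈1 : 𝕏 ^ suc m ≈ 1#
  X^m≈1 = pointwise λ i → ~-reflexive (trans (act-^ (suc m) (δ m) i) (δ-periodic m i))

  act-multiple : ∀ n s i → ⟦ n ×′ 1# ⟧ s i ≡ pos n ℤ.* s i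
  act-multiple zero    s i = refl
  act-multiple (suc n) s i = trans (cong (λ z → s i ℤ.+ z) (act-multiple n s i)) (lemma (pos n) (s i))
    where
    lemma : ∀ n x → x ℤ.+ n ℤ.* x ≡ (ℤ.1ℤ ℤ.+ n) ℤ.* x
    lemma = solve-∀

  char : CharDivides R p
  char = pointwise λ i → mod (ℤ∣.divides (δ m i) (trans (ℤ.+-identityʳ _) (trans (act-multiple p (δ m) i) (ℤ.*-comm (pos p) (δ m i)))))

  open Frobenius R p p-prime char

  coefficient₀-shift : ∀ n a → ⟦ 𝕏 ^ n * a ⟧ (δ m) 0 ≡ ⟦ a ⟧ (δ m) n
  coefficient₀-shift n a = trans (act-^ n (⟦ a ⟧ (δ m)) 0) (cong (⟦ a ⟧ (δ m)) (ℕ.+-identityʳ n))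

  -- The coefficients are periodic because `𝕏 ^ suc m ≈ 1#`, so m + 1 of them decide.
  ≈0? : ∀ a → Dec (a ≈ 0#)
  ≈0? a with Fin.all? (λ (i : Fin (suc m)) → ~0? (⟦ a ⟧ (δ m) (toℕ i)))
  ... | no ¬all = no λ a≈0 → ¬all λ i → at a≈0 (toℕ i)
  ... | yes all = yes (pointwise λ i → ~-trans (~-trans (~-trans
    (~-reflexive (sym (coefficient₀-shift i a)))
    (at (*-congʳ {a} (^-mod (suc m) X^m≈1 i)) 0))
    (~-reflexive (coefficient₀-shift (i % suc m) a)))
    (subst (λ n → ⟦ a ⟧ (δ m) n ~ ℤ.0ℤ) (Fin.toℕ-fromℕ< (m%n<n i (suc m))) (all (Fin.fromℕ< (m%n<n i (suc m))))))

  q-homo-+ : ∀ a b → (a + b) ^ suc (suc m) ≈ a ^ suc (suc m) + b ^ suc (suc m)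
  q-homo-+ = subst (λ q → ∀ a b → (a + b) ^ q ≈ a ^ q + b ^ q) p^k≡q (^p^k-homo-+ k)

  -- Raising to the power q = p^k is additive and multiplicative, and it fixes `𝕏`, whose order
  -- divides q - 1. Negatives follow from (- a)^q + a^q = 0^q, whatever the parity of q.
  ^q≈id : ∀ a → a ^ suc (suc m) ≈ a
  ^q≈id 𝟘 = zeroˡ _
  ^q≈id 𝟙 = 1^n≈1 (suc (suc m))
  ^q≈id 𝕏 = ≈-trans (*-congˡ X^m≈1) (*-identityʳ 𝕏)
  ^q≈id (a ⊕ b) = ≈-trans (q-homo-+ a b) (+-cong (^q≈id a) (^q≈id b))
  ^q≈id (a ⊗ b) = ≈-trans (^-distrib-* a b (suc (suc m))) (*-cong (^q≈id a) (^q≈id b))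
  ^q≈id (⊝ a) = inverseˡ-unique _ _ (begin
    (- a) ^ q + a                  ≈⟨ +-congˡ (^q≈id a) ⟨
    (- a) ^ q + a ^ q              ≈⟨ q-homo-+ (- a) a ⟨
    (- a + a) ^ q                  ≈⟨ ^-congˡ q (-‿inverseˡ a) ⟩
    0# ^ q                         ≈⟨ zeroˡ _ ⟩
    0#                             ∎)
    where
    q = suc (suc m)

  -- `ε-at-0` is an equality in ℤ, so `ε` is non-zero modulo any prime. By `ε-support` the group
  -- elements occurring in `ε` have order dividing `N`, and `N-primes` keeps the next 𝕏^((m+1)/ℓ)
  -- outside the subgroup of such elements. `ε-multiple` is the purpose: where `ε` is invertible,
  -- `𝕏 ^ d` differs from 1.
  record Separator (j : ℕ) : Set where
    field
      ε : Poly
      N : ℕ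
      ε-at-0        : ⟦ ε ⟧ (δ m) 0 ≡ ℤ.1ℤ
      ε-support     : ∀ i → ¬ (suc m ∣ N ℕ.* i) → ⟦ ε ⟧ (δ m) i ≡ ℤ.0ℤ
      N-primes      : ∀ {ℓ} → Prime ℓ → ℓ ∣ N → ℓ < j
      ε-multiple    : ∀ {ℓ} d → Prime ℓ → ℓ < j → suc m ≡ d ℕ.* ℓ → ∃[ b ] ε ≈ (1# - 𝕏 ^ d) * b

  prime∤1 : ∀ {ℓ} → Prime ℓ → ¬ (ℓ ∣ 1)
  prime∤1 = λ ℓ-prime → prime∤! ℓ-prime 0 (ℕ.>-nonZero⁻¹ _ {{prime⇒nonZero ℓ-prime}})

  -- ε is the product of the 1 - 𝕏^((m+1)/ℓ) over the primes ℓ < j dividing m + 1 and N is the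
  -- product of these ℓ. Each factor involves a group element outside the subgroup generated by
  -- the earlier ones, so the coefficient of the identity stays 1.
  separator : ∀ j → Separator j
  separator zero = record
    { ε = 1# ; N = 1 ; ε-at-0 = refl
    ; ε-support = λ i ¬∣ → δ-zero m i λ d → ¬∣ (subst (suc m ∣_) (sym (ℕ.*-identityˡ i)) d)
    ; N-primes = λ ℓ-prime ℓ∣1 → ⊥-elim (prime∤1 ℓ-prime ℓ∣1)
    ; ε-multiple = λ d _ () }
  separator (suc j) with prime? j | j Div.∣? suc m
  ... | no ¬prime | _ = record
    { ε = ε ; N = N ; ε-at-0 = ε-at-0 ; ε-support = ε-support
    ; N-primes = λ ℓ-prime ℓ∣N → ℕ.<-trans (N-primes ℓ-prime ℓ∣N) (ℕ.n<1+n j)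
    ; ε-multiple = λ d ℓ-prime ℓ<1+j → ε-multiple d ℓ-prime
        (ℕ.≤∧≢⇒< (ℕ.s≤s⁻¹ ℓ<1+j) λ ℓ≡j → ¬prime (subst Prime ℓ≡j ℓ-prime)) }
    where open Separator (separator j)
  ... | yes _ | no j∤m = record
    { ε = ε ; N = N ; ε-at-0 = ε-at-0 ; ε-support = ε-support
    ; N-primes = λ ℓ-prime ℓ∣N → ℕ.<-trans (N-primes ℓ-prime ℓ∣N) (ℕ.n<1+n j)
    ; ε-multiple = λ d ℓ-prime ℓ<1+j m≡dℓ → ε-multiple d ℓ-prime
        (ℕ.≤∧≢⇒< (ℕ.s≤s⁻¹ ℓ<1+j) λ ℓ≡j → j∤m (divides d (trans m≡dℓ (cong (d ℕ.*_) ℓ≡j)))) m≡dℓ }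
    where open Separator (separator j)
  ... | yes j-prime | yes (divides r m≡rj) = record
    { ε = (1# - 𝕏 ^ r) * ε ; N = j ℕ.* N
    ; ε-at-0 = cong₂ ℤ._-_ ε-at-0 (trans (act-^ r _ 0) (trans (cong (⟦ ε ⟧ (δ m)) (ℕ.+-identityʳ r)) (ε-support r m∤Nr)))
    ; ε-support = λ i ¬∣ → cong₂ ℤ._-_
        (ε-support i λ m∣Ni → ¬∣ (subst (suc m ∣_) (sym (ℕ.*-assoc j N i)) (Div.∣n⇒∣m*n j m∣Ni)))
        (trans (act-^ r _ i) (ε-support (r ℕ.+ i) λ m∣N[r+i] → ¬∣ (shifted i m∣N[r+i])))
    ; N-primes = λ {ℓ} ℓ-prime ℓ∣jN → [ (λ ℓ∣j → s≤s (∣⇒≤ {{prime⇒nonZero j-prime}} ℓ∣j))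
                                  , (λ ℓ∣N → ℕ.<-trans (N-primes ℓ-prime ℓ∣N) (ℕ.n<1+n j)) ]′
                                  (euclidsLemma j N ℓ-prime ℓ∣jN)
    ; ε-multiple = multiple }
    where
    open Separator (separator j)
    instance
      j≢0 : NonZero j
      j≢0 = prime⇒nonZero j-prime
    r≢0 : NonZero r
    r≢0 = ℕ.≢-nonZero λ r≡0 → ℕ.1+n≢0 (trans m≡rj (cong (ℕ._* j) r≡0))
    m∤Nr : ¬ (suc m ∣ N ℕ.* r)
    m∤Nr m∣Nr = ℕ.<-irrefl refl (N-primes j-prime (Div.*-cancelˡ-∣ r {{r≢0}}
      (subst₂ _∣_ m≡rj (ℕ.*-comm N r) m∣Nr)))
    shifted : ∀ i → suc m ∣ N ℕ.* (r ℕ.+ i) → suc m ∣ (j ℕ.* N) ℕ.* i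
    shifted i d = Div.∣m+n∣m⇒∣n
      (subst (suc m ∣_) eq (Div.∣n⇒∣m*n j d))
      (Div.∣n⇒∣m*n N (Div.∣-reflexive m≡rj))
      where
      eq : j ℕ.* (N ℕ.* (r ℕ.+ i)) ≡ N ℕ.* (r ℕ.* j) ℕ.+ j ℕ.* N ℕ.* i
      eq = ring-eq j N r i
        where
        ring-eq : ∀ j N r i → j ℕ.* (N ℕ.* (r ℕ.+ i)) ≡ N ℕ.* (r ℕ.* j) ℕ.+ j ℕ.* N ℕ.* i
        ring-eq = ℕ-Solver.solve-∀
    multiple : ∀ {ℓ} d → Prime ℓ → ℓ < suc j → suc m ≡ d ℕ.* ℓ → ∃[ b ] (1# - 𝕏 ^ r) * ε ≈ (1# - 𝕏 ^ d) * b
    multiple {ℓ} d ℓ-prime ℓ<1+j m≡dℓ with ℓ ℕ.≟ j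
    ... | yes refl = ε , *-congʳ (+-congˡ (-‿cong (^-congʳ 𝕏 (ℕ.*-cancelʳ-≡ r d j (trans (sym m≡rj) m≡dℓ)))))
    ... | no ℓ≢j with ε-multiple d ℓ-prime (ℕ.≤∧≢⇒< (ℕ.s≤s⁻¹ ℓ<1+j) ℓ≢j) m≡dℓ
    ...   | b , ε≈ = (1# - 𝕏 ^ r) * b , ≈-trans (*-congˡ ε≈)
              (solve 3 (λ u v b → u :* (v :* b) := v :* (u :* b)) ≈-refl (1# - 𝕏 ^ r) (1# - 𝕏 ^ d) b)

-- Orders of elements

prime-divisor : ∀ {n} → 1 < n → ∃[ ℓ ] (Prime ℓ × ℓ ∣ n)
prime-divisor {n} 1<n with factorise n {{ℕ.>-nonZero (ℕ.<-trans ℕ.z<s 1<n)}}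
... | record { factors = [] ; isFactorisation = n≡1 } = ⊥-elim (ℕ.<-irrefl (sym n≡1) 1<n)
... | record { factors = ℓ ∷ ℓs ; isFactorisation = n≡ ; factorsPrime = ℓ-prime ∷ _ } =
  ℓ , ℓ-prime , divides (product ℓs) (trans n≡ (ℕ.*-comm ℓ _))

module RootOrder (Q : CommutativeRing 0ℓ 0ℓ) where
  open CommutativeRing Q hiding (refl; sym; trans)
  open import Algebra.Properties.CommutativeSemiring.Exp commutativeSemiring
  open RootOfUnity Q using (1^n≈1)
  open import Relation.Binary.Reasoning.Setoid setoid

  ^≈1-multiple : ∀ {x} a b → x ^ a ≈ 1# → x ^ (b ℕ.* a) ≈ 1#
  ^≈1-multiple {x} a b x^a≈1 = begin
    x ^ (b ℕ.* a)     ≈⟨ ^-congʳ x (ℕ.*-comm b a) ⟩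
    x ^ (a ℕ.* b)     ≈⟨ ^-assocʳ x a b ⟨
    (x ^ a) ^ b       ≈⟨ ^-congˡ b x^a≈1 ⟩
    1# ^ b            ≈⟨ 1^n≈1 b ⟩
    1#                ∎

  ^≈1-cancel : ∀ {x} a b c → c ℕ.+ b ≡ a → x ^ a ≈ 1# → x ^ b ≈ 1# → x ^ c ≈ 1#
  ^≈1-cancel {x} a b c c+b≡a x^a≈1 x^b≈1 = begin
    x ^ c             ≈⟨ *-identityʳ _ ⟨
    x ^ c * 1#        ≈⟨ *-congˡ x^b≈1 ⟨
    x ^ c * x ^ b     ≈⟨ ^-homo-* x c b ⟨
    x ^ (c ℕ.+ b)     ≈⟨ ^-congʳ x c+b≡a ⟩
    x ^ a             ≈⟨ x^a≈1 ⟩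
    1#                ∎

  ^≈1-gcd : ∀ {x} a b → x ^ a ≈ 1# → x ^ b ≈ 1# → x ^ gcd a b ≈ 1#
  ^≈1-gcd a b x^a≈1 x^b≈1 with Bézout.identity (gcd-GCD a b)
  ... | Bézout.+- u v eq = ^≈1-cancel (u ℕ.* a) (v ℕ.* b) _ eq (^≈1-multiple a u x^a≈1) (^≈1-multiple b v x^b≈1)
  ... | Bézout.-+ u v eq = ^≈1-cancel (v ℕ.* b) (u ℕ.* a) _ eq (^≈1-multiple b v x^b≈1) (^≈1-multiple a u x^a≈1)

  -- The exponents with `x ^ i ≈ 1#` are closed under gcd, and a proper divisor of `m` divides some
  -- m / ℓ. To show that `x` has order exactly `m`, it is therefore enough to exclude `x ^ d ≈ 1#`
  -- for the quotients d = m / ℓ with ℓ prime.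
  proper-power-divisor : ∀ {x m i} → x ^ m ≈ 1# → x ^ i ≈ 1# → 0 < i → i < m →
    ∃[ ℓ ] ∃[ d ] (Prime ℓ × m ≡ d ℕ.* ℓ × x ^ d ≈ 1#)
  proper-power-divisor {x} {m} {i} x^m≈1 x^i≈1 0<i i<m with gcd[m,n]∣m m i
  ... | divides c m≡cg = ℓ , d ℕ.* g , ℓ-prime , trans m≡cg (trans (cong (ℕ._* g) c≡dℓ) (shuffle d ℓ g)) ,
        ^≈1-multiple g d (^≈1-gcd m i x^m≈1 x^i≈1)
    where
    g = gcd m i
    shuffle : ∀ d ℓ g → (d ℕ.* ℓ) ℕ.* g ≡ (d ℕ.* g) ℕ.* ℓ
    shuffle = ℕ-Solver.solve-∀
    g<m : g < m
    g<m = ℕ.≤-<-trans (∣⇒≤ {{ℕ.>-nonZero 0<i}} (gcd[m,n]∣n m i)) i<m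
    1<c : 1 < c
    1<c = ℕ.*-cancelʳ-< g 1 c (subst₂ _<_ (sym (ℕ.*-identityˡ g)) m≡cg g<m)
    ℓ = proj₁ (prime-divisor 1<c)
    ℓ-prime = proj₁ (proj₂ (prime-divisor 1<c))
    d = Div.quotient (proj₂ (proj₂ (prime-divisor 1<c)))
    c≡dℓ : c ≡ d ℕ.* ℓ
    c≡dℓ = Div._∣_.equality (proj₂ (proj₂ (prime-divisor 1<c)))

module PowerRing (R : CommutativeRing 0ℓ 0ℓ) where
  open CommutativeRing R
  open import Algebra.Properties.CommutativeSemiring.Exp commutativeSemiring using (_^_)
  open import Algebra.Properties.Semiring.Mult semiring using () renaming (_×_ to _×′_)

  -- Up to the equality of the ring this is a field of order m + 2 whose multiplicative group is
  -- generated by `ζ`.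
  record IsPowerRing (m : ℕ) (ζ : Carrier) : Set where
    field
      1≉0        : ¬ (1# ≈ 0#)
      ζ^m≈1      : ζ ^ suc m ≈ 1#
      ζ-faithful : ∀ {i} → 0 < i → i < suc m → ¬ (ζ ^ i ≈ 1#)
      q×1≈0      : suc (suc m) ×′ 1# ≈ 0#
      power      : ∀ a → a ≈ 0# ⊎ (∃[ k ] a ≈ ζ ^ k)

-- The residue field in which 𝕏 has order q - 1

module ResidueField (p m k : ℕ) (p-prime : Prime p) (p^k≡q : p ℕ.^ suc k ≡ suc (suc m)) where
  open CyclicAlgebra p m
  open GroupAlgebra p m (suc k) p-prime p^k≡q
  private module R = CommutativeRing R
  open import Algebra.Properties.CommutativeSemiring.Exp R.commutativeSemiring using () renaming (_^_ to _^ᴿ_)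
  open import Algebra.Properties.Semiring.Mult R.semiring using () renaming (_×_ to _×ᴿ_)
  open Separation R ≈0? m ^q≈id
  open Frobenius R p p-prime char using (multiple-vanishes)

  abstract
    total-separator : Separator (suc (suc m))
    total-separator = separator (suc (suc m))

  open Separator total-separator

  ε≉0 : ¬ (ε R.≈ R.0#)
  ε≉0 ε≈0 with subst (_~ ℤ.0ℤ) ε-at-0 (at ε≈0 0)
  ... | mod p∣1 = prime∤1 p-prime (ℤ∣.∣⇒∣ᵤ p∣1)

  faithful sums : Fin (suc m) → Poly
  faithful i = R.1# R.- 𝕏 ^ᴿ toℕ i
  sums i = R.1# R.+ 𝕏 ^ᴿ toℕ i

  shifts : Fin (suc m) → Fin (suc m) → Poly
  shifts i l = R.1# R.- sums i R.* 𝕏 ^ᴿ toℕ l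

  -- Finitely many elements suffice to obtain a field. The differences 1 - 𝕏ⁱ with 0 < i become
  -- units. Each sum 1 + 𝕏ⁱ becomes zero or a root of unity, and in the second case a power of 𝕏 by
  -- `root-is-power`, whose dichotomy is supplied by `shifts`. Closure of the powers under addition
  -- then follows from 𝕏ⁱ + 𝕏ʲ = 𝕏ⁱ (1 + 𝕏ʲ⁻ⁱ).
  tests : List Poly
  tests = List.tabulate faithful ++ (List.tabulate sums ++
          List.cartesianProductWith shifts (List.allFin (suc m)) (List.allFin (suc m)))

  abstract
    refined : ∃[ f ] (NonzeroIdempotent f × f R.* ε ^ᴿ suc m R.≈ f × All (ZeroOrUnit f) tests)
    -- Starting from the idempotent `ε ^ suc m` makes `ε` a unit of the quotient.
    refined = refine (ε ^ᴿ suc m) (power-idempotent ε , power-nonzero ε≉0) tests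

  e : Poly
  e = proj₁ refined

  Q : CommutativeRing 0ℓ 0ℓ
  Q = quotientRing R e

  open CommutativeRing Q hiding (refl; sym; trans)
  open CommutativeRing Q using () renaming (refl to ≈-refl; sym to ≈-sym; trans to ≈-trans)
  open import Relation.Binary.Reasoning.Setoid setoid
  open import Algebra.Properties.CommutativeSemiring.Exp commutativeSemiring using (_^_; ^-homo-*; ^-congʳ)
  open import Algebra.Properties.Semiring.Mult semiring using () renaming (_×_ to _×′_)
  open import Algebra.Properties.Group +-group using (x∙y⁻¹≈ε⇒x≈y; inverseˡ-unique)
  open RootOfUnity Q using (ZeroOrRoot; root-is-power; ^-mod)
  open RootOrder Q using (proper-power-divisor)

  toQ : ∀ {a b} → a R.≈ b → a ≈ b
  toQ = quotientRing-≈ R e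

  -- The powers in R and Q are stuck on different ring structures, hence not definitionally equal.
  ^-agree : ∀ a n → a ^ᴿ n ≡ a ^ n
  ^-agree a zero    = refl
  ^-agree a (suc n) = cong (a ⊗_) (^-agree a n)

  ×-agree : ∀ n a → n ×ᴿ a ≡ n ×′ a
  ×-agree zero    a = refl
  ×-agree (suc n) a = cong (a ⊕_) (×-agree n a)

  1≉0 : ¬ (1# ≈ 0#)
  1≉0 1≈0 = proj₂ (proj₁ (proj₂ refined)) (R.trans (R.sym (R.*-identityʳ e)) (R.trans 1≈0 (R.zeroʳ e)))

  tested : ∀ {x} → x ∈ tests → ZeroOrRoot m x
  tested x∈tests with All.lookup (proj₂ (proj₂ (proj₂ refined))) x∈tests
  ... | inj₁ ex≈0 = inj₁ (R.trans ex≈0 (R.sym (R.zeroʳ e)))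
  ... | inj₂ ex^m≈e = inj₂ (subst (_≈ 1#) (^-agree _ (suc m)) (R.trans ex^m≈e (R.sym (R.*-identityʳ e))))

  Q-X^m≈1 : 𝕏 ^ suc m ≈ 1#
  Q-X^m≈1 = subst (_≈ 1#) (^-agree 𝕏 (suc m)) (toQ X^m≈1)

  ε-power≈1 : ε ^ suc m ≈ 1#
  ε-power≈1 = subst (_≈ 1#) (^-agree ε (suc m))
    (R.trans (proj₁ (proj₂ (proj₂ refined))) (R.sym (R.*-identityʳ e)))

  ε-factor-nonzero : ∀ d b → ε ≈ (1# - 𝕏 ^ d) * b → ¬ (𝕏 ^ d ≈ 1#)
  ε-factor-nonzero d b ε≈ X^d≈1 = 1≉0 (begin
    1#                               ≈⟨ ε-power≈1 ⟨
    ε * ε ^ m                        ≈⟨ *-congʳ ε≈ ⟩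
    (1# - 𝕏 ^ d) * b * ε ^ m         ≈⟨ *-congʳ (*-congʳ (+-congˡ (-‿cong X^d≈1))) ⟩
    (1# - 1#) * b * ε ^ m            ≈⟨ *-congʳ (*-congʳ (-‿inverseʳ 1#)) ⟩
    0# * b * ε ^ m                   ≈⟨ *-congʳ (zeroˡ b) ⟩
    0# * ε ^ m                       ≈⟨ zeroˡ _ ⟩
    0#                               ∎)

  -- A smaller order would give `𝕏 ^ d ≈ 1#` for some d with m + 1 = d ℓ and ℓ prime, but 1 - 𝕏ᵈ
  -- divides the unit `ε`.
  X-faithful : ∀ {i} → 0 < i → i < suc m → ¬ (𝕏 ^ i ≈ 1#)
  X-faithful 0<i i<m X^i≈1 =
    let ℓ , d , ℓ-prime , m≡dℓ , X^d≈1 = proper-power-divisor Q-X^m≈1 X^i≈1 0<i i<m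
        b , ε≈ = ε-multiple d ℓ-prime (s≤s (∣⇒≤ (divides d m≡dℓ))) m≡dℓ
    in ε-factor-nonzero d b (subst (λ z → ε ≈ (1# - z) * b) (^-agree 𝕏 d) (toQ ε≈)) X^d≈1

  units : ∀ (i : Fin m) → (1# - 𝕏 ^ suc (toℕ i)) ^ suc m ≈ 1#
  units i with subst (λ z → ZeroOrRoot m (1# - z)) (^-agree 𝕏 (suc (toℕ i)))
    (tested (∈-++⁺ˡ (∈-tabulate⁺ {f = faithful} (Fin.suc i))))
  ... | inj₁ 1-X^i≈0 = ⊥-elim (X-faithful ℕ.z<s (s≤s (Fin.toℕ<n i)) (≈-sym (x∙y⁻¹≈ε⇒x≈y 1# _ 1-X^i≈0)))
  ... | inj₂ unit = unit

  q×a≈0 : ∀ a → suc (suc m) ×′ a ≈ 0#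
  q×a≈0 a = subst (_≈ 0#) (×-agree (suc (suc m)) a)
    (toQ (multiple-vanishes (suc (suc m)) (divides (p ℕ.^ k) (trans (sym p^k≡q) (ℕ.*-comm p _))) a))

  Power : Poly → Set
  Power a = a ≈ 0# ⊎ (∃[ n ] a ≈ 𝕏 ^ n)

  Power-≈ : ∀ {a b} → a ≈ b → Power b → Power a
  Power-≈ a≈b (inj₁ b≈0) = inj₁ (≈-trans a≈b b≈0)
  Power-≈ a≈b (inj₂ (n , b≈X^n)) = inj₂ (n , ≈-trans a≈b b≈X^n)

  Power-* : ∀ {a b} → Power a → Power b → Power (a * b)
  Power-* {a} {b} (inj₁ a≈0) _ = inj₁ (≈-trans (*-congʳ a≈0) (zeroˡ b))
  Power-* {a} {b} (inj₂ _) (inj₁ b≈0) = inj₁ (≈-trans (*-congˡ b≈0) (zeroʳ a))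
  Power-* (inj₂ (i , a≈)) (inj₂ (j , b≈)) = inj₂ (i ℕ.+ j , ≈-trans (*-cong a≈ b≈) (≈-sym (^-homo-* 𝕏 i j)))

  Power-sums : ∀ i → Power (sums i)
  Power-sums i with tested (∈-++⁺ʳ (List.tabulate faithful) (∈-++⁺ˡ (∈-tabulate⁺ {f = sums} i)))
  ... | inj₁ ≈0 = inj₁ ≈0
  ... | inj₂ root = inj₂ (root-is-power m 𝕏 Q-X^m≈1 1≉0 (q×a≈0 1#) units root λ l →
    subst (λ z → ZeroOrRoot m (1# - sums i * z)) (^-agree 𝕏 (toℕ l))
      (tested (∈-++⁺ʳ (List.tabulate faithful) (∈-++⁺ʳ (List.tabulate sums)
        (∈-cartesianProductWith⁺ shifts (∈-allFin i) (∈-allFin l))))))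

  Power-1+X^ : ∀ n → Power (1# + 𝕏 ^ n)
  Power-1+X^ n = Power-≈ (+-congˡ X^n≈) (Power-sums r)
    where
    r : Fin (suc m)
    r = Fin.fromℕ< (m%n<n n (suc m))
    X^n≈ : 𝕏 ^ n ≈ 𝕏 ^ᴿ toℕ r
    X^n≈ = ≈-trans (^-mod (suc m) Q-X^m≈1 n)
      (reflexive (trans (cong (𝕏 ^_) (sym (Fin.toℕ-fromℕ< (m%n<n n (suc m))))) (sym (^-agree 𝕏 (toℕ r)))))

  Power-X^+X^ : ∀ {i j} → i ≤ j → Power (𝕏 ^ i + 𝕏 ^ j)
  Power-X^+X^ {i} {j} i≤j = Power-≈ (begin
    𝕏 ^ i + 𝕏 ^ j                       ≈⟨ +-cong (≈-sym (*-identityʳ _)) (^-congʳ 𝕏 (sym (ℕ.m+[n∸m]≡n i≤j))) ⟩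
    𝕏 ^ i * 1# + 𝕏 ^ (i ℕ.+ (j ∸ i))    ≈⟨ +-congˡ (^-homo-* 𝕏 i (j ∸ i)) ⟩
    𝕏 ^ i * 1# + 𝕏 ^ i * 𝕏 ^ (j ∸ i)    ≈⟨ distribˡ _ _ _ ⟨
    𝕏 ^ i * (1# + 𝕏 ^ (j ∸ i))          ∎) (Power-* (inj₂ (i , ≈-refl)) (Power-1+X^ (j ∸ i)))

  Power-+ : ∀ {a b} → Power a → Power b → Power (a + b)
  Power-+ {a} {b} (inj₁ a≈0) b-power = Power-≈ (≈-trans (+-congʳ a≈0) (+-identityˡ b)) b-power
  Power-+ {a} {b} (inj₂ a-power) (inj₁ b≈0) = Power-≈ (≈-trans (+-congˡ b≈0) (+-identityʳ a)) (inj₂ a-power)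
  Power-+ (inj₂ (i , a≈)) (inj₂ (j , b≈)) with ℕ.≤-total i j
  ... | inj₁ i≤j = Power-≈ (+-cong a≈ b≈) (Power-X^+X^ i≤j)
  ... | inj₂ j≤i = Power-≈ (≈-trans (+-cong a≈ b≈) (+-comm _ _)) (Power-X^+X^ j≤i)

  Power-× : ∀ n {a} → Power a → Power (n ×′ a)
  Power-× zero    _       = inj₁ ≈-refl
  Power-× (suc n) a-power = Power-+ a-power (Power-× n a-power)

  power : ∀ a → Power a
  power 𝟘 = inj₁ ≈-refl
  power 𝟙 = inj₂ (0 , ≈-refl)
  power 𝕏 = inj₂ (1 , ≈-sym (*-identityʳ 𝕏))
  power (a ⊕ b) = Power-+ (power a) (power b)
  power (a ⊗ b) = Power-* (power a) (power b)
  -- Since q a = 0, the negative of `a` is (q - 1) a, a repeated sum.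
  power (⊝ a) = Power-≈ (≈-sym (inverseˡ-unique _ a (begin
    suc m ×′ a + a                  ≈⟨ +-comm _ _ ⟩
    suc (suc m) ×′ a                ≈⟨ q×a≈0 a ⟩
    0#                              ∎))) (Power-× (suc m) (power a))

  isPowerRing : PowerRing.IsPowerRing Q m 𝕏
  isPowerRing = record
    { 1≉0 = 1≉0 ; ζ^m≈1 = Q-X^m≈1 ; ζ-faithful = X-faithful ; q×1≈0 = q×a≈0 1# ; power = power }

-- Numbering the field by exponents, and its sixth roots of unity

module RootField (R : CommutativeRing 0ℓ 0ℓ) (m : ℕ) (ζ : CommutativeRing.Carrier R)
                 (isPowerRing : PowerRing.IsPowerRing R m ζ) where
  open CommutativeRing R hiding (refl; sym; trans)
  open CommutativeRing R using () renaming (refl to ≈-refl; sym to ≈-sym; trans to ≈-trans)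
  open PowerRing R using (module IsPowerRing)
  open IsPowerRing isPowerRing
  open import Algebra.Properties.CommutativeSemiring.Exp commutativeSemiring
  open import Algebra.Properties.Semiring.Mult semiring using (×-assocˡ; ×-congʳ; ×-congˡ) renaming (_×_ to _×′_)
  open import Algebra.Properties.Group +-group using (inverseˡ-unique)
  open RootOfUnity R using (^-mod; 1^n≈1)
  open import Relation.Binary.Reasoning.Setoid setoid
  open IntegerSolver R using (solve; _:=_; _:+_; _:*_; :-_; _:-_; con)

  power-inverse : ∀ k → ζ ^ k * ζ ^ (k ℕ.* m) ≈ 1#
  power-inverse k = begin
    ζ ^ k * ζ ^ (k ℕ.* m)     ≈⟨ ^-homo-* ζ k (k ℕ.* m) ⟨
    ζ ^ (k ℕ.+ k ℕ.* m)       ≈⟨ ^-congʳ ζ (trans (sym (ℕ.*-suc k m)) (ℕ.*-comm k (suc m))) ⟩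
    ζ ^ (suc m ℕ.* k)         ≈⟨ ^-assocʳ ζ (suc m) k ⟨
    (ζ ^ suc m) ^ k           ≈⟨ ^-congˡ k ζ^m≈1 ⟩
    1# ^ k                    ≈⟨ 1^n≈1 k ⟩
    1#                        ∎

  power≉0 : ∀ k → ¬ (ζ ^ k ≈ 0#)
  power≉0 k ζ^k≈0 = 1≉0 (≈-trans (≈-sym (power-inverse k)) (≈-trans (*-congʳ ζ^k≈0) (zeroˡ _)))

  inverse : ∀ a → ¬ (a ≈ 0#) → ∃[ b ] a * b ≈ 1#
  inverse a a≉0 with power a
  ... | inj₁ a≈0 = ⊥-elim (a≉0 a≈0)
  ... | inj₂ (k , a≈ζ^k) = ζ ^ (k ℕ.* m) , ≈-trans (*-congʳ a≈ζ^k) (power-inverse k)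

  zero-product : ∀ {a b} → a * b ≈ 0# → ¬ (a ≈ 0#) → b ≈ 0#
  zero-product {a} {b} ab≈0 a≉0 =
    let c , ac≈1 = inverse a a≉0 in begin
    b             ≈⟨ *-identityˡ b ⟨
    1# * b        ≈⟨ *-congʳ ac≈1 ⟨
    a * c * b     ≈⟨ solve 3 (λ a b c → a :* c :* b := c :* (a :* b)) ≈-refl a b c ⟩
    c * (a * b)   ≈⟨ *-congˡ ab≈0 ⟩
    c * 0#        ≈⟨ zeroʳ c ⟩
    0#            ∎

  power-injective-≤ : ∀ {i j} → i ≤ j → j < suc m → ζ ^ i ≈ ζ ^ j → i ≡ j
  power-injective-≤ {i} {j} i≤j j<m ζ^i≈ζ^j with ℕ.m≤n⇒m<n∨m≡n i≤j
  ... | inj₂ i≡j = i≡j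
  ... | inj₁ i<j = ⊥-elim (ζ-faithful (ℕ.m<n⇒0<n∸m i<j) (ℕ.≤-<-trans (ℕ.m∸n≤m j i) j<m) (begin
    ζ ^ (j ∸ i)                                        ≈⟨ *-identityˡ _ ⟨
    1# * ζ ^ (j ∸ i)                                   ≈⟨ *-congʳ (power-inverse i) ⟨
    ζ ^ i * ζ ^ (i ℕ.* m) * ζ ^ (j ∸ i)                ≈⟨ solve 3 (λ a b c → a :* b :* c := b :* (a :* c)) ≈-refl (ζ ^ i) (ζ ^ (i ℕ.* m)) (ζ ^ (j ∸ i)) ⟩
    ζ ^ (i ℕ.* m) * (ζ ^ i * ζ ^ (j ∸ i))              ≈⟨ *-congˡ (^-homo-* ζ i (j ∸ i)) ⟨
    ζ ^ (i ℕ.* m) * ζ ^ (i ℕ.+ (j ∸ i))                ≈⟨ *-congˡ (^-congʳ ζ (ℕ.m+[n∸m]≡n i≤j)) ⟩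
    ζ ^ (i ℕ.* m) * ζ ^ j                              ≈⟨ *-congˡ ζ^i≈ζ^j ⟨
    ζ ^ (i ℕ.* m) * ζ ^ i                              ≈⟨ *-comm _ _ ⟩
    ζ ^ i * ζ ^ (i ℕ.* m)                              ≈⟨ power-inverse i ⟩
    1#                                                 ∎))

  power-injective : ∀ {i j} → i < suc m → j < suc m → ζ ^ i ≈ ζ ^ j → i ≡ j
  power-injective {i} {j} i<m j<m eq with ℕ.≤-total i j
  ... | inj₁ i≤j = power-injective-≤ i≤j j<m eq
  ... | inj₂ j≤i = sym (power-injective-≤ j≤i i<m (≈-sym eq))

  -- Zero comes first and the other elements are numbered by their discrete logarithms, which turns
  -- the equality of the ring into propositional equality.
  decode : Fin (suc (suc m)) → Carrier
  decode Fin.zero    = 0#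
  decode (Fin.suc i) = ζ ^ toℕ i

  decode-injective : ∀ {x y} → decode x ≈ decode y → x ≡ y
  decode-injective {Fin.zero}  {Fin.zero}  _  = refl
  decode-injective {Fin.zero}  {Fin.suc j} eq = ⊥-elim (power≉0 (toℕ j) (≈-sym eq))
  decode-injective {Fin.suc i} {Fin.zero}  eq = ⊥-elim (power≉0 (toℕ i) eq)
  decode-injective {Fin.suc i} {Fin.suc j} eq =
    cong Fin.suc (Fin.toℕ-injective (power-injective (Fin.toℕ<n i) (Fin.toℕ<n j) eq))

  encode-power : ∀ {a} → a ≈ 0# ⊎ (∃[ k ] a ≈ ζ ^ k) → Fin (suc (suc m))
  encode-power (inj₁ _)       = Fin.zero
  encode-power (inj₂ (k , _)) = Fin.suc (Fin.fromℕ< (m%n<n k (suc m)))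

  decode-encode-power : ∀ {a} (w : a ≈ 0# ⊎ (∃[ k ] a ≈ ζ ^ k)) → decode (encode-power w) ≈ a
  decode-encode-power (inj₁ a≈0) = ≈-sym a≈0
  decode-encode-power (inj₂ (k , a≈)) = ≈-trans
    (^-congʳ ζ (Fin.toℕ-fromℕ< (m%n<n k (suc m)))) (≈-trans (≈-sym (^-mod (suc m) ζ^m≈1 k)) (≈-sym a≈))

  abstract
    encode : Carrier → Fin (suc (suc m))
    encode a = encode-power (power a)

    decode-encode : ∀ a → decode (encode a) ≈ a
    decode-encode a = decode-encode-power (power a)

  module SixthRoots (t : ℕ) (m≡6t : suc m ≡ 6 ℕ.* t) where

    0<t : 0 < t
    0<t = ℕ.n≢0⇒n>0 λ { refl → ℕ.1+n≢0 m≡6t }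

    multiple-of-t : ∀ {i} → i < 6 → i ℕ.* t < suc m
    multiple-of-t {i} i<6 = subst (i ℕ.* t <_) (sym m≡6t) (ℕ.*-monoˡ-< t {{ℕ.>-nonZero 0<t}} i<6)

    power≉1 : ∀ i → i < 5 → ¬ (ζ ^ (suc i ℕ.* t) ≈ 1#)
    power≉1 i i<5 = ζ-faithful (ℕ.≤-trans 0<t (ℕ.m≤m+n t (i ℕ.* t))) (multiple-of-t (s≤s i<5))

    power≈1 : ∀ i j → i ℕ.* j ≡ 6 → (ζ ^ (i ℕ.* t)) ^ j ≈ 1#
    power≈1 i j ij≡6 = begin
      (ζ ^ (i ℕ.* t)) ^ j       ≈⟨ ^-assocʳ ζ (i ℕ.* t) j ⟩
      ζ ^ ((i ℕ.* t) ℕ.* j)     ≈⟨ ^-congʳ ζ (trans (shuffle i t j) (trans (cong (ℕ._* t) ij≡6) (sym m≡6t))) ⟩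
      ζ ^ suc m                 ≈⟨ ζ^m≈1 ⟩
      1#                        ∎
      where
      shuffle : ∀ i t j → (i ℕ.* t) ℕ.* j ≡ (i ℕ.* j) ℕ.* t
      shuffle = ℕ-Solver.solve-∀

    difference≉0 : ∀ {a} → ¬ (a ≈ 1#) → ¬ (a - 1# ≈ 0#)
    difference≉0 a≉1 a-1≈0 = a≉1 (x∙y⁻¹≈ε⇒x≈y _ _ a-1≈0)
      where open import Algebra.Properties.Group +-group using (x∙y⁻¹≈ε⇒x≈y)

    ω : Carrier
    ω = ζ ^ (2 ℕ.* t)

    ω-root : 1# + ω + ω * ω ≈ 0#
    ω-root = zero-product (begin
      (ω - 1#) * (1# + ω + ω * ω)      ≈⟨ solve 1 (λ w → (w :- con ℤ.1ℤ) :* (con ℤ.1ℤ :+ w :+ w :* w) := w :* (w :* (w :* con ℤ.1ℤ)) :- con ℤ.1ℤ) ≈-refl ω ⟩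
      ω ^ 3 - 1#                       ≈⟨ +-congʳ (power≈1 2 3 refl) ⟩
      1# - 1#                          ≈⟨ -‿inverseʳ 1# ⟩
      0#                               ∎) (difference≉0 (power≉1 1 (s≤s (s≤s z≤n))))

    -1-power : ζ ^ (3 ℕ.* t) ≈ - 1#
    -1-power = inverseˡ-unique _ _ (zero-product (begin
      (a - 1#) * (a + 1#)      ≈⟨ solve 1 (λ a → (a :- con ℤ.1ℤ) :* (a :+ con ℤ.1ℤ) := a :* (a :* con ℤ.1ℤ) :- con ℤ.1ℤ) ≈-refl a ⟩
      a ^ 2 - 1#               ≈⟨ +-congʳ (power≈1 3 2 refl) ⟩
      1# - 1#                  ≈⟨ -‿inverseʳ 1# ⟩
      0#                       ∎) (difference≉0 (power≉1 2 (s≤s (s≤s (s≤s z≤n))))))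
      where a = ζ ^ (3 ℕ.* t)

    -power : ∀ j → - (ζ ^ j) ≈ ζ ^ (3 ℕ.* t ℕ.+ j)
    -power j = begin
      - (ζ ^ j)                      ≈⟨ solve 1 (λ z → :- z := (:- con ℤ.1ℤ) :* z) ≈-refl (ζ ^ j) ⟩
      - 1# * ζ ^ j                   ≈⟨ *-congʳ -1-power ⟨
      ζ ^ (3 ℕ.* t) * ζ ^ j          ≈⟨ ^-homo-* ζ (3 ℕ.* t) j ⟨
      ζ ^ (3 ℕ.* t ℕ.+ j)            ∎

    -- As q = 1 + 2t · 3, a vanishing 3 would turn q = 0 into 1 = 0.
    3≉0 : ¬ (1# + 1# + 1# ≈ 0#)
    3≉0 3≈0 = 1≉0 (begin
      1#                                       ≈⟨ +-identityʳ 1# ⟨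
      1# + 0#                                  ≈⟨ +-congˡ (begin
        suc m ×′ 1#                                ≈⟨ ×-congˡ (trans m≡6t (shuffle t)) ⟩
        ((2 ℕ.* t) ℕ.* 3) ×′ 1#                    ≈⟨ ×-assocˡ 1# (2 ℕ.* t) 3 ⟨
        (2 ℕ.* t) ×′ (3 ×′ 1#)                     ≈⟨ ×-congʳ (2 ℕ.* t) (≈-trans (solve 0 (con ℤ.1ℤ :+ (con ℤ.1ℤ :+ (con ℤ.1ℤ :+ con ℤ.0ℤ)) := con ℤ.1ℤ :+ con ℤ.1ℤ :+ con ℤ.1ℤ) ≈-refl) 3≈0) ⟩
        (2 ℕ.* t) ×′ 0#                            ≈⟨ ×-zero (2 ℕ.* t) ⟩
        0#                                         ∎) ⟨
      1# + suc m ×′ 1#                         ≈⟨ q×1≈0 ⟩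
      0#                                       ∎)
      where
      shuffle : ∀ t → 6 ℕ.* t ≡ (2 ℕ.* t) ℕ.* 3
      shuffle = ℕ-Solver.solve-∀
      ×-zero : ∀ n → n ×′ 0# ≈ 0#
      ×-zero zero    = ≈-refl
      ×-zero (suc n) = ≈-trans (+-identityˡ _) (×-zero n)

    3t+3t≡m : 3 ℕ.* t ℕ.+ 3 ℕ.* t ≡ suc m
    3t+3t≡m = trans (sum t) (sym m≡6t)
      where
      sum : ∀ t → 3 ℕ.* t ℕ.+ 3 ℕ.* t ≡ 6 ℕ.* t
      sum = ℕ-Solver.solve-∀

    3t+j<m : ∀ {j} → j < 3 ℕ.* t → 3 ℕ.* t ℕ.+ j < suc m
    3t+j<m {j} j<3t = subst (3 ℕ.* t ℕ.+ j <_) 3t+3t≡m (ℕ.+-monoʳ-< (3 ℕ.* t) j<3t)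

    j<m : ∀ {j} → j < 3 ℕ.* t → j < suc m
    j<m {j} j<3t = ℕ.≤-<-trans (ℕ.m≤n+m j (3 ℕ.* t)) (3t+j<m j<3t)

    -- - 1 is ζ³ᵗ, so the powers with exponent at least 3t are the negatives of those with exponent
    -- below 3t.
    signed-power : ∀ a → ¬ (a ≈ 0#) → ∃[ j ] (a ≈ ζ ^ toℕ {3 ℕ.* t} j ⊎ a ≈ - (ζ ^ toℕ j))
    signed-power a a≉0 with power a
    ... | inj₁ a≈0 = ⊥-elim (a≉0 a≈0)
    ... | inj₂ (k , a≈ζ^k) with k % suc m ℕ.<? 3 ℕ.* t
    ...   | yes r<3t = Fin.fromℕ< r<3t , inj₁ (≈-trans a≈ζ^k (≈-trans (^-mod (suc m) ζ^m≈1 k)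
              (^-congʳ ζ (sym (Fin.toℕ-fromℕ< r<3t)))))
    ...   | no r≮3t = Fin.fromℕ< r-3t<3t , inj₂ (begin
              a                                 ≈⟨ ≈-trans a≈ζ^k (^-mod (suc m) ζ^m≈1 k) ⟩
              ζ ^ r                             ≈⟨ ^-congʳ ζ (sym (ℕ.m+[n∸m]≡n 3t≤r)) ⟩
              ζ ^ (3 ℕ.* t ℕ.+ (r ∸ 3 ℕ.* t))   ≈⟨ -power _ ⟨
              - (ζ ^ (r ∸ 3 ℕ.* t))             ≈⟨ -‿cong (^-congʳ ζ (sym (Fin.toℕ-fromℕ< r-3t<3t))) ⟩
              - (ζ ^ toℕ (Fin.fromℕ< r-3t<3t))  ∎)
      where
      r = k % suc m
      3t≤r : 3 ℕ.* t ≤ r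
      3t≤r = ℕ.≮⇒≥ r≮3t
      r-3t<3t : r ∸ 3 ℕ.* t < 3 ℕ.* t
      r-3t<3t = ℕ.+-cancelˡ-< (3 ℕ.* t) _ _ (subst₂ _<_ (sym (ℕ.m+[n∸m]≡n 3t≤r)) (sym 3t+3t≡m) (m%n<n k (suc m)))

    signs-disjoint : ∀ (i j : Fin (3 ℕ.* t)) → ¬ (ζ ^ toℕ i ≈ - (ζ ^ toℕ j))
    signs-disjoint i j eq = ℕ.<⇒≱ (Fin.toℕ<n i) (subst (3 ℕ.* t ≤_)
      (sym (power-injective (j<m (Fin.toℕ<n i)) (3t+j<m (Fin.toℕ<n j)) (≈-trans eq (-power (toℕ j)))))
      (ℕ.m≤m+n (3 ℕ.* t) (toℕ j)))

-- The carrier is `Fin q` with propositional equality, because field elements also serve as points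
-- of the given systems and as their indices.
record FiniteField (q s : ℕ) : Set where
  infixl 6 _+_
  infixl 7 _*_
  field
    _+_ _*_           : Fin q → Fin q → Fin q
    -_                : Fin q → Fin q
    0# 1#             : Fin q
    isCommutativeRing : IsCommutativeRing _≡_ _+_ _*_ -_ 0# 1#
    1≢0               : 1# ≢ 0#
    inverse           : ∀ x → x ≢ 0# → ∃[ y ] x * y ≡ 1#
    ω                 : Fin q
    ω-root            : 1# + ω + ω * ω ≡ 0#
    3≢0               : 1# + 1# + 1# ≢ 0#
    β                 : Fin s → Fin q
    β≢0               : ∀ j → β j ≢ 0#
    β-injective       : ∀ {i j} → β i ≡ β j → i ≡ j
    β-signs           : ∀ i j → β i ≢ - β j
    β-covers          : ∀ x → x ≢ 0# → ∃[ j ] (x ≡ β j ⊎ x ≡ - β j)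

module Transport (R : CommutativeRing 0ℓ 0ℓ) (m : ℕ) (ζ : CommutativeRing.Carrier R)
                 (isPowerRing : PowerRing.IsPowerRing R m ζ) (t : ℕ) (m≡6t : suc m ≡ 6 ℕ.* t) where
  open CommutativeRing R hiding (refl; sym; trans)
  open CommutativeRing R using () renaming (refl to ≈-refl; sym to ≈-sym; trans to ≈-trans)
  open import Algebra.Properties.CommutativeSemiring.Exp commutativeSemiring using (_^_)
  open RootField R m ζ isPowerRing
  open SixthRoots t m≡6t

  infix 4 _≐_
  -- Equations in `Fin q` are proved in the ring: `⟨+⟩`, `⟨*⟩` and `⟨-⟩` assemble the elements
  -- represented by the two sides, and `via` compares them.
  record _≐_ (x : Fin (suc (suc m))) (a : Carrier) : Set where
    constructor represents
    field represented : decode x ≈ a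
  open _≐_

  private
    F = Fin (suc (suc m))

    abstract
      _+′_ _*′_ : F → F → F
      x +′ y = encode (decode x + decode y)
      x *′ y = encode (decode x * decode y)

      -′_ : F → F
      -′ x = encode (- decode x)

      ⟨+⟩ : ∀ {x y a b} → x ≐ a → y ≐ b → x +′ y ≐ a + b
      ⟨+⟩ (represents p) (represents q) = represents (≈-trans (decode-encode _) (+-cong p q))

      ⟨*⟩ : ∀ {x y a b} → x ≐ a → y ≐ b → x *′ y ≐ a * b
      ⟨*⟩ (represents p) (represents q) = represents (≈-trans (decode-encode _) (*-cong p q))

      ⟨-⟩ : ∀ {x a} → x ≐ a → -′ x ≐ - a
      ⟨-⟩ (represents p) = represents (≈-trans (decode-encode _) (-‿cong p))

    via : ∀ {x y a b} → x ≐ a → y ≐ b → a ≈ b → x ≡ y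
    via (represents p) (represents q) a≈b = decode-injective (≈-trans p (≈-trans a≈b (≈-sym q)))

    same : ∀ {x y a b} → x ≐ a → y ≐ b → x ≡ y → a ≈ b
    same (represents p) (represents q) refl = ≈-trans (≈-sym p) q

    ⟨⟩ : ∀ {x} → x ≐ decode x
    ⟨⟩ = represents ≈-refl

    ⟨e⟩ : ∀ {a} → encode a ≐ a
    ⟨e⟩ = represents (decode-encode _)

    nonzero : ∀ {x} → x ≢ encode 0# → ¬ (decode x ≈ 0#)
    nonzero x≢0 x≈0 = x≢0 (via (represents x≈0) ⟨e⟩ ≈-refl)

  isCommutativeRing′ : IsCommutativeRing _≡_ _+′_ _*′_ -′_ (encode 0#) (encode 1#)
  isCommutativeRing′ = record
    { isRing = record
      { +-isAbelianGroup = record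
        { isGroup = record
          { isMonoid = record
            { isSemigroup = record
              { isMagma = record { isEquivalence = ≡.isEquivalence ; ∙-cong = cong₂ _+′_ }
              ; assoc = λ x y z → via (⟨+⟩ (⟨+⟩ ⟨⟩ ⟨⟩) ⟨⟩) (⟨+⟩ ⟨⟩ (⟨+⟩ ⟨⟩ ⟨⟩)) (+-assoc _ _ _) }
            ; identity = (λ x → via (⟨+⟩ ⟨e⟩ ⟨⟩) ⟨⟩ (+-identityˡ _)) , (λ x → via (⟨+⟩ ⟨⟩ ⟨e⟩) ⟨⟩ (+-identityʳ _)) }
          ; inverse = (λ x → via (⟨+⟩ (⟨-⟩ ⟨⟩) ⟨⟩) ⟨e⟩ (-‿inverseˡ _)) , (λ x → via (⟨+⟩ ⟨⟩ (⟨-⟩ ⟨⟩)) ⟨e⟩ (-‿inverseʳ _))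
          ; ⁻¹-cong = cong -′_ }
        ; comm = λ x y → via (⟨+⟩ ⟨⟩ ⟨⟩) (⟨+⟩ ⟨⟩ ⟨⟩) (+-comm _ _) }
      ; *-cong = cong₂ _*′_
      ; *-assoc = λ x y z → via (⟨*⟩ (⟨*⟩ ⟨⟩ ⟨⟩) ⟨⟩) (⟨*⟩ ⟨⟩ (⟨*⟩ ⟨⟩ ⟨⟩)) (*-assoc _ _ _)
      ; *-identity = (λ x → via (⟨*⟩ ⟨e⟩ ⟨⟩) ⟨⟩ (*-identityˡ _)) , (λ x → via (⟨*⟩ ⟨⟩ ⟨e⟩) ⟨⟩ (*-identityʳ _))
      ; distrib = (λ x y z → via (⟨*⟩ ⟨⟩ (⟨+⟩ ⟨⟩ ⟨⟩)) (⟨+⟩ (⟨*⟩ ⟨⟩ ⟨⟩) (⟨*⟩ ⟨⟩ ⟨⟩)) (distribˡ _ _ _))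
                , (λ x y z → via (⟨*⟩ (⟨+⟩ ⟨⟩ ⟨⟩) ⟨⟩) (⟨+⟩ (⟨*⟩ ⟨⟩ ⟨⟩) (⟨*⟩ ⟨⟩ ⟨⟩)) (distribʳ _ _ _)) }
    ; *-comm = λ x y → via (⟨*⟩ ⟨⟩ ⟨⟩) (⟨*⟩ ⟨⟩ ⟨⟩) (*-comm _ _) }

  finiteField : FiniteField (suc (suc m)) (3 ℕ.* t)
  finiteField = record
    { _+_ = _+′_ ; _*_ = _*′_ ; -_ = -′_ ; 0# = encode 0# ; 1# = encode 1#
    ; isCommutativeRing = isCommutativeRing′
    ; 1≢0 = λ 1≡0 → 1≉0 (through 1≡0)
    ; inverse = λ x x≢0 → let b , xb≈1 = inverse (decode x) (nonzero x≢0) in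
        encode b , via (⟨*⟩ ⟨⟩ ⟨e⟩) ⟨e⟩ xb≈1
    ; ω = encode ω
    ; ω-root = via (⟨+⟩ (⟨+⟩ ⟨e⟩ ⟨e⟩) (⟨*⟩ ⟨e⟩ ⟨e⟩)) ⟨e⟩ ω-root
    ; 3≢0 = λ 3≡0 → 3≉0 (same (⟨+⟩ (⟨+⟩ ⟨e⟩ ⟨e⟩) ⟨e⟩) ⟨e⟩ 3≡0)
    ; β = λ j → encode (ζ ^ toℕ j)
    ; β≢0 = λ j β≡0 → power≉0 (toℕ j) (through β≡0)
    ; β-injective = λ {i} {j} eq → Fin.toℕ-injective (power-injective (j<m (Fin.toℕ<n i)) (j<m (Fin.toℕ<n j)) (through eq))
    ; β-signs = λ i j eq → signs-disjoint i j (same ⟨e⟩ (⟨-⟩ ⟨e⟩) eq)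
    ; β-covers = λ x x≢0 → let j , signed = signed-power (decode x) (nonzero x≢0) in
        j , [ (λ eq → inj₁ (via (represents eq) ⟨e⟩ ≈-refl)) , (λ eq → inj₂ (via (represents eq) (⟨-⟩ ⟨e⟩) ≈-refl)) ]′ signed }
    where
    open PowerRing.IsPowerRing isPowerRing using (1≉0)
    through : ∀ {a b} → encode a ≡ encode b → a ≈ b
    through = same ⟨e⟩ ⟨e⟩

finite-field : ∀ {q} → IsPrimePower q → q % 6 ≡ 1 → ∃[ t ] (q ≡ suc (6 ℕ.* t) × FiniteField q (3 ℕ.* t))
finite-field {zero} _ ()
-- 1 also leaves remainder 1 modulo 6; it is excluded because a power of `p` with positive exponent
-- is a multiple of `p`.
finite-field {suc zero} (p , suc k , p-prime , _ , 1≡p^k) _ =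
  ⊥-elim (prime∤! p-prime 0 (ℕ.>-nonZero⁻¹ p {{prime⇒nonZero p-prime}}) (divides (p ℕ.^ k) (trans 1≡p^k (ℕ.*-comm p _))))
finite-field {suc (suc m)} (p , suc k , p-prime , _ , q≡p^k) q%6≡1 = t , cong suc m≡6t ,
  Transport.finiteField (ResidueField.Q p m k p-prime (sym q≡p^k)) m 𝕏 (ResidueField.isPowerRing p m k p-prime (sym q≡p^k)) t m≡6t
  where
  t = suc (suc m) / 6
  m≡6t : suc m ≡ 6 ℕ.* t
  m≡6t = ℕ.suc-injective (trans (m≡m%n+[m/n]*n (suc (suc m)) 6) (cong₂ ℕ._+_ q%6≡1 (ℕ.*-comm t 6)))

-- Linear algebra over the field

module LinearAlgebra {q s} (𝔽 : FiniteField q s) where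
  open FiniteField 𝔽

  commutativeRing : CommutativeRing 0ℓ 0ℓ
  commutativeRing = record { isCommutativeRing = isCommutativeRing }

  open CommutativeRing commutativeRing public
    using (_-_; +-identityˡ; +-identityʳ; *-identityˡ; *-identityʳ; *-assoc; zeroˡ; zeroʳ; -‿inverseʳ; ring; +-group)
  open import Algebra.Properties.Ring ring public using (-0#≈0#; -‿distribʳ-*; -‿involutive)
  open import Algebra.Properties.Group +-group public using (x∙y⁻¹≈ε⇒x≈y)
  open IntegerSolver commutativeRing
  open ≡.≡-Reasoning

  F : Set
  F = Fin q

  _≟_ : (x y : F) → Dec (x ≡ y)
  _≟_ = Fin._≟_

  zero-product : ∀ {x y} → x * y ≡ 0# → x ≢ 0# → y ≡ 0#
  zero-product {x} {y} xy≡0 x≢0 with inverse x x≢0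
  ... | z , xz≡1 = begin
    y             ≡⟨ *-identityˡ y ⟨
    1# * y        ≡⟨ cong (_* y) xz≡1 ⟨
    x * z * y     ≡⟨ solve 3 (λ x y z → x :* z :* y := z :* (x :* y)) refl x y z ⟩
    z * (x * y)   ≡⟨ cong (z *_) xy≡0 ⟩
    z * 0#        ≡⟨ zeroʳ z ⟩
    0#            ∎

  *-nonzero : ∀ {x y} → x ≢ 0# → y ≢ 0# → x * y ≢ 0#
  *-nonzero x≢0 y≢0 xy≡0 = y≢0 (zero-product xy≡0 x≢0)

  *-cancelˡ : ∀ {x y z} → x ≢ 0# → x * y ≡ x * z → y ≡ z
  *-cancelˡ {x} {y} {z} x≢0 xy≡xz = x∙y⁻¹≈ε⇒x≈y y z (zero-product (begin
    x * (y - z)       ≡⟨ solve 3 (λ x y z → x :* (y :- z) := x :* y :- x :* z) refl x y z ⟩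
    x * y - x * z     ≡⟨ cong (_- x * z) xy≡xz ⟩
    x * z - x * z     ≡⟨ -‿inverseʳ _ ⟩
    0#                ∎) x≢0)

  -- inv 0# is 0#.
  inv : F → F
  inv x with x ≟ 0#
  ... | yes _   = 0#
  ... | no x≢0 = proj₁ (inverse x x≢0)

  inv-inverse : ∀ {x} → x ≢ 0# → x * inv x ≡ 1#
  inv-inverse {x} x≢0 with x ≟ 0#
  ... | yes x≡0 = ⊥-elim (x≢0 x≡0)
  ... | no x≢0′ = proj₂ (inverse x x≢0′)

  inv-nonzero : ∀ {x} → x ≢ 0# → inv x ≢ 0#
  inv-nonzero {x} x≢0 inv≡0 = 1≢0 (trans (sym (inv-inverse x≢0)) (trans (cong (x *_) inv≡0) (zeroʳ x)))

  inv-unique : ∀ {x y} → x * y ≡ 1# → y ≡ inv x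
  inv-unique {x} {y} xy≡1 = *-cancelˡ x≢0 (trans xy≡1 (sym (inv-inverse x≢0)))
    where
    x≢0 : x ≢ 0#
    x≢0 x≡0 = 1≢0 (trans (sym xy≡1) (trans (cong (_* y) x≡0) (zeroˡ y)))

  ω³≡1 : ω * (ω * ω) ≡ 1#
  ω³≡1 = begin
    ω * (ω * ω)                           ≡⟨ solve 1 (λ w → w :* (w :* w) := con ℤ.1ℤ :+ (w :- con ℤ.1ℤ) :* (con ℤ.1ℤ :+ w :+ w :* w)) refl ω ⟩
    1# + (ω - 1#) * (1# + ω + ω * ω)      ≡⟨ cong (λ z → 1# + (ω - 1#) * z) ω-root ⟩
    1# + (ω - 1#) * 0#                    ≡⟨ solve 1 (λ w → con ℤ.1ℤ :+ (w :- con ℤ.1ℤ) :* con ℤ.0ℤ := con ℤ.1ℤ) refl ω ⟩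
    1#                                    ∎

  ω≢0 : ω ≢ 0#
  ω≢0 ω≡0 = 1≢0 (trans (sym ω³≡1) (trans (cong (_* (ω * ω)) ω≡0) (zeroˡ _)))

  inv-ω : ∀ {x} → x ≢ 0# → inv (ω * x) ≡ ω * ω * inv x
  inv-ω {x} x≢0 = sym (inv-unique (begin
    ω * x * (ω * ω * inv x)           ≡⟨ solve 3 (λ w x y → w :* x :* (w :* w :* y) := w :* (w :* w) :* (x :* y)) refl ω x (inv x) ⟩
    ω * (ω * ω) * (x * inv x)         ≡⟨ cong₂ _*_ ω³≡1 (inv-inverse x≢0) ⟩
    1# * 1#                           ≡⟨ *-identityˡ 1# ⟩
    1#                                ∎))

  infixl 6 _⊞_ _⊟_
  infixr 7 _·_

  _⊞_ _⊟_ : ∀ {n} → Vec F n → Vec F n → Vec F n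
  _⊞_ = Vec.zipWith _+_
  _⊟_ = Vec.zipWith _-_

  _·_ : ∀ {n} → F → Vec F n → Vec F n
  c · v = Vec.map (c *_) v

  𝟎 : ∀ {n} → Vec F n
  𝟎 = Vec.replicate _ 0#

  lead : ∀ {n} → Vec F n → F
  lead [] = 0#
  lead (x ∷ v) with x ≟ 0#
  ... | yes _ = lead v
  ... | no _  = x

  lead-0∷ : ∀ {n x} (v : Vec F n) → x ≡ 0# → lead (x ∷ v) ≡ lead v
  lead-0∷ {x = x} v x≡0 with x ≟ 0#
  ... | yes _   = refl
  ... | no x≢0 = ⊥-elim (x≢0 x≡0)

  lead-∷ : ∀ {n x} (v : Vec F n) → x ≢ 0# → lead (x ∷ v) ≡ x
  lead-∷ {x = x} v x≢0 with x ≟ 0#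
  ... | yes x≡0 = ⊥-elim (x≢0 x≡0)
  ... | no _    = refl

  lead-𝟎 : ∀ n → lead (𝟎 {n}) ≡ 0#
  lead-𝟎 zero    = refl
  lead-𝟎 (suc n) = trans (lead-0∷ (𝟎 {n}) refl) (lead-𝟎 n)

  lead≡0 : ∀ {n} (v : Vec F n) → lead v ≡ 0# → v ≡ 𝟎
  lead≡0 [] _ = refl
  lead≡0 (x ∷ v) lead≡ with x ≟ 0#
  ... | yes refl = cong (0# ∷_) (lead≡0 v lead≡)
  ... | no x≢0  = ⊥-elim (x≢0 lead≡)

  lead-· : ∀ {n c} (v : Vec F n) → c ≢ 0# → lead (c · v) ≡ c * lead v
  lead-· {c = c} [] _ = sym (zeroʳ c)
  lead-· {c = c} (x ∷ v) c≢0 with x ≟ 0#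
  ... | yes refl = trans (lead-0∷ (c · v) (zeroʳ c)) (lead-· v c≢0)
  ... | no x≢0  = lead-∷ (c · v) (*-nonzero c≢0 x≢0)

  -- The first non-zero Plücker coordinate of v ∧ w.
  d : ∀ {n} → Vec F n → Vec F n → F
  d [] [] = 0#
  d (x ∷ v) (y ∷ w) with x ≟ 0# | y ≟ 0#
  ... | yes _ | yes _ = d v w
  ... | yes _ | no _  = lead (x · w ⊟ y · v)
  ... | no _  | _     = lead (x · w ⊟ y · v)

  d-00 : ∀ {n x y} (v w : Vec F n) → x ≡ 0# → y ≡ 0# → d (x ∷ v) (y ∷ w) ≡ d v w
  d-00 {x = x} {y} v w x≡0 y≡0 with x ≟ 0# | y ≟ 0#
  ... | yes _   | yes _   = refl
  ... | yes _   | no y≢0 = ⊥-elim (y≢0 y≡0)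
  ... | no x≢0 | _       = ⊥-elim (x≢0 x≡0)

  d-lead : ∀ {n x y} (v w : Vec F n) → x ≢ 0# ⊎ y ≢ 0# → d (x ∷ v) (y ∷ w) ≡ lead (x · w ⊟ y · v)
  d-lead {x = x} {y} v w nz with x ≟ 0# | y ≟ 0#
  ... | yes x≡0 | yes y≡0 = ⊥-elim ([ (λ x≢0 → x≢0 x≡0) , (λ y≢0 → y≢0 y≡0) ]′ nz)
  ... | yes _   | no _    = refl
  ... | no _    | _       = refl

  zero? : ∀ x → x ≡ 0# ⊎ x ≢ 0#
  zero? x with x ≟ 0#
  ... | yes x≡0 = inj₁ x≡0
  ... | no x≢0  = inj₂ x≢0

  zeros? : ∀ x y → (x ≡ 0# × y ≡ 0#) ⊎ (x ≢ 0# ⊎ y ≢ 0#)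
  zeros? x y with x ≟ 0# | y ≟ 0#
  ... | yes x≡0 | yes y≡0 = inj₁ (x≡0 , y≡0)
  ... | no x≢0 | _       = inj₂ (inj₁ x≢0)
  ... | _       | no y≢0 = inj₂ (inj₂ y≢0)

  -1≢0 : - 1# ≢ 0#
  -1≢0 -1≡0 = 1≢0 (trans (sym (-‿involutive 1#)) (trans (cong -_ -1≡0) -0#≈0#))

  ⊟-swap : ∀ {n} x y (v w : Vec F n) → x · w ⊟ y · v ≡ (- 1#) · (y · v ⊟ x · w)
  ⊟-swap x y [] [] = refl
  ⊟-swap x y (a ∷ v) (b ∷ w) = cong₂ _∷_
    (solve 4 (λ x y a b → x :* b :- y :* a := (:- con ℤ.1ℤ) :* (y :* a :- x :* b)) refl x y a b) (⊟-swap x y v w)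

  d-antisym : ∀ {n} (v w : Vec F n) → d v w ≡ - d w v
  d-antisym [] [] = sym -0#≈0#
  d-antisym (x ∷ v) (y ∷ w) with zeros? x y
  ... | inj₁ (x≡0 , y≡0) = trans (d-00 v w x≡0 y≡0) (trans (d-antisym v w) (cong -_ (sym (d-00 w v y≡0 x≡0))))
  ... | inj₂ nz = begin
    d (x ∷ v) (y ∷ w)                      ≡⟨ d-lead v w nz ⟩
    lead (x · w ⊟ y · v)                   ≡⟨ cong lead (⊟-swap x y v w) ⟩
    lead ((- 1#) · (y · v ⊟ x · w))        ≡⟨ lead-· (y · v ⊟ x · w) -1≢0 ⟩
    - 1# * lead (y · v ⊟ x · w)            ≡⟨ cong (- 1# *_) (d-lead w v ([ inj₂ , inj₁ ]′ nz)) ⟨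
    - 1# * d (y ∷ w) (x ∷ v)               ≡⟨ solve 1 (λ z → (:- con ℤ.1ℤ) :* z := :- z) refl (d (y ∷ w) (x ∷ v)) ⟩
    - d (y ∷ w) (x ∷ v)                    ∎

  ·-⊟ : ∀ {n} c x y (v w : Vec F n) → (c * x) · w ⊟ y · (c · v) ≡ c · (x · w ⊟ y · v)
  ·-⊟ c x y [] [] = refl
  ·-⊟ c x y (a ∷ v) (b ∷ w) = cong₂ _∷_
    (solve 5 (λ c x y a b → c :* x :* b :- y :* (c :* a) := c :* (x :* b :- y :* a)) refl c x y a b) (·-⊟ c x y v w)

  d-·ˡ : ∀ {n c} (v w : Vec F n) → c ≢ 0# → d (c · v) w ≡ c * d v w
  d-·ˡ {c = c} [] [] _ = sym (zeroʳ c)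
  d-·ˡ {c = c} (x ∷ v) (y ∷ w) c≢0 with zeros? x y
  ... | inj₁ (refl , refl) = trans (d-00 (c · v) w (zeroʳ c) refl) (trans (d-·ˡ v w c≢0) (cong (c *_) (sym (d-00 v w refl refl))))
  ... | inj₂ nz = begin
    d (c * x ∷ c · v) (y ∷ w)                   ≡⟨ d-lead (c · v) w ([ (λ x≢0 → inj₁ (*-nonzero c≢0 x≢0)) , inj₂ ]′ nz) ⟩
    lead ((c * x) · w ⊟ y · (c · v))            ≡⟨ cong lead (·-⊟ c x y v w) ⟩
    lead (c · (x · w ⊟ y · v))                  ≡⟨ lead-· (x · w ⊟ y · v) c≢0 ⟩
    c * lead (x · w ⊟ y · v)                    ≡⟨ cong (c *_) (d-lead v w nz) ⟨
    c * d (x ∷ v) (y ∷ w)                       ∎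

  d-·ʳ : ∀ {n c} (v w : Vec F n) → c ≢ 0# → d v (c · w) ≡ c * d v w
  d-·ʳ {c = c} v w c≢0 = begin
    d v (c · w)        ≡⟨ d-antisym v (c · w) ⟩
    - d (c · w) v      ≡⟨ cong -_ (d-·ˡ w v c≢0) ⟩
    - (c * d w v)      ≡⟨ -‿distribʳ-* c (d w v) ⟩
    c * - d w v        ≡⟨ cong (c *_) (d-antisym v w) ⟨
    c * d v w          ∎

  ⊞-⊟ : ∀ {n} c x y (v w : Vec F n) → (x + c * y) · w ⊟ y · (v ⊞ c · w) ≡ x · w ⊟ y · v
  ⊞-⊟ c x y [] [] = refl
  ⊞-⊟ c x y (a ∷ v) (b ∷ w) = cong₂ _∷_
    (solve 5 (λ c x y a b → (x :+ c :* y) :* b :- y :* (a :+ c :* b) := x :* b :- y :* a) refl c x y a b) (⊞-⊟ c x y v w)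

  -- (v + c w) ∧ w = v ∧ w. A shear also does not affect whether both first entries vanish, so the
  -- recursion takes the same branch on both sides.
  d-shear : ∀ {n} c (v w : Vec F n) → d (v ⊞ c · w) w ≡ d v w
  d-shear c [] [] = refl
  d-shear c (x ∷ v) (y ∷ w) with zeros? x y
  ... | inj₁ (refl , refl) = trans (d-00 (v ⊞ c · w) w (trans (+-identityˡ _) (zeroʳ c)) refl)
          (trans (d-shear c v w) (sym (d-00 v w refl refl)))
  ... | inj₂ nz = begin
    d (x + c * y ∷ v ⊞ c · w) (y ∷ w)           ≡⟨ d-lead (v ⊞ c · w) w nz′ ⟩
    lead ((x + c * y) · w ⊟ y · (v ⊞ c · w))    ≡⟨ cong lead (⊞-⊟ c x y v w) ⟩
    lead (x · w ⊟ y · v)                        ≡⟨ d-lead v w nz ⟨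
    d (x ∷ v) (y ∷ w)                           ∎
    where
    nz′ : x + c * y ≢ 0# ⊎ y ≢ 0#
    nz′ with y ≟ 0#
    ... | no y≢0  = inj₂ y≢0
    ... | yes refl = inj₁ λ x+c0≡0 → [ (λ x≢0 → x≢0 (trans (sym (trans (cong (x +_) (zeroʳ c)) (+-identityʳ x))) x+c0≡0)) , (λ 0≢0 → 0≢0 refl) ]′ nz

  𝟎⊞ : ∀ {n} (v : Vec F n) → 𝟎 ⊞ v ≡ v
  𝟎⊞ []      = refl
  𝟎⊞ (x ∷ v) = cong₂ _∷_ (+-identityˡ x) (𝟎⊞ v)

  0· : ∀ {n} (v : Vec F n) → 0# · v ≡ 𝟎
  0· []      = refl
  0· (x ∷ v) = cong₂ _∷_ (zeroˡ x) (0· v)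

  d-𝟎ˡ : ∀ {n} (w : Vec F n) → d 𝟎 w ≡ 0#
  d-𝟎ˡ [] = refl
  d-𝟎ˡ {suc n} (y ∷ w) with zeros? 0# y
  ... | inj₁ (_ , y≡0) = trans (d-00 𝟎 w refl y≡0) (d-𝟎ˡ w)
  ... | inj₂ nz = trans (d-lead 𝟎 w nz) (trans (cong lead (vanish y w)) (lead-𝟎 n))
    where
    vanish : ∀ {n} y (w : Vec F n) → 0# · w ⊟ y · 𝟎 ≡ 𝟎
    vanish y []      = refl
    vanish y (b ∷ w) = cong₂ _∷_ (solve 2 (λ y b → con ℤ.0ℤ :* b :- y :* con ℤ.0ℤ := con ℤ.0ℤ) refl y b) (vanish y w)

  d-multiple : ∀ {n} c (w : Vec F n) → d (c · w) w ≡ 0#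
  d-multiple c w = begin
    d (c · w) w          ≡⟨ cong (λ u → d u w) (𝟎⊞ (c · w)) ⟨
    d (𝟎 ⊞ c · w) w      ≡⟨ d-shear c 𝟎 w ⟩
    d 𝟎 w                ≡⟨ d-𝟎ˡ w ⟩
    0#                   ∎

  d-parallel : ∀ {n} a b (w : Vec F n) → d (a · w) (b · w) ≡ 0#
  d-parallel a b w with b ≟ 0#
  ... | no b≢0  = trans (d-·ʳ (a · w) w b≢0) (trans (cong (b *_) (d-multiple a w)) (zeroʳ b))
  ... | yes refl = begin
    d (a · w) (0# · w)     ≡⟨ cong (d (a · w)) (0· w) ⟩
    d (a · w) 𝟎            ≡⟨ d-antisym (a · w) 𝟎 ⟩
    - d 𝟎 (a · w)          ≡⟨ cong -_ (d-𝟎ˡ (a · w)) ⟩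
    - 0#                   ≡⟨ -0#≈0# ⟩
    0#                     ∎

  -- The vectors whose first non-zero entry is 1: one for each line through the origin.
  data Dir : ℕ → Set where
    here  : ∀ {n} → Vec F n → Dir (suc n)
    there : ∀ {n} → Dir n → Dir (suc n)

  vec : ∀ {n} → Dir n → Vec F n
  vec (here v)  = 1# ∷ v
  vec (there e) = 0# ∷ vec e

  coord : ∀ {n} → Dir n → Vec F n → F
  coord (here _)  (x ∷ _) = x
  coord (there e) (_ ∷ v) = coord e v

  coord-vec : ∀ {n} (e : Dir n) → coord e (vec e) ≡ 1#
  coord-vec (here _)  = refl
  coord-vec (there e) = coord-vec e

  coord-⊞ : ∀ {n} (e : Dir n) v w → coord e (v ⊞ w) ≡ coord e v + coord e w
  coord-⊞ (here _)  (_ ∷ _) (_ ∷ _) = refl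
  coord-⊞ (there e) (_ ∷ v) (_ ∷ w) = coord-⊞ e v w

  coord-⊟ : ∀ {n} (e : Dir n) v w → coord e (v ⊟ w) ≡ coord e v - coord e w
  coord-⊟ (here _)  (_ ∷ _) (_ ∷ _) = refl
  coord-⊟ (there e) (_ ∷ v) (_ ∷ w) = coord-⊟ e v w

  coord-· : ∀ {n} (e : Dir n) c v → coord e (c · v) ≡ c * coord e v
  coord-· (here _)  c (_ ∷ _) = refl
  coord-· (there e) c (_ ∷ v) = coord-· e c v

  coord-𝟎 : ∀ {n} (e : Dir n) → coord e 𝟎 ≡ 0#
  coord-𝟎 (here _)  = refl
  coord-𝟎 (there e) = coord-𝟎 e

  coord-·vec : ∀ {n} (e : Dir n) c → coord e (c · vec e) ≡ c
  coord-·vec e c = trans (coord-· e c (vec e)) (trans (cong (c *_) (coord-vec e)) (*-identityʳ c))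

  direction : ∀ {n} (v : Vec F n) → v ≢ 𝟎 → ∃[ e ] (coord e v ≢ 0# × v ≡ coord e v · vec e)
  direction [] v≢𝟎 = ⊥-elim (v≢𝟎 refl)
  direction (x ∷ v) v≢𝟎 with x ≟ 0#
  ... | no x≢0 = here (inv x · v) , x≢0 , cong₂ _∷_ (sym (*-identityʳ x)) (rescale v)
    where
    rescale : ∀ {n} (v : Vec F n) → v ≡ x · (inv x · v)
    rescale []      = refl
    rescale (y ∷ v) = cong₂ _∷_ (begin
      y                   ≡⟨ *-identityˡ y ⟨
      1# * y              ≡⟨ cong (_* y) (inv-inverse x≢0) ⟨
      x * inv x * y       ≡⟨ *-assoc x (inv x) y ⟩
      x * (inv x * y)     ∎) (rescale v)
  ... | yes refl with direction v (λ v≡𝟎 → v≢𝟎 (cong (0# ∷_) v≡𝟎))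
  ...   | e , c≢0 , v≡ce = there e , c≢0 , cong₂ _∷_ (sym (zeroʳ _)) v≡ce

  direction-unique : ∀ {n} (e e′ : Dir n) {c c′} → c ≢ 0# → c · vec e ≡ c′ · vec e′ → e ≡ e′
  direction-unique (here v) (here w) {c} {c′} c≢0 eq with ∷-injective eq
  ... | c1≡c′1 , cv≡c′w = cong here (cancel v w
        (trans cv≡c′w (cong (_· w) (trans (sym (*-identityʳ c′)) (trans (sym c1≡c′1) (*-identityʳ c))))))
    where
    cancel : ∀ {n} (v w : Vec F n) → c · v ≡ c · w → v ≡ w
    cancel [] [] _ = refl
    cancel (_ ∷ v) (_ ∷ w) eq with ∷-injective eq
    ... | head-eq , tail-eq = cong₂ _∷_ (*-cancelˡ c≢0 head-eq) (cancel v w tail-eq)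
  direction-unique (here v) (there e′) {c} {c′} c≢0 eq with ∷-injective eq
  ... | c1≡c′0 , _ = ⊥-elim (c≢0 (trans (sym (*-identityʳ c)) (trans c1≡c′0 (zeroʳ c′))))
  direction-unique (there e) (here w) {c} {c′} c≢0 eq with ∷-injective eq
  ... | c0≡c′1 , ce≡c′w = ⊥-elim (c≢0 (trans (sym (coord-·vec e c)) (trans (cong (coord e)
          (trans ce≡c′w (trans (cong (_· w) (trans (sym (*-identityʳ c′)) (trans (sym c0≡c′1) (zeroʳ c)))) (0· w)))) (coord-𝟎 e))))
  direction-unique (there e) (there e′) c≢0 eq = cong there (direction-unique e e′ c≢0 (proj₂ (∷-injective eq)))

  -- Together with `d-multiple` this makes `d` a test for collinearity. At the first position where
  -- `v` or `vec e` is non-zero, `d` is the leading entry of a combination x · w - y · v of the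
  -- tails, so this combination is zero. If the position precedes that of the leading 1 of `e`, it
  -- is a non-zero multiple of the tail of `vec e`, a contradiction.
  d≡0⇒multiple : ∀ {n} v (e : Dir n) → d v (vec e) ≡ 0# → v ≡ coord e v · vec e
  d≡0⇒multiple (x ∷ v) (here w) d≡0 = cong₂ _∷_ (sym (*-identityʳ x))
    (equal v w (lead≡0 _ (trans (sym (d-lead v w (inj₂ 1≢0))) d≡0)))
    where
    equal : ∀ {n} (v w : Vec F n) → x · w ⊟ 1# · v ≡ 𝟎 → v ≡ x · w
    equal [] [] _ = refl
    equal (a ∷ v) (b ∷ w) eq with ∷-injective eq
    ... | head-eq , tail-eq = cong₂ _∷_ (sym (trans (x∙y⁻¹≈ε⇒x≈y _ _ head-eq) (*-identityˡ a))) (equal v w tail-eq)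
  d≡0⇒multiple (x ∷ v) (there e) d≡0 with zero? x
  ... | inj₁ refl = cong₂ _∷_ (sym (zeroʳ _)) (d≡0⇒multiple v e (trans (sym (d-00 v (vec e) refl refl)) d≡0))
  ... | inj₂ x≢0 = ⊥-elim (x≢0 (begin
    x                                    ≡⟨ coord-·vec e x ⟨
    coord e (x · vec e)                  ≡⟨ cong (coord e) (simplify v (vec e)) ⟨
    coord e (x · vec e ⊟ 0# · v)         ≡⟨ cong (coord e) (lead≡0 _ (trans (sym (d-lead v (vec e) (inj₁ x≢0))) d≡0)) ⟩
    coord e 𝟎                            ≡⟨ coord-𝟎 e ⟩
    0#                                   ∎))
    where
    simplify : ∀ {n} (v w : Vec F n) → x · w ⊟ 0# · v ≡ x · w
    simplify [] [] = refl
    simplify (a ∷ v) (b ∷ w) = cong₂ _∷_ (solve 3 (λ x a b → x :* b :- con ℤ.0ℤ :* a := x :* b) refl x a b) (simplify v w)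

-- Maps of order three and pairs of independent vectors

module Frame {q s} (𝔽 : FiniteField q s) where
  open FiniteField 𝔽
  open LinearAlgebra 𝔽
  open IntegerSolver commutativeRing
  open ≡.≡-Reasoning

  ⊞⊟-cancel : ∀ {n} (x v : Vec F n) → (x ⊞ v) ⊟ x ≡ v
  ⊞⊟-cancel [] [] = refl
  ⊞⊟-cancel (a ∷ x) (b ∷ v) = cong₂ _∷_ (solve 2 (λ a b → a :+ b :- a := b) refl a b) (⊞⊟-cancel x v)

  ⊞-⊟-cancel : ∀ {n} (x y : Vec F n) → x ⊞ (y ⊟ x) ≡ y
  ⊞-⊟-cancel [] [] = refl
  ⊞-⊟-cancel (a ∷ x) (b ∷ y) = cong₂ _∷_ (solve 2 (λ a b → a :+ (b :- a) := b) refl a b) (⊞-⊟-cancel x y)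

  ⊟-self : ∀ {n} (x : Vec F n) → x ⊟ x ≡ 𝟎
  ⊟-self []      = refl
  ⊟-self (a ∷ x) = cong₂ _∷_ (-‿inverseʳ a) (⊟-self x)

  ⊟≡𝟎⇒≡ : ∀ {n} (y x : Vec F n) → y ⊟ x ≡ 𝟎 → y ≡ x
  ⊟≡𝟎⇒≡ [] [] _ = refl
  ⊟≡𝟎⇒≡ (a ∷ y) (b ∷ x) eq with ∷-injective eq
  ... | head-eq , tail-eq = cong₂ _∷_ (x∙y⁻¹≈ε⇒x≈y a b head-eq) (⊟≡𝟎⇒≡ y x tail-eq)

  ⊞-cancelʳ : ∀ {n} (v : Vec F n) {x y} → x ⊞ v ≡ y ⊞ v → x ≡ y
  ⊞-cancelʳ v {x} {y} eq = trans (sym (cancel x v)) (trans (cong (_⊟ v) eq) (cancel y v))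
    where
    cancel : ∀ {n} (x v : Vec F n) → (x ⊞ v) ⊟ v ≡ x
    cancel [] [] = refl
    cancel (a ∷ x) (b ∷ v) = cong₂ _∷_ (solve 2 (λ a b → a :+ b :- b := a) refl a b) (cancel x v)

  -- Off ⟨e⟩ this is a permutation of order three with d v (swing e b v) = b, whence an independent
  -- pair is a step in exactly one direction, for exactly one e and j.
  swing : ∀ {n} → Dir n → F → Vec F n → Vec F n
  swing e b v = ω · v ⊞ (b * inv (d v (vec e))) · vec e

  d-swing-vec : ∀ {n} (e : Dir n) b v → d (swing e b v) (vec e) ≡ ω * d v (vec e)
  d-swing-vec e b v = trans (d-shear _ (ω · v) (vec e)) (d-·ˡ v (vec e) ω≢0)

  d-swing-vec≢0 : ∀ {n} (e : Dir n) b v → d v (vec e) ≢ 0# → d (swing e b v) (vec e) ≢ 0#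
  d-swing-vec≢0 e b v d≢0 = subst (_≢ 0#) (sym (d-swing-vec e b v)) (*-nonzero ω≢0 d≢0)

  d-swing : ∀ {n} (e : Dir n) b v → b ≢ 0# → d v (vec e) ≢ 0# → d v (swing e b v) ≡ b
  d-swing e b v b≢0 d≢0 = begin
    d v (swing e b v)                   ≡⟨ d-antisym v _ ⟩
    - d (ω · v ⊞ g · vec e) v           ≡⟨ cong (λ u → - d u v) (⊞-comm (ω · v) (g · vec e)) ⟩
    - d (g · vec e ⊞ ω · v) v           ≡⟨ cong -_ (d-shear ω (g · vec e) v) ⟩
    - d (g · vec e) v                   ≡⟨ d-antisym v (g · vec e) ⟨
    d v (g · vec e)                     ≡⟨ d-·ʳ v (vec e) (*-nonzero b≢0 (inv-nonzero d≢0)) ⟩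
    b * inv Δ * Δ                       ≡⟨ solve 3 (λ b i c → b :* i :* c := b :* (c :* i)) refl b (inv Δ) Δ ⟩
    b * (Δ * inv Δ)                     ≡⟨ cong (b *_) (inv-inverse d≢0) ⟩
    b * 1#                              ≡⟨ *-identityʳ b ⟩
    b                                   ∎
    where
    Δ = d v (vec e)
    g = b * inv Δ
    ⊞-comm : ∀ {n} (v w : Vec F n) → v ⊞ w ≡ w ⊞ v
    ⊞-comm [] [] = refl
    ⊞-comm (a ∷ v) (b ∷ w) = cong₂ _∷_ (solve 2 (λ a b → a :+ b := b :+ a) refl a b) (⊞-comm v w)

  -- Each step multiplies d(v, e) by ω and hence the coefficient of e by ω⁻¹ = ω². Owing to this
  -- twist the multiples of e in an orbit cancel along with those of v.
  swing-swing : ∀ {n} (e : Dir n) b v → d v (vec e) ≢ 0# →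
    swing e b (swing e b v) ≡ ω · swing e b v ⊞ (ω * ω * (b * inv (d v (vec e)))) · vec e
  swing-swing e b v d≢0 = cong (λ z → ω · swing e b v ⊞ z · vec e) (begin
    b * inv (d (swing e b v) (vec e))    ≡⟨ cong (λ z → b * inv z) (d-swing-vec e b v) ⟩
    b * inv (ω * d v (vec e))            ≡⟨ cong (b *_) (inv-ω d≢0) ⟩
    b * (ω * ω * inv (d v (vec e)))      ≡⟨ solve 3 (λ b w i → b :* (w :* w :* i) := w :* w :* (b :* i)) refl b ω (inv (d v (vec e))) ⟩
    ω * ω * (b * inv (d v (vec e)))      ∎)

  swing-sum : ∀ {n} (e : Dir n) b v → d v (vec e) ≢ 0# → v ⊞ swing e b v ⊞ swing e b (swing e b v) ≡ 𝟎
  swing-sum e b v d≢0 = trans (cong (v ⊞ swing e b v ⊞_) (swing-swing e b v d≢0)) (sums v (vec e))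
    where
    g = b * inv (d v (vec e))
    sums : ∀ {n} (v u : Vec F n) → v ⊞ (ω · v ⊞ g · u) ⊞ (ω · (ω · v ⊞ g · u) ⊞ (ω * ω * g) · u) ≡ 𝟎
    sums [] [] = refl
    sums (a ∷ v) (c ∷ u) = cong₂ _∷_ (begin
      a + (ω * a + g * c) + (ω * (ω * a + g * c) + ω * ω * g * c)
        ≡⟨ solve 4 (λ a w g c → a :+ (w :* a :+ g :* c) :+ (w :* (w :* a :+ g :* c) :+ w :* w :* g :* c)
             := (con ℤ.1ℤ :+ w :+ w :* w) :* (a :+ g :* c)) refl a ω g c ⟩
      (1# + ω + ω * ω) * (a + g * c)   ≡⟨ cong (_* (a + g * c)) ω-root ⟩
      0# * (a + g * c)                 ≡⟨ zeroˡ _ ⟩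
      0#                               ∎) (sums v u)

  -- The first three vectors of the orbit have sum zero, and so have the next three starting one
  -- step later; hence the fourth vector equals the first.
  swing³ : ∀ {n} (e : Dir n) b v → d v (vec e) ≢ 0# → swing e b (swing e b (swing e b v)) ≡ v
  swing³ e b v d≢0 = complement (swing-sum e b v d≢0) (swing-sum e b (swing e b v) (d-swing-vec≢0 e b v d≢0))
    where
    complement : ∀ {n} {v u w t : Vec F n} → v ⊞ u ⊞ w ≡ 𝟎 → u ⊞ w ⊞ t ≡ 𝟎 → t ≡ v
    complement {v = []} {[]} {[]} {[]} _ _ = refl
    complement {v = a ∷ _} {b ∷ _} {c ∷ _} {d ∷ _} p r with ∷-injective p | ∷-injective r
    ... | a+b+c≡0 , ps | b+c+d≡0 , rs = cong₂ _∷_ (begin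
      d                            ≡⟨ solve 4 (λ a b c d → d := b :+ c :+ d :- (a :+ b :+ c) :+ a) refl a b c d ⟩
      b + c + d - (a + b + c) + a  ≡⟨ cong₂ (λ x y → x - y + a) b+c+d≡0 a+b+c≡0 ⟩
      0# - 0# + a                  ≡⟨ solve 1 (λ a → con ℤ.0ℤ :- con ℤ.0ℤ :+ a := a) refl a ⟩
      a                            ∎) (complement ps rs)

  d-self : ∀ {n} (v : Vec F n) → d v v ≡ 0#
  d-self v = trans (cong (λ u → d u v) (sym (1· v))) (d-multiple 1# v)
    where
    1· : ∀ {n} (v : Vec F n) → 1# · v ≡ v
    1· []      = refl
    1· (a ∷ v) = cong₂ _∷_ (*-identityˡ a) (1· v)

  FrameStep : ∀ {n} → Dir n → Fin s → Vec F n → Vec F n → Set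
  FrameStep e j v w = d v (vec e) ≢ 0# × swing e (β j) v ≡ w

  frame-step-d : ∀ {n} {e : Dir n} {j v w} → FrameStep e j v w → d v w ≡ β j
  frame-step-d {e = e} {j} {v} (d≢0 , refl) = d-swing e (β j) v (β≢0 j) d≢0

  frame-step-exists : ∀ {n} (v w : Vec F n) j → d v w ≡ β j → ∃[ e ] FrameStep e j v w
  frame-step-exists v w j dvw≡β = e , d≢0 , (begin
    ω · v ⊞ (β j * inv Δ) · vec e     ≡⟨ cong (λ z → ω · v ⊞ z · vec e) γ≡ ⟨
    ω · v ⊞ γ · vec e                 ≡⟨ cong (ω · v ⊞_) u≡γe ⟨
    ω · v ⊞ u                         ≡⟨ ⊞-⊟-cancel (ω · v) w ⟩
    w                                 ∎)
    where
    -- A step from v to w forces w - ωv to be a multiple of `vec e`, so its direction is the only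
    -- candidate for `e`.
    u = w ⊟ ω · v
    sheared : d v u ≡ β j
    sheared = begin
      d v u                          ≡⟨ d-antisym v u ⟩
      - d u v                        ≡⟨ cong -_ (d-shear ω u v) ⟨
      - d (u ⊞ ω · v) v              ≡⟨ cong (λ z → - d z v) (restore w (ω · v)) ⟩
      - d w v                        ≡⟨ d-antisym v w ⟨
      d v w                          ≡⟨ dvw≡β ⟩
      β j                            ∎
      where
      restore : ∀ {n} (w v : Vec F n) → (w ⊟ v) ⊞ v ≡ w
      restore [] [] = refl
      restore (a ∷ w) (b ∷ v) = cong₂ _∷_ (solve 2 (λ a b → a :- b :+ b := a) refl a b) (restore w v)
    u≢𝟎 : u ≢ 𝟎
    u≢𝟎 u≡𝟎 = β≢0 j (trans (sym sheared) (trans (cong (d v) u≡𝟎)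
      (trans (d-antisym v 𝟎) (trans (cong -_ (d-𝟎ˡ v)) -0#≈0#))))
    dir = direction u u≢𝟎
    e = proj₁ dir
    γ = coord e u
    u≡γe : u ≡ γ · vec e
    u≡γe = proj₂ (proj₂ dir)
    Δ = d v (vec e)
    γΔ≡β : γ * Δ ≡ β j
    γΔ≡β = trans (sym (d-·ʳ v (vec e) (proj₁ (proj₂ dir)))) (trans (cong (d v) (sym u≡γe)) sheared)
    d≢0 : Δ ≢ 0#
    d≢0 Δ≡0 = β≢0 j (trans (sym γΔ≡β) (trans (cong (γ *_) Δ≡0) (zeroʳ γ)))
    γ≡ : γ ≡ β j * inv Δ
    γ≡ = begin
      γ                   ≡⟨ *-identityʳ γ ⟨
      γ * 1#              ≡⟨ cong (γ *_) (inv-inverse d≢0) ⟨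
      γ * (Δ * inv Δ)     ≡⟨ *-assoc γ Δ (inv Δ) ⟨
      γ * Δ * inv Δ       ≡⟨ cong (_* inv Δ) γΔ≡β ⟩
      β j * inv Δ         ∎

  frame-step-unique : ∀ {n} {e e′ : Dir n} {j j′ v w} → FrameStep e j v w → FrameStep e′ j′ v w → e ≡ e′ × j ≡ j′
  frame-step-unique {e = e} {e′} {j} {j′} {v} p@(d≢0 , eq) r@(_ , eq′) =
    direction-unique e e′ (*-nonzero (β≢0 j) (inv-nonzero d≢0)) (⊞-cancelˡ (ω · v) (trans eq (sym eq′))) ,
    β-injective (trans (sym (frame-step-d p)) (frame-step-d r))
    where
    ⊞-cancelˡ : ∀ {n} (x : Vec F n) {u w} → x ⊞ u ≡ x ⊞ w → u ≡ w
    ⊞-cancelˡ x {u} {w} eq = trans (sym (⊞⊟-cancel x u)) (trans (cong (_⊟ x) eq) (⊞⊟-cancel x w))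

  FrameAdjacent : ∀ {n} → Dir n → Fin s → Vec F n → Vec F n → Set
  FrameAdjacent e j v w = FrameStep e j v w ⊎ FrameStep e j w v

  frame-adjacent-d : ∀ {n} {e : Dir n} {j v w} → FrameAdjacent e j v w → d v w ≢ 0#
  frame-adjacent-d {j = j} (inj₁ step) dvw≡0 = β≢0 j (trans (sym (frame-step-d step)) dvw≡0)
  frame-adjacent-d {j = j} {v} {w} (inj₂ step) dvw≡0 = β≢0 j (trans (sym (frame-step-d step))
    (trans (d-antisym w v) (trans (cong -_ dvw≡0) -0#≈0#)))

  frame-adjacent-exists : ∀ {n} (v w : Vec F n) → d v w ≢ 0# → ∃[ e ] ∃[ j ] FrameAdjacent e j v w
  frame-adjacent-exists v w d≢0 with β-covers (d v w) d≢0
  ... | j , inj₁ d≡β = let e , step = frame-step-exists v w j d≡β in e , j , inj₁ step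
  ... | j , inj₂ d≡-β =
    let e , step = frame-step-exists w v j (trans (d-antisym w v) (trans (cong -_ d≡-β) (-‿involutive _)))
    in e , j , inj₂ step

  -- Otherwise d(v, w) would be one of the β and also the negative of one.
  opposite-steps : ∀ {n} {e e′ : Dir n} {j j′ v w} → FrameStep e j v w → ¬ FrameStep e′ j′ w v
  opposite-steps {j = j} {j′} {v} {w} p r = β-signs j j′
    (trans (sym (frame-step-d p)) (trans (d-antisym v w) (cong -_ (frame-step-d r))))

  frame-adjacent-unique : ∀ {n} {e e′ : Dir n} {j j′ v w} →
    FrameAdjacent e j v w → FrameAdjacent e′ j′ v w → (e , j) ≡ (e′ , j′)
  frame-adjacent-unique (inj₁ p) (inj₁ r) with frame-step-unique p r
  ... | refl , refl = refl
  frame-adjacent-unique (inj₁ p) (inj₂ r) = ⊥-elim (opposite-steps p r)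
  frame-adjacent-unique (inj₂ p) (inj₁ r) = ⊥-elim (opposite-steps r p)
  frame-adjacent-unique (inj₂ p) (inj₂ r) with frame-step-unique p r
  ... | refl , refl = refl

  -- With a = v - u and v + u + w = 0 one has w - u = - a - 3 u, and d is invariant under shears.
  zero-sum-noncollinear : ∀ {n} (v u w : Vec F n) → v ⊞ u ⊞ w ≡ 𝟎 → d v u ≢ 0# → d (v ⊟ u) (w ⊟ u) ≢ 0#
  zero-sum-noncollinear v u w sum≡𝟎 d≢0 d≡0 = *-nonzero -3≢0 d≢0 (begin
    -3# * d v u                            ≡⟨ cong (-3# *_) (trans (d-antisym v u) (cong -_ (trans (d-antisym u v) (cong -_ (sym d-a))))) ⟩
    -3# * - - d a u                        ≡⟨ cong (-3# *_) (-‿involutive (d a u)) ⟩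
    -3# * d a u                            ≡⟨ d-·ʳ a u -3≢0 ⟨
    d a (-3# · u)                          ≡⟨ d-antisym a (-3# · u) ⟩
    - d (-3# · u) a                        ≡⟨ cong -_ (d-shear (- 1#) (-3# · u) a) ⟨
    - d (-3# · u ⊞ (- 1#) · a) a           ≡⟨ d-antisym a _ ⟨
    d a (-3# · u ⊞ (- 1#) · a)             ≡⟨ cong (d a) (rest sum≡𝟎) ⟨
    d a (w ⊟ u)                            ≡⟨ d≡0 ⟩
    0#                                     ∎)
    where
    -3# = - (1# + 1# + 1#)
    -3≢0 : -3# ≢ 0#
    -3≢0 -3≡0 = 3≢0 (trans (sym (-‿involutive _)) (trans (cong -_ -3≡0) -0#≈0#))
    a = v ⊟ u
    d-a : d a u ≡ d v u
    d-a = trans (cong (λ z → d z u) (as-shear v u)) (d-shear (- 1#) v u)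
      where
      as-shear : ∀ {n} (v u : Vec F n) → v ⊟ u ≡ v ⊞ (- 1#) · u
      as-shear [] [] = refl
      as-shear (a ∷ v) (b ∷ u) = cong₂ _∷_ (solve 2 (λ a b → a :- b := a :+ (:- con ℤ.1ℤ) :* b) refl a b) (as-shear v u)
    rest : ∀ {n} {v u w : Vec F n} → v ⊞ u ⊞ w ≡ 𝟎 → w ⊟ u ≡ -3# · u ⊞ (- 1#) · (v ⊟ u)
    rest {v = []} {[]} {[]} _ = refl
    rest {v = a ∷ _} {b ∷ _} {c ∷ _} eq with ∷-injective eq
    ... | a+b+c≡0 , eqs = cong₂ _∷_ (begin
      c - b
        ≡⟨ solve 3 (λ a b c → c :- b := a :+ b :+ c :+ ((:- (con ℤ.1ℤ :+ con ℤ.1ℤ :+ con ℤ.1ℤ)) :* b :+ (:- con ℤ.1ℤ) :* (a :- b))) refl a b c ⟩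
      a + b + c + (-3# * b + - 1# * (a - b))   ≡⟨ cong (_+ (-3# * b + - 1# * (a - b))) a+b+c≡0 ⟩
      0# + (-3# * b + - 1# * (a - b))          ≡⟨ +-identityˡ _ ⟩
      -3# * b + - 1# * (a - b)                 ∎) (rest eqs)

  -- The two sums differ by 3 (x - x′), and 3 is not zero in F.
  centroid-unique : ∀ {n} (y z w x x′ : Vec F n) →
    (y ⊟ x) ⊞ (z ⊟ x) ⊞ (w ⊟ x) ≡ 𝟎 → (y ⊟ x′) ⊞ (z ⊟ x′) ⊞ (w ⊟ x′) ≡ 𝟎 → x ≡ x′
  centroid-unique [] [] [] [] [] _ _ = refl
  centroid-unique (y ∷ ys) (z ∷ zs) (w ∷ ws) (x ∷ xs) (x′ ∷ xs′) eq eq′ with ∷-injective eq | ∷-injective eq′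
  ... | p , ps | p′ , ps′ = cong₂ _∷_ (x∙y⁻¹≈ε⇒x≈y x x′ (zero-product (begin
    (1# + 1# + 1#) * (x - x′)
      ≡⟨ solve 5 (λ y z w x x′ → (con ℤ.1ℤ :+ con ℤ.1ℤ :+ con ℤ.1ℤ) :* (x :- x′)
           := (y :- x′ :+ (z :- x′) :+ (w :- x′)) :- (y :- x :+ (z :- x) :+ (w :- x))) refl y z w x x′ ⟩
    (y - x′ + (z - x′) + (w - x′)) - (y - x + (z - x) + (w - x))    ≡⟨ cong₂ _-_ p′ p ⟩
    0# - 0#                                                         ≡⟨ -‿inverseʳ 0# ⟩
    0#                                                              ∎) 3≢0)) (centroid-unique ys zs ws xs xs′ ps ps′)

-- The construction

-- A Kirkman triple system on X with parallel classes C: class c consists of the orbits of next c.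
record Kirkman (X C : Set) : Set where
  field
    next  : C → X → X
    next³ : ∀ c x → next c (next c (next c x)) ≡ x
    next≢ : ∀ c x → next c x ≢ x

  Adjacent : C → X → X → Set
  Adjacent c x y = next c x ≡ y ⊎ next c y ≡ x

  field
    covers : ∀ {x y} → x ≢ y → ∃[ c ] Adjacent c x y
    unique : ∀ {x y c c′} → Adjacent c x y → Adjacent c′ x y → c ≡ c′

  adjacent-irrefl : ∀ {c x y} → Adjacent c x y → x ≢ y
  adjacent-irrefl (inj₁ eq) refl = next≢ _ _ eq
  adjacent-irrefl (inj₂ eq) refl = next≢ _ _ eq

  next-injective : ∀ {c x y} → next c x ≡ next c y → x ≡ y
  next-injective {c} {x} {y} eq = trans (sym (next³ c x)) (trans (cong (λ z → next c (next c z)) eq) (next³ c y))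

  Cycle : C → X → X → X → Set
  Cycle c x y z = next c x ≡ y × next c y ≡ z

  Block : X → X → X → Set
  Block x y z = ∃[ c ] (Cycle c x y z ⊎ Cycle c z y x)

  block-reverse : ∀ {x y z} → Block x y z → Block z y x
  block-reverse (c , inj₁ cycle) = c , inj₂ cycle
  block-reverse (c , inj₂ cycle) = c , inj₁ cycle

  block-rotate : ∀ {x y z} → Block x y z → Block y z x
  block-rotate {x} (c , inj₁ (refl , refl)) = c , inj₁ (refl , next³ c x)
  block-rotate {z = z} (c , inj₂ (refl , refl)) = c , inj₂ (next³ c z , refl)

  block-distinct : ∀ {x y z} → Block x y z → x ≢ y
  block-distinct (c , inj₁ (x→y , _)) = adjacent-irrefl (inj₁ x→y)
  block-distinct (c , inj₂ (_ , y→x)) = adjacent-irrefl (inj₂ y→x)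

PairwiseDisjoint : ∀ {I X : Set} {C : I → Set} → ((i : I) → Kirkman X (C i)) → Set
PairwiseDisjoint K = ∀ {i j x y z} → Kirkman.Block (K i) x y z → Kirkman.Block (K j) x y z → i ≡ j

data Point (A : Set) : Set where
  ∞₁ ∞₂ : Point A
  pt    : A → Point A

pt-injective : ∀ {A : Set} {x y : A} → pt x ≡ pt y → x ≡ y
pt-injective refl = refl

-- The new systems and their parallel classes

module Construction {q s} (𝔽 : FiniteField q s)
  (K : Fin q → Kirkman (Point (Fin q)) (Maybe (Fin s)))
  (base₁ : ∀ a → Kirkman.next (K a) nothing ∞₁ ≡ ∞₂)
  (base₂ : ∀ a → Kirkman.next (K a) nothing ∞₂ ≡ pt a)
  (K-disjoint : PairwiseDisjoint K)
  (n : ℕ) where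

  open FiniteField 𝔽
  open LinearAlgebra 𝔽
  open Frame 𝔽
  open IntegerSolver commutativeRing
  open ≡.≡-Reasoning
  private module K a = Kirkman (K a)

  V : Set
  V = Vec F (suc n)

  D : Set
  D = Dir (suc n)

  base₃ : ∀ a → K.next a nothing (pt a) ≡ ∞₁
  base₃ a = begin
    K.next a nothing (pt a)                                     ≡⟨ cong (K.next a nothing) (base₂ a) ⟨
    K.next a nothing (K.next a nothing ∞₂)                      ≡⟨ cong (λ z → K.next a nothing (K.next a nothing z)) (base₁ a) ⟨
    K.next a nothing (K.next a nothing (K.next a nothing ∞₁))   ≡⟨ K.next³ a nothing ∞₁ ⟩
    ∞₁                                                          ∎

  -- The point of the line x + ⟨e⟩ with a given coordinate.
  onto : V → D → Point F → Point V
  onto x e ∞₁     = ∞₁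
  onto x e ∞₂     = ∞₂
  onto x e (pt t) = pt (x ⊞ (t - coord e x) · vec e)

  crd : D → Point V → Point F
  crd e ∞₁     = ∞₁
  crd e ∞₂     = ∞₂
  crd e (pt y) = pt (coord e y)

  crd-onto : ∀ x e P → crd e (onto x e P) ≡ P
  crd-onto x e ∞₁     = refl
  crd-onto x e ∞₂     = refl
  crd-onto x e (pt t) = cong pt (begin
    coord e (x ⊞ (t - coord e x) · vec e)            ≡⟨ coord-⊞ e x _ ⟩
    coord e x + coord e ((t - coord e x) · vec e)    ≡⟨ cong (coord e x +_) (coord-·vec e _) ⟩
    coord e x + (t - coord e x)                      ≡⟨ solve 2 (λ c t → c :+ (t :- c) := t) refl (coord e x) t ⟩
    t                                                ∎)

  -- With this form ∞₁ and ∞₂ lie on every line by `refl`, and two points of a line are equal as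
  -- soon as their coordinates are.
  OnLine : V → D → Point V → Set
  OnLine x e P = onto x e (crd e P) ≡ P

  onto-onLine : ∀ x e P → OnLine x e (onto x e P)
  onto-onLine x e P = cong (onto x e) (crd-onto x e P)

  crd-injective : ∀ {x e P Q} → OnLine x e P → OnLine x e Q → crd e P ≡ crd e Q → P ≡ Q
  crd-injective {x} {e} p q eq = trans (sym p) (trans (cong (onto x e) eq) q)

  onLine⇒multiple : ∀ {x e y} → OnLine x e (pt y) → y ⊟ x ≡ (coord e y - coord e x) · vec e
  onLine⇒multiple {x} {e} {y} p = trans (cong (_⊟ x) (sym (pt-injective p))) (⊞⊟-cancel x _)

  multiple⇒onLine : ∀ {x e y} c → y ⊟ x ≡ c · vec e → OnLine x e (pt y)
  multiple⇒onLine {x} {e} {y} c eq = cong pt (begin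
    x ⊞ (coord e y - coord e x) · vec e    ≡⟨ cong (λ z → x ⊞ z · vec e) c≡ ⟨
    x ⊞ c · vec e                          ≡⟨ cong (x ⊞_) eq ⟨
    x ⊞ (y ⊟ x)                            ≡⟨ ⊞-⊟-cancel x y ⟩
    y                                      ∎)
    where
    c≡ : c ≡ coord e y - coord e x
    c≡ = trans (sym (coord-·vec e c)) (trans (cong (coord e) (sym eq)) (coord-⊟ e y x))

  onLine⇒d≡0 : ∀ {x e y} → OnLine x e (pt y) → d (y ⊟ x) (vec e) ≡ 0#
  onLine⇒d≡0 {x} {e} {y} p = trans (cong (λ u → d u (vec e)) (onLine⇒multiple {x} {e} {y} p)) (d-multiple _ (vec e))

  onLine-d : ∀ {x e y z} → OnLine x e (pt y) → OnLine x e (pt z) → d (y ⊟ x) (z ⊟ x) ≡ 0#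
  onLine-d {x} {e} {y} {z} p r = trans (cong₂ d (onLine⇒multiple {x} {e} {y} p) (onLine⇒multiple {x} {e} {z} r)) (d-parallel _ _ (vec e))

  centre-onLine : ∀ (x : V) e → OnLine x e (pt x)
  centre-onLine x e = multiple⇒onLine 0# (trans (⊟-self x) (sym (0· (vec e))))

  OffLine : V → D → Point V → Set
  OffLine x e P = ∃[ y ] (P ≡ pt y × d (y ⊟ x) (vec e) ≢ 0#)

  onLine? : ∀ x e P → OnLine x e P ⊎ OffLine x e P
  onLine? x e ∞₁ = inj₁ refl
  onLine? x e ∞₂ = inj₁ refl
  onLine? x e (pt y) with zero? (d (y ⊟ x) (vec e))
  ... | inj₁ d≡0 = inj₁ (multiple⇒onLine _ (d≡0⇒multiple (y ⊟ x) e d≡0))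
  ... | inj₂ d≢0 = inj₂ (y , refl , d≢0)

  on⇒¬off : ∀ {x e P} → OnLine x e P → ¬ OffLine x e P
  on⇒¬off {x} {e} p (y , refl , d≢0) = d≢0 (onLine⇒d≡0 {x} {e} {y} p)

  centre? : (x y : V) → y ≡ x ⊎ y ⊟ x ≢ 𝟎
  centre? x y with lead-zero? (y ⊟ x)
    where
    lead-zero? : ∀ {n} (v : Vec F n) → v ≡ 𝟎 ⊎ v ≢ 𝟎
    lead-zero? {n} v with zero? (lead v)
    ... | inj₁ lead≡0# = inj₁ (lead≡0 v lead≡0#)
    ... | inj₂ lead≢0 = inj₂ λ v≡𝟎 → lead≢0 (trans (cong lead v≡𝟎) (lead-𝟎 n))
  ... | inj₁ ≡𝟎 = inj₁ (⊟≡𝟎⇒≡ y x ≡𝟎)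
  ... | inj₂ ≢𝟎 = inj₂ ≢𝟎

  line-through : ∀ x P → ∃[ e ] OnLine x e P
  -- ∞₁, ∞₂ and x lie on all lines through x, so a default direction serves; `here 𝟎` exists because
  -- the dimension is positive.
  line-through x ∞₁ = here 𝟎 , refl
  line-through x ∞₂ = here 𝟎 , refl
  line-through x (pt y) with centre? x y
  ... | inj₁ refl = here 𝟎 , centre-onLine x (here 𝟎)
  ... | inj₂ y⊟x≢𝟎 = let e , _ , eq = direction (y ⊟ x) y⊟x≢𝟎 in e , multiple⇒onLine _ eq

  Independent : V → Point V → Point V → Set
  Independent x P Q = ∃[ y ] ∃[ z ] (P ≡ pt y × Q ≡ pt z × d (y ⊟ x) (z ⊟ x) ≢ 0#)

  -- An affine point other than x determines its line through x, the other points lie on all lines.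
  onEveryLine? : ∀ x P → (∀ e → OnLine x e P) ⊎
    (∃[ y ] ∃[ e ] (P ≡ pt y × coord e (y ⊟ x) ≢ 0# × y ⊟ x ≡ coord e (y ⊟ x) · vec e))
  onEveryLine? x ∞₁ = inj₁ λ _ → refl
  onEveryLine? x ∞₂ = inj₁ λ _ → refl
  onEveryLine? x (pt y) with centre? x y
  ... | inj₁ refl = inj₁ (centre-onLine x)
  ... | inj₂ y⊟x≢𝟎 = let e , c≢0 , eq = direction (y ⊟ x) y⊟x≢𝟎 in inj₂ (y , e , refl , c≢0 , eq)

  -- If `P` lies on all lines through x, a line through `Q` serves. Otherwise `P` determines the
  -- direction, and `Q` is tested against it.
  common-line? : ∀ x P Q → (∃[ e ] (OnLine x e P × OnLine x e Q)) ⊎ Independent x P Q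
  common-line? x P Q with onEveryLine? x P
  ... | inj₁ all = let e , q = line-through x Q in inj₁ (e , all e , q)
  ... | inj₂ (y , e , refl , c≢0 , eq) with onLine? x e Q
  ...   | inj₁ q = inj₁ (e , multiple⇒onLine _ eq , q)
  ...   | inj₂ (z , refl , d≢0) = inj₂ (y , z , refl , refl , λ d≡0 → d≢0 (trans (d-antisym (z ⊟ x) (vec e))
            (trans (cong -_ (zero-product (trans (sym (d-·ˡ (vec e) (z ⊟ x) c≢0)) (trans (cong (λ u → d u (z ⊟ x)) (sym eq)) d≡0)) c≢0)) -0#≈0#)))

  -- Class nothing consists of the blocks of the small classes nothing on all lines through x, class
  -- (e , j) of those of the small class j on the line x + ⟨e⟩ and of non-collinear triples off this line.
  Class : Set
  Class = Maybe (D × Fin s)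

  on-line-next : V → D → Maybe (Fin s) → Point V → Point V
  on-line-next x e c P = onto x e (K.next (coord e x) c (crd e P))

  step : V → Class → Point V → Point V
  step x nothing ∞₁ = ∞₂
  step x nothing ∞₂ = pt x
  step x nothing (pt y) with centre? x y
  ... | inj₁ _      = ∞₁
  ... | inj₂ y⊟x≢𝟎 = on-line-next x (proj₁ (direction (y ⊟ x) y⊟x≢𝟎)) nothing (pt y)
  step x (just (e , j)) P with onLine? x e P
  ... | inj₁ _           = on-line-next x e (just j) P
  ... | inj₂ (y , _ , _) = pt (x ⊞ swing e (β j) (y ⊟ x))

  lift : D → Maybe (Fin s) → Class
  lift e nothing  = nothing
  lift e (just j) = just (e , j)

  -- This refers all questions about points of one line to the given system there. For class
  -- `nothing` it says that the lines fit together: they share the block {∞₁, ∞₂, x}, and any other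
  -- point of the line leads back to the direction `e`.
  step-on : ∀ x e c {P} → OnLine x e P → step x (lift e c) P ≡ on-line-next x e c P
  step-on x e nothing {∞₁} p = sym (cong (onto x e) (base₁ (coord e x)))
  step-on x e nothing {∞₂} p = sym (trans (cong (onto x e) (base₂ (coord e x))) (centre-onLine x e))
  step-on x e nothing {pt y} p with centre? x y
  ... | inj₁ refl = sym (cong (onto x e) (base₃ (coord e x)))
  ... | inj₂ y⊟x≢𝟎 = cong (λ e → on-line-next x e nothing (pt y))
          (direction-unique _ e (proj₁ (proj₂ dir)) (trans (sym (proj₂ (proj₂ dir))) (onLine⇒multiple {x} {e} {y} p)))
    where dir = direction (y ⊟ x) y⊟x≢𝟎
  step-on x e (just j) {P} p with onLine? x e P
  ... | inj₁ _   = refl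
  ... | inj₂ off = ⊥-elim (on⇒¬off p off)

  step-off : ∀ x e j {y} → d (y ⊟ x) (vec e) ≢ 0# → step x (just (e , j)) (pt y) ≡ pt (x ⊞ swing e (β j) (y ⊟ x))
  step-off x e j {y} d≢0 with onLine? x e (pt y)
  ... | inj₁ on             = ⊥-elim (on⇒¬off on (y , refl , d≢0))
  ... | inj₂ (_ , refl , _) = refl

  step-onLine : ∀ x e c {P} → OnLine x e P → OnLine x e (step x (lift e c) P)
  step-onLine x e c p = subst (OnLine x e) (sym (step-on x e c p)) (onto-onLine x e _)

  crd-step : ∀ x e c {P} → OnLine x e P → crd e (step x (lift e c) P) ≡ K.next (coord e x) c (crd e P)
  crd-step x e c p = trans (cong (crd e) (step-on x e c p)) (crd-onto x e _)

  swing-off : ∀ {x : V} {e y} j → d (y ⊟ x) (vec e) ≢ 0# → d ((x ⊞ swing e (β j) (y ⊟ x)) ⊟ x) (vec e) ≢ 0#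
  swing-off {x} {e} {y} j d≢0 = subst (λ u → d u (vec e) ≢ 0#) (sym (⊞⊟-cancel x _)) (d-swing-vec≢0 e (β j) (y ⊟ x) d≢0)

  step³-on : ∀ x e c {P} → OnLine x e P → step x (lift e c) (step x (lift e c) (step x (lift e c) P)) ≡ P
  step³-on x e c {P} p = crd-injective {x} {e} (on (on (on p))) p (begin
    crd e (next (next (next P)))                                                       ≡⟨ crd-step x e c (on (on p)) ⟩
    K.next a c (crd e (next (next P)))                                                 ≡⟨ cong (K.next a c) (crd-step x e c (on p)) ⟩
    K.next a c (K.next a c (crd e (next P)))                                           ≡⟨ cong (λ z → K.next a c (K.next a c z)) (crd-step x e c p) ⟩
    K.next a c (K.next a c (K.next a c (crd e P)))                                     ≡⟨ K.next³ a c (crd e P) ⟩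
    crd e P                                                                            ∎)
    where
    a = coord e x
    next = step x (lift e c)
    on : ∀ {P} → OnLine x e P → OnLine x e (next P)
    on = step-onLine x e c

  step³ : ∀ x c P → step x c (step x c (step x c P)) ≡ P
  step³ x nothing P = let e , p = line-through x P in step³-on x e nothing p
  step³ x (just (e , j)) P with onLine? x e P
  ... | inj₁ p = trans (cong (λ Q → next (next Q)) (sym (step-on x e (just j) p))) (step³-on x e (just j) p)
    where next = step x (just (e , j))
  ... | inj₂ (y , refl , d≢0) = begin
    next (next (pt (x ⊞ φ v)))                        ≡⟨ cong next (step-off x e j {x ⊞ φ v} off₁) ⟩
    next (pt (x ⊞ φ ((x ⊞ φ v) ⊟ x)))                 ≡⟨ step-off x e j (swing-off {x} {e} {x ⊞ φ v} j off₁) ⟩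
    pt (x ⊞ φ ((x ⊞ φ ((x ⊞ φ v) ⊟ x)) ⊟ x))          ≡⟨ cong (λ u → pt (x ⊞ φ u)) (⊞⊟-cancel x _) ⟩
    pt (x ⊞ φ (φ ((x ⊞ φ v) ⊟ x)))                    ≡⟨ cong (λ u → pt (x ⊞ φ (φ u))) (⊞⊟-cancel x _) ⟩
    pt (x ⊞ φ (φ (φ v)))                              ≡⟨ cong (λ u → pt (x ⊞ u)) (swing³ e (β j) v d≢0) ⟩
    pt (x ⊞ v)                                        ≡⟨ cong pt (⊞-⊟-cancel x y) ⟩
    pt y                                              ∎
    where
    next = step x (just (e , j))
    φ = swing e (β j)
    v = y ⊟ x
    off₁ = swing-off {x} {e} {y} j d≢0

  StepAdjacent : V → Class → Point V → Point V → Set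
  StepAdjacent x c P Q = step x c P ≡ Q ⊎ step x c Q ≡ P

  adjacent-from-line : ∀ x e c {P Q} → OnLine x e P → OnLine x e Q →
    K.Adjacent (coord e x) c (crd e P) (crd e Q) → StepAdjacent x (lift e c) P Q
  adjacent-from-line x e c p q (inj₁ eq) = inj₁ (trans (step-on x e c p) (trans (cong (onto x e) eq) q))
  adjacent-from-line x e c p q (inj₂ eq) = inj₂ (trans (step-on x e c q) (trans (cong (onto x e) eq) p))

  adjacent-to-line : ∀ x e c {P Q} → OnLine x e P → OnLine x e Q →
    StepAdjacent x (lift e c) P Q → K.Adjacent (coord e x) c (crd e P) (crd e Q)
  adjacent-to-line x e c p q (inj₁ refl) = inj₁ (sym (crd-step x e c p))
  adjacent-to-line x e c p q (inj₂ refl) = inj₂ (sym (crd-step x e c q))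

  FrameAdjacentPoints : V → D → Fin s → Point V → Point V → Set
  FrameAdjacentPoints x e j P Q = ∃[ y ] ∃[ z ] (P ≡ pt y × Q ≡ pt z × FrameAdjacent e j (y ⊟ x) (z ⊟ x))

  step-cases : ∀ x e j {P Q} → StepAdjacent x (just (e , j)) P Q →
    (OnLine x e P × OnLine x e Q) ⊎ FrameAdjacentPoints x e j P Q
  step-cases x e j {P} {Q} (inj₁ refl) with onLine? x e P
  ... | inj₁ p = inj₁ (p , onto-onLine x e _)
  ... | inj₂ (y , refl , d≢0) = inj₂ (y , _ , refl , refl , inj₁ (d≢0 , sym (⊞⊟-cancel x _)))
  step-cases x e j {P} {Q} (inj₂ refl) with onLine? x e Q
  ... | inj₁ q = inj₁ (onto-onLine x e _ , q)
  ... | inj₂ (z , refl , d≢0) = inj₂ (_ , z , refl , refl , inj₂ (d≢0 , sym (⊞⊟-cancel x _)))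

  frame-not-collinear : ∀ x e e′ j {P Q} → OnLine x e P → OnLine x e Q → ¬ FrameAdjacentPoints x e′ j P Q
  frame-not-collinear x e e′ j p q (y , z , refl , refl , adj) = frame-adjacent-d adj (onLine-d {x} {e} {y} {z} p q)

  -- The points of the block {∞₁, ∞₂, a}, which all lines through the centre `a` have in common.
  data Core (A : Set) (a : A) : Point A → Set where
    is-∞₁     : Core A a ∞₁
    is-∞₂     : Core A a ∞₂
    is-centre : Core A a (pt a)

  crd-core : ∀ {x P} e → Core V x P → Core F (coord e x) (crd e P)
  crd-core e is-∞₁     = is-∞₁
  crd-core e is-∞₂     = is-∞₂
  crd-core e is-centre = is-centre

  core-adjacent : ∀ {a P Q} → Core F a P → Core F a Q → P ≢ Q → K.Adjacent a nothing P Q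
  core-adjacent {a} is-∞₁     is-∞₂     _ = inj₁ (base₁ a)
  core-adjacent {a} is-∞₂     is-centre _ = inj₁ (base₂ a)
  core-adjacent {a} is-centre is-∞₁     _ = inj₁ (base₃ a)
  core-adjacent {a} is-∞₂     is-∞₁     _ = inj₂ (base₁ a)
  core-adjacent {a} is-centre is-∞₂     _ = inj₂ (base₂ a)
  core-adjacent {a} is-∞₁     is-centre _ = inj₂ (base₃ a)
  core-adjacent is-∞₁     is-∞₁     P≢P = ⊥-elim (P≢P refl)
  core-adjacent is-∞₂     is-∞₂     P≢P = ⊥-elim (P≢P refl)
  core-adjacent is-centre is-centre P≢P = ⊥-elim (P≢P refl)

  two-lines : ∀ x e e′ {P} → OnLine x e P → OnLine x e′ P → e ≡ e′ ⊎ Core V x P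
  two-lines x e e′ {∞₁} _ _ = inj₂ is-∞₁
  two-lines x e e′ {∞₂} _ _ = inj₂ is-∞₂
  two-lines x e e′ {pt y} p p′ with zero? (coord e y - coord e x)
  ... | inj₂ c≢0 = inj₁ (direction-unique e e′ c≢0 (trans (sym (onLine⇒multiple {x} {e} {y} p)) (onLine⇒multiple {x} {e′} {y} p′)))
  ... | inj₁ c≡0 = inj₂ (subst (λ z → Core V x (pt z)) (sym (⊟≡𝟎⇒≡ y x
          (trans (onLine⇒multiple {x} {e} {y} p) (trans (cong (_· vec e) c≡0) (0· (vec e)))))) is-centre)

  -- Non-collinear blocks are excluded, as `d` vanishes on pairs from one line through x. A class of
  -- another line e′ could join `P` and `Q` only if both lay on e′ too, hence in {∞₁, ∞₂, x}. But
  -- this block is in class `nothing` of the given system on e′, which by uniqueness rules out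
  -- `just j`.
  adjacent-on-line : ∀ x e c {P Q} → OnLine x e P → OnLine x e Q → StepAdjacent x c P Q →
    ∃[ c₀ ] (c ≡ lift e c₀ × K.Adjacent (coord e x) c₀ (crd e P) (crd e Q))
  adjacent-on-line x e nothing p q adj = nothing , refl , adjacent-to-line x e nothing p q adj
  adjacent-on-line x e (just (e′ , j)) {P} {Q} p q adj with step-cases x e′ j adj
  ... | inj₂ frame = ⊥-elim (frame-not-collinear x e e′ j p q frame)
  ... | inj₁ (p′ , q′) with two-lines x e e′ p p′ | two-lines x e e′ q q′
  ...   | inj₁ refl | _         = just j , refl , adjacent-to-line x e (just j) p q adj
  ...   | inj₂ _    | inj₁ refl = just j , refl , adjacent-to-line x e (just j) p q adj
  ...   | inj₂ P-core | inj₂ Q-core = ⊥-elim (nothing≢just (K.unique (coord e′ x)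
            (core-adjacent (crd-core e′ P-core) (crd-core e′ Q-core) (K.adjacent-irrefl (coord e′ x) adj′)) adj′))
    where
    adj′ = adjacent-to-line x e′ (just j) p′ q′ adj
    nothing≢just : ∀ {j : Fin s} → nothing ≢ just j
    nothing≢just ()

  nothing-collinear : ∀ x {P Q} → StepAdjacent x nothing P Q → ∃[ e ] (OnLine x e P × OnLine x e Q)
  nothing-collinear x {P} (inj₁ refl) = let e , p = line-through x P in e , p , step-onLine x e nothing p
  nothing-collinear x {_} {Q} (inj₂ refl) = let e , q = line-through x Q in e , step-onLine x e nothing q , q

  independent-adjacent : ∀ x c {P Q} → Independent x P Q → StepAdjacent x c P Q →
    ∃[ e ] ∃[ j ] (c ≡ just (e , j) × FrameAdjacentPoints x e j P Q)
  independent-adjacent x nothing (y , z , refl , refl , d≢0) adj =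
    let e , p , q = nothing-collinear x adj in ⊥-elim (d≢0 (onLine-d {x} {e} {y} {z} p q))
  independent-adjacent x (just (e , j)) (y , z , refl , refl , d≢0) adj with step-cases x e j adj
  ... | inj₁ (p , q) = ⊥-elim (d≢0 (onLine-d {x} {e} {y} {z} p q))
  ... | inj₂ frame = e , j , refl , frame

  step-unique : ∀ x {P Q c c′} → StepAdjacent x c P Q → StepAdjacent x c′ P Q → c ≡ c′
  step-unique x {P} {Q} {c} {c′} adj adj′ with common-line? x P Q
  ... | inj₁ (e , p , q) with adjacent-on-line x e c p q adj | adjacent-on-line x e c′ p q adj′
  ...   | c₀ , refl , a₀ | c₀′ , refl , a₀′ = cong (lift e) (K.unique (coord e x) a₀ a₀′)
  step-unique x {P} {Q} {c} {c′} adj adj′ | inj₂ ind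
    with independent-adjacent x c ind adj | independent-adjacent x c′ ind adj′
  ...   | e , j , refl , _ , _ , refl , refl , f | e′ , j′ , refl , _ , _ , refl , refl , f′ =
    cong just (frame-adjacent-unique f f′)

  step-covers : ∀ x {P Q} → P ≢ Q → ∃[ c ] StepAdjacent x c P Q
  step-covers x {P} {Q} P≢Q with common-line? x P Q
  ... | inj₁ (e , p , q) =
    let c , adj = K.covers (coord e x) (λ eq → P≢Q (crd-injective {x} {e} p q eq))
    in lift e c , adjacent-from-line x e c p q adj
  ... | inj₂ (y , z , refl , refl , d≢0) with frame-adjacent-exists (y ⊟ x) (z ⊟ x) d≢0
  ...   | e , j , inj₁ (d≢0 , eq) = just (e , j) , inj₁ (trans (step-off x e j d≢0)
            (cong pt (trans (cong (x ⊞_) eq) (⊞-⊟-cancel x z))))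
  ...   | e , j , inj₂ (d≢0 , eq) = just (e , j) , inj₂ (trans (step-off x e j d≢0)
            (cong pt (trans (cong (x ⊞_) eq) (⊞-⊟-cancel x y))))

  -- As d(v, v) = 0, the pair `P`, `P` lies on a line through x, where a fixed point would be
  -- adjacent to itself in the given system.
  step≢ : ∀ x c P → step x c P ≢ P
  step≢ x c P eq with common-line? x P P
  ... | inj₂ (y , z , refl , refl , d≢0) = d≢0 (d-self (y ⊟ x))
  ... | inj₁ (e , p , _) = let c₀ , _ , adj = adjacent-on-line x e c p p (inj₁ eq) in
    K.adjacent-irrefl (coord e x) adj refl

  system : V → Kirkman (Point V) Class
  system x = record
    { next = step x ; next³ = step³ x ; next≢ = step≢ x ; covers = step-covers x ; unique = step-unique x }

  -- Disjointness of the new systems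

  ⊟-translate : ∀ {n} (y z x : Vec F n) → (y ⊟ x) ⊟ (z ⊟ x) ≡ y ⊟ z
  ⊟-translate [] [] [] = refl
  ⊟-translate (a ∷ y) (b ∷ z) (c ∷ x) = cong₂ _∷_
    (solve 3 (λ a b c → (a :- c) :- (b :- c) := a :- b) refl a b c) (⊟-translate y z x)

  ·-⊟-distrib : ∀ {n} a b (u : Vec F n) → a · u ⊟ b · u ≡ (a - b) · u
  ·-⊟-distrib a b [] = refl
  ·-⊟-distrib a b (c ∷ u) = cong₂ _∷_ (solve 3 (λ a b c → a :* c :- b :* c := (a :- b) :* c) refl a b c) (·-⊟-distrib a b u)

  onLine-difference : ∀ {x e y z} → OnLine x e (pt y) → OnLine x e (pt z) → ∃[ c ] y ⊟ z ≡ c · vec e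
  onLine-difference {x} {e} {y} {z} p r = _ , trans (sym (⊟-translate y z x))
    (trans (cong₂ _⊟_ (onLine⇒multiple {x} {e} {y} p) (onLine⇒multiple {x} {e} {z} r)) (·-⊟-distrib _ _ (vec e)))

  record LineBlock (x : V) (P Q S : Point V) : Set where
    constructor lineBlock
    field
      e     : D
      onP   : OnLine x e P
      onQ   : OnLine x e Q
      onS   : OnLine x e S
      block : K.Block (coord e x) (crd e P) (crd e Q) (crd e S)

  -- `noncollinear` is stated without the centre `x`, so that it can be confronted with a line block
  -- on the same points in a system with another centre.
  record FrameBlock (x : V) (P Q S : Point V) : Set where
    constructor frameBlock
    field
      y z w        : V
      P≡           : P ≡ pt y
      Q≡           : Q ≡ pt z
      S≡           : S ≡ pt w
      zero-sum     : (y ⊟ x) ⊞ (z ⊟ x) ⊞ (w ⊟ x) ≡ 𝟎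
      noncollinear : d (y ⊟ z) (w ⊟ z) ≢ 0#

  module System x = Kirkman (system x)

  line-cycle : ∀ x e c {P Q S} → OnLine x e P → System.Cycle x (lift e c) P Q S → LineBlock x P Q S
  line-cycle x e c {P} on-P (refl , refl) = lineBlock e on-P on-Q (step-onLine x e c on-Q)
    (c , inj₁ (sym (crd-step x e c on-P) , sym (crd-step x e c on-Q)))
    where on-Q = step-onLine x e c on-P

  frame-cycle : ∀ x e j {P Q S} → OffLine x e P → System.Cycle x (just (e , j)) P Q S → FrameBlock x P Q S
  frame-cycle x e j (y , refl , d≢0) (refl , refl) = frameBlock y z w refl
    (step-off x e j d≢0) (trans (cong (step x (just (e , j))) (step-off x e j d≢0)) (step-off x e j d≢0′)) sum≡𝟎
    (subst₂ (λ a b → d a b ≢ 0#) (⊟-translate y z x) (⊟-translate w z x)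
      (zero-sum-noncollinear (y ⊟ x) (z ⊟ x) (w ⊟ x) sum≡𝟎 d-vu≢0))
    where
    φ = swing e (β j)
    z w : V
    z = x ⊞ φ (y ⊟ x)
    w = x ⊞ φ (z ⊟ x)
    d≢0′ : d (z ⊟ x) (vec e) ≢ 0#
    d≢0′ = swing-off {x} {e} {y} j d≢0
    z⊟x≡ : z ⊟ x ≡ φ (y ⊟ x)
    z⊟x≡ = ⊞⊟-cancel x _
    sum≡𝟎 : (y ⊟ x) ⊞ (z ⊟ x) ⊞ (w ⊟ x) ≡ 𝟎
    sum≡𝟎 = trans (cong₂ (λ a b → (y ⊟ x) ⊞ a ⊞ b) z⊟x≡ (trans (⊞⊟-cancel x _) (cong φ z⊟x≡)))
      (swing-sum e (β j) (y ⊟ x) d≢0)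
    d-vu≢0 : d (y ⊟ x) (z ⊟ x) ≢ 0#
    d-vu≢0 = frame-adjacent-d (inj₁ (d≢0 , sym z⊟x≡))

  cycle-cases : ∀ x c {P Q S} → System.Cycle x c P Q S → LineBlock x P Q S ⊎ FrameBlock x P Q S
  cycle-cases x nothing {P} cycle = let e , p = line-through x P in inj₁ (line-cycle x e nothing p cycle)
  cycle-cases x (just (e , j)) {P} cycle =
    [ (λ p → inj₁ (line-cycle x e (just j) p cycle)) , (λ off → inj₂ (frame-cycle x e j off cycle)) ]′ (onLine? x e P)

  line-reverse : ∀ {x P Q S} → LineBlock x P Q S → LineBlock x S Q P
  line-reverse {x} (lineBlock e p q s b) = lineBlock e s q p (K.block-reverse (coord e x) b)

  line-rotate : ∀ {x P Q S} → LineBlock x P Q S → LineBlock x Q S P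
  line-rotate {x} (lineBlock e p q s b) = lineBlock e q s p (K.block-rotate (coord e x) b)

  frame-reverse : ∀ {x P Q S} → FrameBlock x P Q S → FrameBlock x S Q P
  frame-reverse {x} (frameBlock y z w P≡ Q≡ S≡ sum≡𝟎 d≢0) = frameBlock w z y S≡ Q≡ P≡
    (trans (rev (w ⊟ x) (z ⊟ x) (y ⊟ x)) sum≡𝟎)
    λ d≡0 → d≢0 (trans (d-antisym (y ⊟ z) (w ⊟ z)) (trans (cong -_ d≡0) -0#≈0#))
    where
    rev : ∀ {n} (a b c : Vec F n) → a ⊞ b ⊞ c ≡ c ⊞ b ⊞ a
    rev [] [] [] = refl
    rev (x ∷ a) (y ∷ b) (z ∷ c) = cong₂ _∷_ (solve 3 (λ x y z → x :+ y :+ z := z :+ y :+ x) refl x y z) (rev a b c)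

  block-cases : ∀ x {P Q S} → System.Block x P Q S → LineBlock x P Q S ⊎ FrameBlock x P Q S
  block-cases x (c , inj₁ cycle) = cycle-cases x c cycle
  block-cases x (c , inj₂ cycle) with cycle-cases x c cycle
  ... | inj₁ line  = inj₁ (line-reverse line)
  ... | inj₂ frame = inj₂ (frame-reverse frame)

  line-frame : ∀ {x x′ P Q S} → LineBlock x P Q S → ¬ FrameBlock x′ P Q S
  line-frame {x} (lineBlock e p q s _) (frameBlock y z w refl refl refl _ d≢0)
    with onLine-difference {x} {e} {y} {z} p q | onLine-difference {x} {e} {w} {z} s q
  ... | a , y⊟z≡ | b , w⊟z≡ = d≢0 (trans (cong₂ d y⊟z≡ w⊟z≡) (d-parallel a b (vec e)))

  onto-same : ∀ {x x′ e y} → OnLine x e (pt y) → OnLine x′ e (pt y) → coord e x ≡ coord e x′ → x ≡ x′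
  onto-same {x} {x′} {e} {y} p p′ eq = ⊞-cancelʳ ((coord e y - coord e x) · vec e)
    (trans (pt-injective p) (trans (sym (pt-injective p′)) (cong (λ c → x′ ⊞ (coord e y - c) · vec e) (sym eq))))

  -- The difference of the affine points fixes the direction. Disjointness of the given systems then
  -- fixes the coordinate of the centre, and both centres lie on the line through `y` in this
  -- direction.
  two-affine : ∀ {x x′ y z S} → LineBlock x (pt y) (pt z) S → LineBlock x′ (pt y) (pt z) S → x ≡ x′
  two-affine {x} {x′} {y} {z} (lineBlock e p q s b) (lineBlock e′ p′ q′ s′ b′)
    with onLine-difference {x} {e} {y} {z} p q | onLine-difference {x′} {e′} {y} {z} p′ q′
  ... | c , y⊟z≡ | c′ , y⊟z≡′ with direction-unique e e′ c≢0 (trans (sym y⊟z≡) y⊟z≡′)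
    where
    y≢z : y ≢ z
    y≢z refl = K.block-distinct (coord e x) b refl
    c≢0 : c ≢ 0#
    c≢0 refl = y≢z (⊟≡𝟎⇒≡ y z (trans y⊟z≡ (0· (vec e))))
  ... | refl = onto-same {x} {x′} {e} {y} p p′ (K-disjoint b b′)

  -- By uniqueness the pair ∞₁, ∞₂ is joined in class `nothing` only, where its third point is
  -- `pt a`.
  base-block : ∀ {a t} → K.Block a ∞₁ ∞₂ (pt t) → t ≡ a
  base-block {a} (c , inj₁ (eq₁ , eq₂)) with K.unique a (inj₁ eq₁) (inj₁ (base₁ a))
  ... | refl = pt-injective (trans (sym eq₂) (base₂ a))
  base-block {a} (c , inj₂ (eq₁ , eq₂)) with K.unique a (inj₂ eq₂) (inj₁ (base₁ a))
  ... | refl with trans (sym eq₂) (base₂ a)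
  ...   | ()

  base-block′ : ∀ {a t} → K.Block a ∞₂ ∞₁ (pt t) → t ≡ a
  base-block′ {a} (c , inj₁ (eq₁ , eq₂)) with K.unique a (inj₂ eq₁) (inj₁ (base₁ a))
  ... | refl with trans (sym eq₁) (base₂ a)
  ...   | ()
  base-block′ {a} (c , inj₂ (eq₁ , eq₂)) with K.unique a (inj₁ eq₂) (inj₁ (base₁ a))
  ... | refl = pt-injective (K.next-injective a (trans eq₁ (sym (base₃ a))))

  at-centre : ∀ {x e y} → OnLine x e (pt y) → coord e y ≡ coord e x → y ≡ x
  at-centre {x} {e} {y} p eq = pt-injective (crd-injective {x} {e} p (centre-onLine x e) (cong pt eq))

  one-affine : ∀ {x y} → LineBlock x ∞₁ ∞₂ (pt y) → y ≡ x
  one-affine {x} {y} (lineBlock e _ _ s b) = at-centre {x} {e} {y} s (base-block b)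

  one-affine′ : ∀ {x y} → LineBlock x ∞₂ ∞₁ (pt y) → y ≡ x
  one-affine′ {x} {y} (lineBlock e _ _ s b) = at-centre {x} {e} {y} s (base-block′ b)

  not-equal : ∀ {x P S} → ¬ LineBlock x P P S
  not-equal {x} (lineBlock e _ _ _ b) = K.block-distinct (coord e x) b refl

  -- If there is a second affine point, a rotation brings two affine points to the front. Otherwise
  -- the block is {∞₁, ∞₂, y}, and `y` is the centre itself.
  last-affine : ∀ {x x′} P Q {y} → LineBlock x P Q (pt y) → LineBlock x′ P Q (pt y) → x ≡ x′
  last-affine (pt _) (pt _) b b′ = two-affine b b′
  last-affine (pt _) ∞₁ b b′ = two-affine (line-rotate (line-rotate b)) (line-rotate (line-rotate b′))
  last-affine (pt _) ∞₂ b b′ = two-affine (line-rotate (line-rotate b)) (line-rotate (line-rotate b′))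
  last-affine ∞₁ (pt _) b b′ = two-affine (line-rotate b) (line-rotate b′)
  last-affine ∞₂ (pt _) b b′ = two-affine (line-rotate b) (line-rotate b′)
  last-affine ∞₁ ∞₁ b b′ = ⊥-elim (not-equal b)
  last-affine ∞₂ ∞₂ b b′ = ⊥-elim (not-equal b)
  last-affine ∞₁ ∞₂ b b′ = trans (sym (one-affine b)) (one-affine b′)
  last-affine ∞₂ ∞₁ b b′ = trans (sym (one-affine′ b)) (one-affine′ b′)

  -- Three distinct points cannot all be among ∞₁ and ∞₂.
  no-affine : ∀ {A : Set} {x P Q S} → (∀ y → P ≢ pt y) → (∀ y → Q ≢ pt y) → (∀ y → S ≢ pt y) → LineBlock x P Q S → A
  no-affine {P = pt y} P≢ _ _ _ = ⊥-elim (P≢ y refl)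
  no-affine {Q = pt y} _ Q≢ _ _ = ⊥-elim (Q≢ y refl)
  no-affine {S = pt y} _ _ S≢ _ = ⊥-elim (S≢ y refl)
  no-affine {P = ∞₁} {∞₁} _ _ _ b = ⊥-elim (not-equal b)
  no-affine {P = ∞₂} {∞₂} _ _ _ b = ⊥-elim (not-equal b)
  no-affine {P = ∞₁} {∞₂} {∞₁} _ _ _ b = ⊥-elim (not-equal (line-rotate (line-rotate b)))
  no-affine {P = ∞₁} {∞₂} {∞₂} _ _ _ b = ⊥-elim (not-equal (line-rotate b))
  no-affine {P = ∞₂} {∞₁} {∞₁} _ _ _ b = ⊥-elim (not-equal (line-rotate b))
  no-affine {P = ∞₂} {∞₁} {∞₂} _ _ _ b = ⊥-elim (not-equal (line-rotate (line-rotate b)))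

  affine? : ∀ (P : Point V) → (∃[ y ] P ≡ pt y) ⊎ (∀ y → P ≢ pt y)
  affine? ∞₁     = inj₂ λ _ ()
  affine? ∞₂     = inj₂ λ _ ()
  affine? (pt y) = inj₁ (y , refl)

  line-line : ∀ {x x′} P Q S → LineBlock x P Q S → LineBlock x′ P Q S → x ≡ x′
  line-line P Q S b b′ with affine? P | affine? Q | affine? S
  ... | inj₁ (_ , refl) | _ | _ = last-affine Q S (line-rotate b) (line-rotate b′)
  ... | inj₂ _ | inj₁ (_ , refl) | _ = last-affine S P (line-rotate (line-rotate b)) (line-rotate (line-rotate b′))
  ... | inj₂ _ | inj₂ _ | inj₁ (_ , refl) = last-affine P Q b b′
  ... | inj₂ P≢ | inj₂ Q≢ | inj₂ S≢ = no-affine P≢ Q≢ S≢ b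

  system-disjoint : PairwiseDisjoint system
  system-disjoint {x} {x′} {P} {Q} {S} b b′ with block-cases x b | block-cases x′ b′
  ... | inj₁ line  | inj₁ line′  = line-line P Q S line line′
  ... | inj₁ line  | inj₂ frame′ = ⊥-elim (line-frame line frame′)
  ... | inj₂ frame | inj₁ line′  = ⊥-elim (line-frame line′ frame)
  ... | inj₂ (frameBlock y z w refl refl refl sum≡𝟎 _) | inj₂ (frameBlock _ _ _ refl refl refl sum≡𝟎′ _) =
    centroid-unique y z w x x′ sum≡𝟎 sum≡𝟎′

-- Lists of triples and resolutions

open import Defs

module _ {v : ℕ} where

  private
    a≢b : (t : Triple v) → a t ≢ b t
    a≢b t eq = ℕ.<⇒≢ (a<b t) (cong toℕ eq)

    b≢c : (t : Triple v) → b t ≢ c t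
    b≢c t eq = ℕ.<⇒≢ (b<c t) (cong toℕ eq)

    a≢c : (t : Triple v) → a t ≢ c t
    a≢c t eq = ℕ.<⇒≢ (ℕ.<-trans (a<b t) (b<c t)) (cong toℕ eq)

  -- The cyclic order that makes a block an orbit; points outside `t` go to `a t` by default.
  succ : Triple v → Fin v → Fin v
  succ t x with x Fin.≟ a t | x Fin.≟ b t
  ... | yes _ | _     = b t
  ... | no _  | yes _ = c t
  ... | no _  | no _  = a t

  succ-a : ∀ t → succ t (a t) ≡ b t
  succ-a t with a t Fin.≟ a t | a t Fin.≟ b t
  ... | yes _  | _ = refl
  ... | no a≢a | _ = ⊥-elim (a≢a refl)

  succ-b : ∀ t → succ t (b t) ≡ c t
  succ-b t with b t Fin.≟ a t | b t Fin.≟ b t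
  ... | yes b≡a | _      = ⊥-elim (a≢b t (sym b≡a))
  ... | no _    | yes _  = refl
  ... | no _    | no b≢b = ⊥-elim (b≢b refl)

  succ-c : ∀ t → succ t (c t) ≡ a t
  succ-c t with c t Fin.≟ a t | c t Fin.≟ b t
  ... | yes c≡a | _       = ⊥-elim (a≢c t (sym c≡a))
  ... | no _    | yes c≡b = ⊥-elim (b≢c t (sym c≡b))
  ... | no _    | no _    = refl

  succ-∈ : ∀ t {x} → x ∈ᵇ t → succ t x ∈ᵇ t
  succ-∈ t (inj₁ refl)        = inj₂ (inj₁ (succ-a t))
  succ-∈ t (inj₂ (inj₁ refl)) = inj₂ (inj₂ (succ-b t))
  succ-∈ t (inj₂ (inj₂ refl)) = inj₁ (succ-c t)

  succ³ : ∀ t {x} → x ∈ᵇ t → succ t (succ t (succ t x)) ≡ x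
  succ³ t (inj₁ refl)        rewrite succ-a t | succ-b t | succ-c t = refl
  succ³ t (inj₂ (inj₁ refl)) rewrite succ-b t | succ-c t | succ-a t = refl
  succ³ t (inj₂ (inj₂ refl)) rewrite succ-c t | succ-a t | succ-b t = refl

  succ≢ : ∀ t {x} → x ∈ᵇ t → succ t x ≢ x
  succ≢ t (inj₁ refl)        eq = a≢b t (trans (sym eq) (succ-a t))
  succ≢ t (inj₂ (inj₁ refl)) eq = b≢c t (trans (sym eq) (succ-b t))
  succ≢ t (inj₂ (inj₂ refl)) eq = a≢c t (trans (sym (succ-c t)) eq)

  orbit : ∀ t {x w} → x ∈ᵇ t → w ∈ᵇ t → w ≡ x ⊎ (w ≡ succ t x ⊎ w ≡ succ t (succ t x))
  orbit t (inj₁ refl)        (inj₁ refl)        = inj₁ refl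
  orbit t (inj₁ refl)        (inj₂ (inj₁ refl)) = inj₂ (inj₁ (sym (succ-a t)))
  orbit t (inj₁ refl)        (inj₂ (inj₂ refl)) = inj₂ (inj₂ (sym (trans (cong (succ t) (succ-a t)) (succ-b t))))
  orbit t (inj₂ (inj₁ refl)) (inj₁ refl)        = inj₂ (inj₂ (sym (trans (cong (succ t) (succ-b t)) (succ-c t))))
  orbit t (inj₂ (inj₁ refl)) (inj₂ (inj₁ refl)) = inj₁ refl
  orbit t (inj₂ (inj₁ refl)) (inj₂ (inj₂ refl)) = inj₂ (inj₁ (sym (succ-b t)))
  orbit t (inj₂ (inj₂ refl)) (inj₁ refl)        = inj₂ (inj₁ (sym (succ-c t)))
  orbit t (inj₂ (inj₂ refl)) (inj₂ (inj₁ refl)) = inj₂ (inj₂ (sym (trans (cong (succ t) (succ-c t)) (succ-a t))))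
  orbit t (inj₂ (inj₂ refl)) (inj₂ (inj₂ refl)) = inj₁ refl

  triple-≡ : ∀ {t u : Triple v} → a t ≡ a u → b t ≡ b u → c t ≡ c u → t ≡ u
  triple-≡ {triple _ _ _ p q} {triple _ _ _ p′ q′} refl refl refl =
    cong₂ (triple _ _ _) (ℕ.<-irrelevant p p′) (ℕ.<-irrelevant q q′)

  -- The three distinct entries of `t` exhaust those of `u`, and since both triples are increasing,
  -- the entries agree position by position.
  triple-ext : ∀ {t u : Triple v} → (∀ {w} → w ∈ᵇ t → w ∈ᵇ u) → t ≡ u
  triple-ext {t} {u} t⊆u with t⊆u {a t} (inj₁ refl) | t⊆u {b t} (inj₂ (inj₁ refl)) | t⊆u {c t} (inj₂ (inj₂ refl))
  ... | inj₁ p | inj₂ (inj₁ q) | inj₂ (inj₂ r) = triple-≡ p q r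
  ... | _ | inj₁ q | inj₁ r = ⊥-elim (b≢c t (trans q (sym r)))
  ... | _ | inj₂ (inj₁ q) | inj₂ (inj₁ r) = ⊥-elim (b≢c t (trans q (sym r)))
  ... | inj₁ p | inj₁ q | _ = ⊥-elim (a≢b t (trans p (sym q)))
  ... | inj₁ p | _ | inj₁ r = ⊥-elim (a≢c t (trans p (sym r)))
  ... | inj₂ (inj₁ p) | inj₂ (inj₁ q) | _ = ⊥-elim (a≢b t (trans p (sym q)))
  ... | inj₂ (inj₁ p) | inj₁ q | _ = ⊥-elim (ℕ.<-asym (a<b t) (subst₂ (λ x y → toℕ x < toℕ y) (sym q) (sym p) (a<b u)))
  ... | inj₂ (inj₁ p) | _ | inj₁ r = ⊥-elim (ℕ.<-asym (ℕ.<-trans (a<b t) (b<c t)) (subst₂ (λ x y → toℕ x < toℕ y) (sym r) (sym p) (a<b u)))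
  ... | inj₂ (inj₂ p) | inj₁ q | _ = ⊥-elim (ℕ.<-asym (a<b t) (subst₂ (λ x y → toℕ x < toℕ y) (sym q) (sym p) (ℕ.<-trans (a<b u) (b<c u))))
  ... | inj₂ (inj₂ p) | inj₂ (inj₁ q) | _ = ⊥-elim (ℕ.<-asym (a<b t) (subst₂ (λ x y → toℕ x < toℕ y) (sym q) (sym p) (b<c u)))
  ... | inj₂ (inj₂ p) | inj₂ (inj₂ q) | _ = ⊥-elim (a≢b t (trans p (sym q)))
  ... | _ | inj₂ (inj₂ q) | inj₂ (inj₁ r) = ⊥-elim (ℕ.<-asym (b<c t) (subst₂ (λ x y → toℕ x < toℕ y) (sym r) (sym q) (b<c u)))
  ... | _ | inj₂ (inj₂ q) | inj₂ (inj₂ r) = ⊥-elim (b≢c t (trans q (sym r)))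

  orbit-⊆ : ∀ {t u : Triple v} {x} → x ∈ᵇ t → x ∈ᵇ u → succ t x ∈ᵇ u → succ t (succ t x) ∈ᵇ u → t ≡ u
  orbit-⊆ {t} {u} {x} x∈t x∈u y∈u z∈u = triple-ext λ w∈t → included (orbit t x∈t w∈t)
    where
    included : ∀ {w} → w ≡ x ⊎ (w ≡ succ t x ⊎ w ≡ succ t (succ t x)) → w ∈ᵇ u
    included (inj₁ refl)        = x∈u
    included (inj₂ (inj₁ refl)) = y∈u
    included (inj₂ (inj₂ refl)) = z∈u

Unique-++-disjoint : ∀ {A : Set} (xs : List A) {ys x} → Unique (xs ++ ys) → x ∈ xs → ¬ (x ∈ ys)
Unique-++-disjoint (x ∷ xs) (x∉ AllPairs.∷ _) (Any.here refl) x∈ys = All.lookup x∉ (∈-++⁺ʳ xs x∈ys) refl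
Unique-++-disjoint (x ∷ xs) (_ AllPairs.∷ uniq) (Any.there x∈xs) x∈ys = Unique-++-disjoint xs uniq x∈xs x∈ys

Unique-++ʳ : ∀ {A : Set} (xs : List A) {ys} → Unique (xs ++ ys) → Unique ys
Unique-++ʳ []       uniq                  = uniq
Unique-++ʳ (x ∷ xs) (_ AllPairs.∷ uniq) = Unique-++ʳ xs uniq

Unique-concat-index : ∀ {A : Set} (xss : List (List A)) {x} → Unique (concat xss) →
  ∀ i j → x ∈ lookup xss i → x ∈ lookup xss j → i ≡ j
Unique-concat-index (xs ∷ xss) uniq Fin.zero    Fin.zero    _   _   = refl
Unique-concat-index (xs ∷ xss) uniq Fin.zero    (Fin.suc j) x∈i x∈j =
  ⊥-elim (Unique-++-disjoint xs uniq x∈i (∈-concat⁺′ x∈j (∈-lookup {xs = xss} j)))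
Unique-concat-index (xs ∷ xss) uniq (Fin.suc i) Fin.zero    x∈i x∈j =
  ⊥-elim (Unique-++-disjoint xs uniq x∈j (∈-concat⁺′ x∈i (∈-lookup {xs = xss} i)))
Unique-concat-index (xs ∷ xss) uniq (Fin.suc i) (Fin.suc j) x∈i x∈j =
  cong Fin.suc (Unique-concat-index xss (Unique-++ʳ xs uniq) i j x∈i x∈j)

module FromKTS {v : ℕ} {B : List (Triple v)} (kts : IsKTS v B) where
  private
    B-unique = proj₁ (proj₁ kts)
    pairs = proj₂ (proj₁ kts)
    R = proj₁ (proj₂ kts)
    classes = proj₁ (proj₂ (proj₂ kts))
    R↭B = proj₂ (proj₂ (proj₂ kts))

  C : Set
  C = Fin (length R)

  private
    parallel : ∀ i → IsParallelClass v (lookup R i)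
    parallel i = All.lookup classes (∈-lookup {xs = R} i)

    R-unique : Unique (concat R)
    R-unique = ↭ₛ.Unique-resp-↭ (≡.setoid (Triple v)) (↭⇒↭ₛ (↭-sym R↭B)) B-unique

    in-B : ∀ i {t} → t ∈ lookup R i → t ∈ B
    in-B i t∈ = ∈-resp-↭ R↭B (∈-concat⁺′ t∈ (∈-lookup {xs = R} i))

  block : C → Fin v → Triple v
  block i x = proj₁ (proj₁ (proj₂ (parallel i) x))

  block-∈ : ∀ i x → block i x ∈ lookup R i
  block-∈ i x = proj₁ (proj₂ (proj₁ (proj₂ (parallel i) x)))

  ∈-block : ∀ i x → x ∈ᵇ block i x
  ∈-block i x = proj₂ (proj₂ (proj₁ (proj₂ (parallel i) x)))

  block-unique : ∀ i {t x} → t ∈ lookup R i → x ∈ᵇ t → block i x ≡ t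
  block-unique i {t} {x} t∈ x∈t = proj₂ (proj₂ (parallel i) x) (block i x) t (block-∈ i x) t∈ (∈-block i x) x∈t

  block-∈-B : ∀ i x → block i x ∈ B
  block-∈-B i x = in-B i (block-∈ i x)

  -- The blocks of a parallel class partition the points, so their cyclic orders combine to one
  -- permutation of order three.
  next : C → Fin v → Fin v
  next i x = succ (block i x) x

  next-in-block : ∀ i {t x} → t ∈ lookup R i → x ∈ᵇ t → next i x ≡ succ t x
  next-in-block i {x = x} t∈ x∈t = cong (λ t → succ t x) (block-unique i t∈ x∈t)

  Adjacent : C → Fin v → Fin v → Set
  Adjacent i x y = next i x ≡ y ⊎ next i y ≡ x

  adjacent-block : ∀ {i x y} → Adjacent i x y → ∃[ t ] (t ∈ lookup R i × x ∈ᵇ t × y ∈ᵇ t)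
  adjacent-block {i} {x} (inj₁ refl) = block i x , block-∈ i x , ∈-block i x , succ-∈ (block i x) (∈-block i x)
  adjacent-block {i} {y = y} (inj₂ refl) = block i y , block-∈ i y , succ-∈ (block i y) (∈-block i y) , ∈-block i y

  block-adjacent : ∀ i {t x y} → t ∈ lookup R i → x ∈ᵇ t → y ∈ᵇ t → x ≢ y → Adjacent i x y
  block-adjacent i {t} {x} {y} t∈ x∈t y∈t x≢y with orbit t x∈t y∈t
  ... | inj₁ y≡x         = ⊥-elim (x≢y (sym y≡x))
  ... | inj₂ (inj₁ y≡sx)  = inj₁ (trans (next-in-block i t∈ x∈t) (sym y≡sx))
  ... | inj₂ (inj₂ y≡ssx) = inj₂ (trans (next-in-block i t∈ y∈t) (trans (cong (succ t) y≡ssx) (succ³ t x∈t)))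

  next³ : ∀ i x → next i (next i (next i x)) ≡ x
  next³ i x = begin
    next i (next i (succ t x))       ≡⟨ cong (next i) (next-in-block i t∈ (succ-∈ t x∈t)) ⟩
    next i (succ t (succ t x))       ≡⟨ next-in-block i t∈ (succ-∈ t (succ-∈ t x∈t)) ⟩
    succ t (succ t (succ t x))       ≡⟨ succ³ t x∈t ⟩
    x                                ∎
    where
    open ≡.≡-Reasoning
    t = block i x
    t∈ = block-∈ i x
    x∈t = ∈-block i x

  covers : ∀ {x y} → x ≢ y → ∃[ i ] Adjacent i x y
  covers {x} {y} x≢y =
    let t , t∈B , x∈t , y∈t = proj₁ (pairs x y x≢y)
        t∈R = ∈-concat⁻ R (∈-resp-↭ (↭-sym R↭B) t∈B)
    in Any.index t∈R , block-adjacent (Any.index t∈R) (lookup-index t∈R) x∈t y∈t x≢y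

  -- The pair lies in one block of `B`, and this block occurs in one class, because `concat R` is a
  -- permutation of `B` and so has no repetitions.
  unique : ∀ {x y i j} → Adjacent i x y → Adjacent j x y → i ≡ j
  unique {x} {y} {i} {j} adj adj′ with adjacent-block adj | adjacent-block adj′
  ... | t , t∈ , x∈t , y∈t | u , u∈ , x∈u , y∈u =
    Unique-concat-index R R-unique i j t∈
      (subst (_∈ lookup R j) (sym (proj₂ (pairs x y (distinct adj)) t u (in-B i t∈) (in-B j u∈) x∈t y∈t x∈u y∈u)) u∈)
    where
    distinct : ∀ {x y} → Adjacent i x y → x ≢ y
    distinct (inj₁ eq) refl = succ≢ (block i _) (∈-block i _) eq
    distinct (inj₂ eq) refl = succ≢ (block i _) (∈-block i _) eq

  kirkman : Kirkman (Fin v) C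
  kirkman = record
    { next = next ; next³ = next³ ; next≢ = λ i x → succ≢ (block i x) (∈-block i x) ; covers = covers ; unique = unique }

  cycle-triple : ∀ i x {y z} → Kirkman.Cycle kirkman i x y z →
    ∃[ t ] (t ∈ B × x ∈ᵇ t × y ≡ succ t x × z ≡ succ t (succ t x))
  cycle-triple i x (refl , refl) = block i x , block-∈-B i x , ∈-block i x , refl ,
    next-in-block i (block-∈ i x) (succ-∈ (block i x) (∈-block i x))

  block-triple : ∀ {x y z} → Kirkman.Block kirkman x y z →
    ∃[ t ] (t ∈ B × (x ∈ᵇ t × y ∈ᵇ t × z ∈ᵇ t) × (∀ {u} → x ∈ᵇ u → y ∈ᵇ u → z ∈ᵇ u → t ≡ u))
  block-triple {x} (i , inj₁ cycle) with cycle-triple i x cycle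
  ... | t , t∈B , x∈t , refl , refl = t , t∈B , (x∈t , succ-∈ t x∈t , succ-∈ t (succ-∈ t x∈t)) , orbit-⊆ x∈t
  block-triple {z = z} (i , inj₂ cycle) with cycle-triple i z cycle
  ... | t , t∈B , z∈t , refl , refl = t , t∈B , (succ-∈ t (succ-∈ t z∈t) , succ-∈ t z∈t , z∈t) ,
    λ x∈u y∈u z∈u → orbit-⊆ z∈t z∈u y∈u x∈u

module _ {v : ℕ} (lkts : LKTS v) where
  private
    S = proj₁ lkts
    module S i = FromKTS (proj₁ (proj₂ lkts) i)

  class-number : Fin (v ∸ 2) → ℕ
  class-number i = length (proj₁ (proj₂ (proj₁ (proj₂ lkts) i)))

  small-systems : ∀ i → Kirkman (Fin v) (Fin (class-number i))
  small-systems i = S.kirkman i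

  small-systems-disjoint : PairwiseDisjoint small-systems
  small-systems-disjoint {i} {j} b b′ with i Fin.≟ j
  ... | yes i≡j = i≡j
  ... | no i≢j with S.block-triple i b | S.block-triple j b′
  ...   | t , t∈Sᵢ , _ , t≡ | u , u∈Sⱼ , (x∈u , y∈u , z∈u) , _ =
    ⊥-elim (proj₂ (proj₂ lkts) i j i≢j u (subst (_∈ S i) (t≡ x∈u y∈u z∈u) t∈Sᵢ) u∈Sⱼ)

-- Relabelling and normalising the given systems

transport-kirkman : ∀ {X Y C D : Set} → X ↔ Y → C ↔ D → Kirkman X C → Kirkman Y D
transport-kirkman {X} {Y} {C} {D} X↔Y C↔D K = record
  { next = next
  ; next³ = λ d y → trans (cong to (trans (cong (K.next (C.from d)) (trans (from-to _) (cong (K.next (C.from d)) (from-to _)))) (K.next³ _ _))) (to-from y)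
  ; next≢ = λ d y eq → K.next≢ (C.from d) (from y) (trans (sym (from-to _)) (cong from eq))
  ; covers = λ y≢y′ → let c , adj = K.covers (λ eq → y≢y′ (from-injective eq)) in
      C.to c , backward (subst (λ c → K.Adjacent c _ _) (sym (C.strictlyInverseʳ c)) adj)
  ; unique = λ adj adj′ → trans (sym (C.strictlyInverseˡ _)) (trans (cong C.to (K.unique (forward adj) (forward adj′))) (C.strictlyInverseˡ _)) }
  where
  module K = Kirkman K
  module C = Inverse C↔D
  open Inverse X↔Y using (to; from) renaming (strictlyInverseˡ to to-from; strictlyInverseʳ to from-to)
  next : D → Y → Y
  next d y = to (K.next (C.from d) (from y))
  from-injective : ∀ {y y′} → from y ≡ from y′ → y ≡ y′
  from-injective eq = trans (sym (to-from _)) (trans (cong to eq) (to-from _))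
  forward : ∀ {d y y′} → next d y ≡ y′ ⊎ next d y′ ≡ y → K.Adjacent (C.from d) (from y) (from y′)
  forward (inj₁ refl) = inj₁ (sym (from-to _))
  forward (inj₂ refl) = inj₂ (sym (from-to _))
  backward : ∀ {d y y′} → K.Adjacent (C.from d) (from y) (from y′) → next d y ≡ y′ ⊎ next d y′ ≡ y
  backward (inj₁ eq) = inj₁ (trans (cong to eq) (to-from _))
  backward (inj₂ eq) = inj₂ (trans (cong to eq) (to-from _))

transport-block : ∀ {X Y C D : Set} (X↔Y : X ↔ Y) (C↔D : C ↔ D) (K : Kirkman X C) {x y z} →
  Kirkman.Block (transport-kirkman X↔Y C↔D K) x y z →
  Kirkman.Block K (Inverse.from X↔Y x) (Inverse.from X↔Y y) (Inverse.from X↔Y z)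
transport-block X↔Y C↔D K {x} {y} {z} (d , inj₁ (refl , refl)) = Inverse.from C↔D d , inj₁ (sym (from-to _) , sym (from-to _))
  where open Inverse X↔Y using () renaming (strictlyInverseʳ to from-to)
transport-block X↔Y C↔D K {x} {y} {z} (d , inj₂ (refl , refl)) = Inverse.from C↔D d , inj₂ (sym (from-to _) , sym (from-to _))
  where open Inverse X↔Y using () renaming (strictlyInverseʳ to from-to)

-- The cyclic orders of the given blocks are accidental. Reversing those of class `nothing` lets ∞₂
-- follow ∞₁; for a permutation of order three the inverse is the square.
module ReverseClass {X S : Set} (K : Kirkman X (Maybe S)) where
  private module K = Kirkman K

  next : Maybe S → X → X
  next nothing  x = K.next nothing (K.next nothing x)
  next (just s) x = K.next (just s) x

  private
    forward : ∀ c {x y} → next c x ≡ y ⊎ next c y ≡ x → K.Adjacent c x y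
    forward nothing {x} {y} (inj₁ refl) = inj₂ (K.next³ nothing x)
    forward nothing {x} {y} (inj₂ refl) = inj₁ (K.next³ nothing y)
    forward (just s) adj = adj

    backward : ∀ c {x y} → K.Adjacent c x y → next c x ≡ y ⊎ next c y ≡ x
    backward nothing {x} (inj₁ refl) = inj₂ (K.next³ nothing x)
    backward nothing {y = y} (inj₂ refl) = inj₁ (K.next³ nothing y)
    backward (just s) adj = adj

  reversed : Kirkman X (Maybe S)
  reversed = record
    { next = next
    ; next³ = λ { nothing x → trans (K.next³ nothing _) (K.next³ nothing x) ; (just s) x → K.next³ (just s) x }
    ; next≢ = λ c x eq → K.adjacent-irrefl (forward c {x} {x} (inj₁ eq)) refl
    ; covers = λ x≢y → let c , adj = K.covers x≢y in c , backward c adj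
    ; unique = λ {_} {_} {c} {c′} adj adj′ → K.unique (forward c adj) (forward c′ adj′) }

  reversed-block : ∀ {x y z} → Kirkman.Block reversed x y z → K.Block x y z
  reversed-block (just s , cycle) = just s , cycle
  reversed-block {x} {y} (nothing , inj₁ (refl , refl)) = nothing , inj₂ (K.next³ nothing _ , K.next³ nothing x)
  reversed-block {z = z} (nothing , inj₂ (refl , refl)) = nothing , inj₁ (K.next³ nothing _ , K.next³ nothing z)

-- Punching out a missed value would give an injection into a smaller set.
Fin-injective⇒surjective : ∀ {m n} → m ≡ n → (f : Fin m → Fin n) → (∀ {i j} → f i ≡ f j → i ≡ j) →
  ∀ k → ∃[ i ] f i ≡ k
Fin-injective⇒surjective {zero} refl f f-inj ()
Fin-injective⇒surjective {suc n} refl f f-inj k with Fin.any? (λ i → f i Fin.≟ k)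
... | yes hit  = hit
... | no ¬hit = ⊥-elim (Fin.<⇒notInjective (ℕ.n<1+n n)
        (λ {i} {j} eq → f-inj (Fin.punchOut-injective (missed i) (missed j) eq)))
  where
  missed : ∀ i → k ≢ f i
  missed i k≡fi = ¬hit (i , sym k≡fi)

-- Every class yields two points y with {∞₁, y, ·} in that class.
class-count : ∀ {q l} → Kirkman (Point (Fin q)) (Fin l) → l ℕ.+ l ≡ suc q
class-count {q} {l} K = ℕ.≤-antisym
  (Fin.injective⇒≤ {f = λ i → strip (neighbour (splitAt l i)) (neighbour≢ (splitAt l i))}
    λ {i} {j} eq → splitAt-injective i j (neighbour-injective (splitAt l i) (splitAt l j) (strip-injective _ _ eq)))
  (Fin.injective⇒≤ {f = λ i → join l l (side i)} λ {i} {j} eq → side-injective i j (join-injective eq))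
  where
  open Kirkman K
  strip : (P : Point (Fin q)) → P ≢ ∞₁ → Fin (suc q)
  strip ∞₁     P≢∞₁ = ⊥-elim (P≢∞₁ refl)
  strip ∞₂     _    = Fin.zero
  strip (pt t) _    = Fin.suc t
  strip-injective : ∀ {P Q} (p : P ≢ ∞₁) (r : Q ≢ ∞₁) → strip P p ≡ strip Q r → P ≡ Q
  strip-injective {∞₁}   {_}    p _ _ = ⊥-elim (p refl)
  strip-injective {_}    {∞₁}   _ r _ = ⊥-elim (r refl)
  strip-injective {∞₂}   {∞₂}   _ _ _ = refl
  strip-injective {pt t} {pt u} _ _ eq = cong pt (Fin.suc-injective eq)
  unstrip : Fin (suc q) → Point (Fin q)
  unstrip Fin.zero    = ∞₂
  unstrip (Fin.suc t) = pt t
  unstrip≢ : ∀ i → ∞₁ ≢ unstrip i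
  unstrip≢ Fin.zero ()
  unstrip≢ (Fin.suc _) ()
  unstrip-injective : ∀ i j → unstrip i ≡ unstrip j → i ≡ j
  unstrip-injective Fin.zero    Fin.zero    _  = refl
  unstrip-injective (Fin.suc t) (Fin.suc u) eq = cong Fin.suc (pt-injective eq)
  neighbour : Fin l ⊎ Fin l → Point (Fin q)
  neighbour (inj₁ c) = next c ∞₁
  neighbour (inj₂ c) = next c (next c ∞₁)
  neighbour-adjacent : ∀ s → Adjacent ([ (λ c → c) , (λ c → c) ]′ s) (neighbour s) ∞₁
  neighbour-adjacent (inj₁ c) = inj₂ refl
  neighbour-adjacent (inj₂ c) = inj₁ (next³ c ∞₁)
  neighbour≢ : ∀ s → neighbour s ≢ ∞₁
  neighbour≢ s = adjacent-irrefl (neighbour-adjacent s)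
  neighbour-injective : ∀ s s′ → neighbour s ≡ neighbour s′ → s ≡ s′
  neighbour-injective s s′ eq = cases s s′ eq (unique (neighbour-adjacent s)
    (subst (λ P → Adjacent _ P ∞₁) (sym eq) (neighbour-adjacent s′)))
    where
    cases : ∀ s s′ → neighbour s ≡ neighbour s′ →
      [ (λ c → c) , (λ c → c) ]′ s ≡ [ (λ c → c) , (λ c → c) ]′ s′ → s ≡ s′
    cases (inj₁ c) (inj₁ _) _  refl = refl
    cases (inj₂ c) (inj₂ _) _  refl = refl
    cases (inj₁ c) (inj₂ _) eq refl = ⊥-elim (next≢ c (next c ∞₁) (sym eq))
    cases (inj₂ c) (inj₁ _) eq refl = ⊥-elim (next≢ c (next c ∞₁) eq)
  splitAt-injective : ∀ (i j : Fin (l ℕ.+ l)) → splitAt l i ≡ splitAt l j → i ≡ j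
  splitAt-injective i j eq = trans (sym (Fin.join-splitAt l l i)) (trans (cong (join l l) eq) (Fin.join-splitAt l l j))
  join-injective : ∀ {s s′} → join l l s ≡ join l l s′ → s ≡ s′
  join-injective {s} {s′} eq = trans (sym (Fin.splitAt-join l l s)) (trans (cong (splitAt l) eq) (Fin.splitAt-join l l s′))
  side : Fin (suc q) → Fin l ⊎ Fin l
  side i with covers (unstrip≢ i)
  ... | c , inj₁ _ = inj₁ c
  ... | c , inj₂ _ = inj₂ c
  side-injective : ∀ i j → side i ≡ side j → i ≡ j
  side-injective i j eq with covers (unstrip≢ i) | covers (unstrip≢ j)
  side-injective i j refl | c , inj₁ p | _ , inj₁ r = unstrip-injective i j (trans (sym p) r)
  side-injective i j refl | c , inj₂ p | _ , inj₂ r = unstrip-injective i j (next-injective (trans p (sym r)))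
  side-injective i j () | c , inj₁ p | _ , inj₂ r
  side-injective i j () | c , inj₂ p | _ , inj₁ r

Fin-pointed : ∀ {n} → Fin (suc n) → Fin (suc n) ↔ Maybe (Fin n)
Fin-pointed {n} i = mk↔ₛ′ to from to-from from-to
  where
  to : Fin (suc n) → Maybe (Fin n)
  to j with i Fin.≟ j
  ... | yes _   = nothing
  ... | no i≢j = just (punchOut i≢j)
  from : Maybe (Fin n) → Fin (suc n)
  from nothing  = i
  from (just j) = punchIn i j
  to-from : ∀ j → to (from j) ≡ j
  to-from nothing with i Fin.≟ i
  ... | yes _   = refl
  ... | no i≢i = ⊥-elim (i≢i refl)
  to-from (just j) with i Fin.≟ punchIn i j
  ... | yes eq  = ⊥-elim (Fin.punchInᵢ≢i i j (sym eq))
  ... | no i≢j = cong just (trans (Fin.punchOut-cong i refl) (Fin.punchOut-punchIn i))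
  from-to : ∀ j → from (to j) ≡ j
  from-to j with i Fin.≟ j
  ... | yes i≡j = i≡j
  ... | no i≢j  = Fin.punchIn-punchOut i≢j

Point↔Fin : ∀ {A : Set} {m} → A ↔ Fin m → Point A ↔ Fin (m ℕ.+ 2)
Point↔Fin {A} {m} A↔m = mk↔ₛ′ to from to-from from-to
  where
  module A = Inverse A↔m
  to : Point A → Fin (m ℕ.+ 2)
  to ∞₁     = m ↑ʳ Fin.zero
  to ∞₂     = m ↑ʳ Fin.suc Fin.zero
  to (pt x) = A.to x ↑ˡ 2
  from′ : Fin m ⊎ Fin 2 → Point A
  from′ (inj₁ i)                  = pt (A.from i)
  from′ (inj₂ Fin.zero)           = ∞₁
  from′ (inj₂ (Fin.suc Fin.zero)) = ∞₂
  from : Fin (m ℕ.+ 2) → Point A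
  from i = from′ (splitAt m i)
  to-from : ∀ i → to (from i) ≡ i
  to-from i with splitAt m i in eq
  ... | inj₁ j                  = trans (cong (_↑ˡ 2) (A.strictlyInverseˡ j)) (Fin.splitAt⁻¹-↑ˡ eq)
  ... | inj₂ Fin.zero           = Fin.splitAt⁻¹-↑ʳ eq
  ... | inj₂ (Fin.suc Fin.zero) = Fin.splitAt⁻¹-↑ʳ eq
  from-to : ∀ P → from (to P) ≡ P
  from-to ∞₁     = cong from′ (Fin.splitAt-↑ʳ m 2 Fin.zero)
  from-to ∞₂     = cong from′ (Fin.splitAt-↑ʳ m 2 (Fin.suc Fin.zero))
  from-to (pt x) = trans (cong from′ (Fin.splitAt-↑ˡ m (A.to x) 2)) (cong pt (A.strictlyInverseʳ x))

record Normalised {q C} s (K : Kirkman (Point (Fin q)) C) : Set where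
  field
    K′      : Kirkman (Point (Fin q)) (Maybe (Fin s))
    base    : Kirkman.next K′ nothing ∞₁ ≡ ∞₂
    coarser : ∀ {x y z} → Kirkman.Block K′ x y z → Kirkman.Block K x y z

  open Kirkman K′

  -- A return to ∞₁ would make the orbit of ∞₁ alternate between two points, contrary to its period
  -- three; so the third point is affine.
  third : ∃[ t ] next nothing ∞₂ ≡ pt t
  third with next nothing ∞₂ in eq
  ... | ∞₂   = ⊥-elim (next≢ nothing ∞₂ eq)
  ... | pt t = t , refl
  ... | ∞₁ with trans (sym (next³ nothing ∞₁)) (trans (cong (λ P → next nothing (next nothing P)) base)
                  (trans (cong (next nothing) eq) base))
  ...   | ()

↔-refl : ∀ {A : Set} → A ↔ A
↔-refl = mk↔ₛ′ (λ x → x) (λ x → x) (λ _ → refl) (λ _ → refl)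

normalise : ∀ {q s l} → l ≡ suc s → (K : Kirkman (Point (Fin q)) (Fin l)) → Normalised s K
normalise {q} {s} refl K = orient (proj₂ found)
  where
  found : ∃[ i ] Kirkman.Adjacent K i ∞₁ ∞₂
  found = Kirkman.covers K λ ()
  C↔C : Fin (suc s) ↔ Maybe (Fin s)
  C↔C = Fin-pointed (proj₁ found)
  K₁ : Kirkman (Point (Fin q)) (Maybe (Fin s))
  K₁ = transport-kirkman ↔-refl C↔C K
  open ReverseClass K₁
  orient : Kirkman.Adjacent K (proj₁ found) ∞₁ ∞₂ → Normalised s K
  orient (inj₁ eq) = record
    { K′ = K₁ ; base = eq ; coarser = λ {x} {y} {z} → transport-block ↔-refl C↔C K {x} {y} {z} }
  orient (inj₂ eq) = record
    { K′ = reversed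
    ; base = trans (cong (λ P → Kirkman.next K₁ nothing (Kirkman.next K₁ nothing P)) (sym eq)) (Kirkman.next³ K₁ nothing ∞₂)
    ; coarser = λ {x} {y} {z} b → transport-block ↔-refl C↔C K {x} {y} {z} (reversed-block b) }

record BasedFamily (q s : ℕ) : Set where
  field
    K        : Fin q → Kirkman (Point (Fin q)) (Maybe (Fin s))
    base₁    : ∀ x → Kirkman.next (K x) nothing ∞₁ ≡ ∞₂
    base₂    : ∀ x → Kirkman.next (K x) nothing ∞₂ ≡ pt x
    disjoint : PairwiseDisjoint K

-- The systems are reindexed by the third point of their block through ∞₁ and ∞₂.
reindex : ∀ {q s m} {l : Fin m → ℕ} → m ≡ q → (∀ i → l i ≡ suc s) →
  (systems : ∀ i → Kirkman (Point (Fin q)) (Fin (l i))) → PairwiseDisjoint systems → BasedFamily q s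
reindex {q} {s} {m} {l} m≡q l≡ systems systems-disjoint = record
  { K = λ x → N.K′ (index x)
  ; base₁ = λ x → N.base (index x)
  ; base₂ = λ x → trans (proj₂ (N.third (index x))) (cong pt (index-third x))
  ; disjoint = λ {x} {y} b b′ → trans (sym (index-third x)) (trans (cong third (N-disjoint b b′)) (index-third y)) }
  where
  abstract
    normalised : ∀ i → Normalised s (systems i)
    normalised i = normalise (l≡ i) (systems i)
  module N i = Normalised (normalised i)
  N-disjoint : PairwiseDisjoint N.K′
  N-disjoint {i} {j} b b′ = systems-disjoint (N.coarser i b) (N.coarser j b′)
  third : Fin m → Fin q
  third i = proj₁ (N.third i)
  base-block : ∀ i → Kirkman.Block (N.K′ i) ∞₁ ∞₂ (pt (third i))
  base-block i = nothing , inj₁ (N.base i , proj₂ (N.third i))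
  -- Two systems with the same third point share its block with ∞₁ and ∞₂, so they have the same
  -- index. There are as many systems as field elements, hence every field element occurs as a third
  -- point.
  third-injective : ∀ {i j} → third i ≡ third j → i ≡ j
  third-injective {i} {j} eq = N-disjoint (base-block i) (subst (λ t → Kirkman.Block (N.K′ j) ∞₁ ∞₂ (pt t)) (sym eq) (base-block j))
  onto : ∀ x → ∃[ i ] third i ≡ x
  onto = Fin-injective⇒surjective m≡q third third-injective
  index : Fin q → Fin m
  index x = proj₁ (onto x)
  index-third : ∀ x → third (index x) ≡ x
  index-third x = proj₂ (onto x)

based-family : ∀ {q s} → q ≡ suc (s ℕ.+ s) → LKTS (q ℕ.+ 2) → BasedFamily q s
based-family {q} {s} q≡ lkts = reindex (ℕ.m+n∸n≡m q 2) (λ i → classes≡ (systems i)) systems systems-disjoint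
  where
  Fin↔Point : Fin (q ℕ.+ 2) ↔ Point (Fin q)
  Fin↔Point = mk↔ₛ′ from to strictlyInverseʳ strictlyInverseˡ
    where open Inverse (Point↔Fin {Fin q} ↔-refl)
  systems : ∀ i → Kirkman (Point (Fin q)) (Fin (class-number lkts i))
  systems i = transport-kirkman Fin↔Point ↔-refl (small-systems lkts i)
  systems-disjoint : PairwiseDisjoint systems
  systems-disjoint {i} {j} {x} {y} {z} b b′ = small-systems-disjoint lkts
    (transport-block Fin↔Point ↔-refl (small-systems lkts i) {x} {y} {z} b)
    (transport-block Fin↔Point ↔-refl (small-systems lkts j) {x} {y} {z} b′)
  -- `class-count` gives 2 l = q + 1 = 2 (s + 1): besides the class of ∞₁ and ∞₂ there are `s`
  -- others.
  classes≡ : ∀ {l} → Kirkman (Point (Fin q)) (Fin l) → l ≡ suc s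
  classes≡ {l} K = ℕ.*-cancelˡ-≡ l (suc s) 2 (trans (cong (l ℕ.+_) (ℕ.+-identityʳ l))
    (trans (class-count K) (trans (cong suc q≡) (sym (trans (cong (suc s ℕ.+_) (ℕ.+-identityʳ (suc s))) (cong suc (ℕ.+-suc s s)))))))

-- From permutations of order three back to lists of triples

module _ {v : ℕ} where

  Spans : Fin v → Fin v → Fin v → Triple v → Set
  Spans x y z t = (x ∈ᵇ t × y ∈ᵇ t × z ∈ᵇ t) × (∀ {w} → w ∈ᵇ t → w ≡ x ⊎ (w ≡ y ⊎ w ≡ z))

  private
    1st : ∀ {w x y z : Fin v} → w ≡ x → w ≡ x ⊎ (w ≡ y ⊎ w ≡ z)
    1st = inj₁

    2nd : ∀ {w x y z : Fin v} → w ≡ y → w ≡ x ⊎ (w ≡ y ⊎ w ≡ z)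
    2nd eq = inj₂ (inj₁ eq)

    3rd : ∀ {w x y z : Fin v} → w ≡ z → w ≡ x ⊎ (w ≡ y ⊎ w ≡ z)
    3rd eq = inj₂ (inj₂ eq)

    cases : ∀ {P : Set} {w x y z : Fin v} → (w ≡ x → P) → (w ≡ y → P) → (w ≡ z → P) → w ≡ x ⊎ (w ≡ y ⊎ w ≡ z) → P
    cases f g h = [ f , [ g , h ]′ ]′

  sort₃ : ∀ x y z → x ≢ y → y ≢ z → x ≢ z → ∃[ t ] Spans x y z t
  sort₃ x y z x≢y y≢z x≢z with Fin.<-cmp x y | Fin.<-cmp y z | Fin.<-cmp x z
  ... | tri≈ _ x≡y _ | _ | _ = ⊥-elim (x≢y x≡y)
  ... | _ | tri≈ _ y≡z _ | _ = ⊥-elim (y≢z y≡z)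
  ... | _ | _ | tri≈ _ x≡z _ = ⊥-elim (x≢z x≡z)
  ... | tri< x<y _ _ | tri< y<z _ _ | _ =
    triple x y z x<y y<z , (1st refl , 2nd refl , 3rd refl) , cases 1st 2nd 3rd
  ... | tri< x<y _ _ | tri> _ _ z<y | tri< x<z _ _ =
    triple x z y x<z z<y , (1st refl , 3rd refl , 2nd refl) , cases 1st 3rd 2nd
  ... | tri< x<y _ _ | tri> _ _ z<y | tri> _ _ z<x =
    triple z x y z<x x<y , (2nd refl , 3rd refl , 1st refl) , cases 3rd 1st 2nd
  ... | tri> _ _ y<x | tri< y<z _ _ | tri< x<z _ _ =
    triple y x z y<x x<z , (2nd refl , 1st refl , 3rd refl) , cases 2nd 1st 3rd
  ... | tri> _ _ y<x | tri< y<z _ _ | tri> _ _ z<x =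
    triple y z x y<z z<x , (3rd refl , 1st refl , 2nd refl) , cases 2nd 3rd 1st
  ... | tri> _ _ y<x | tri> _ _ z<y | _ =
    triple z y x z<y y<x , (3rd refl , 2nd refl , 1st refl) , cases 3rd 2nd 1st

  _≟ₜ_ : DecidableEquality (Triple v)
  t ≟ₜ u with a t Fin.≟ a u | b t Fin.≟ b u | c t Fin.≟ c u
  ... | yes p | yes q | yes r = yes (triple-≡ p q r)
  ... | no ¬p | _     | _     = no λ { refl → ¬p refl }
  ... | _     | no ¬q | _     = no λ { refl → ¬q refl }
  ... | _     | _     | no ¬r = no λ { refl → ¬r refl }

module ToKTS {v : ℕ} {C : Set} (K : Kirkman (Fin v) C) where
  open Kirkman K

  next≢next² : ∀ i x → x ≢ next i (next i x)
  next≢next² i x eq = next≢ i x (trans (cong (next i) eq) (next³ i x))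

  abstract
    spanning : ∀ i x → ∃[ t ] Spans x (next i x) (next i (next i x)) t
    spanning i x = sort₃ x (next i x) (next i (next i x))
      (λ eq → next≢ i x (sym eq)) (λ eq → next≢ i (next i x) (sym eq)) (next≢next² i x)

  block : C → Fin v → Triple v
  block i x = proj₁ (spanning i x)

  ∈-block : ∀ i x → x ∈ᵇ block i x
  ∈-block i x = proj₁ (proj₁ (proj₂ (spanning i x)))

  next-∈-block : ∀ i x → next i x ∈ᵇ block i x
  next-∈-block i x = proj₁ (proj₂ (proj₁ (proj₂ (spanning i x))))

  next²-∈-block : ∀ i x → next i (next i x) ∈ᵇ block i x
  next²-∈-block i x = proj₂ (proj₂ (proj₁ (proj₂ (spanning i x))))

  block-∈ : ∀ i x {w} → w ∈ᵇ block i x → w ≡ x ⊎ (w ≡ next i x ⊎ w ≡ next i (next i x))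
  block-∈ i x = proj₂ (proj₂ (spanning i x))

  block-⊆ : ∀ i x {t} → x ∈ᵇ t → next i x ∈ᵇ t → next i (next i x) ∈ᵇ t → block i x ≡ t
  block-⊆ i x {t} x∈t y∈t z∈t = triple-ext λ w∈ → member (block-∈ i x w∈)
    where
    member : ∀ {w} → w ≡ x ⊎ (w ≡ next i x ⊎ w ≡ next i (next i x)) → w ∈ᵇ t
    member (inj₁ refl)        = x∈t
    member (inj₂ (inj₁ refl)) = y∈t
    member (inj₂ (inj₂ refl)) = z∈t

  block-next : ∀ i x → block i (next i x) ≡ block i x
  block-next i x = block-⊆ i (next i x) (next-∈-block i x) (next²-∈-block i x)
    (subst (_∈ᵇ block i x) (sym (next³ i x)) (∈-block i x))

  block-unique : ∀ i x {w} → w ∈ᵇ block i x → block i w ≡ block i x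
  block-unique i x w∈ with block-∈ i x w∈
  ... | inj₁ refl        = refl
  ... | inj₂ (inj₁ refl) = block-next i x
  ... | inj₂ (inj₂ refl) = trans (block-next i (next i x)) (block-next i x)

  block-adjacent : ∀ i x {y} → y ∈ᵇ block i x → x ≢ y → Adjacent i x y
  block-adjacent i x y∈ x≢y with block-∈ i x y∈
  ... | inj₁ refl        = ⊥-elim (x≢y refl)
  ... | inj₂ (inj₁ refl) = inj₁ refl
  ... | inj₂ (inj₂ refl) = inj₂ (next³ i x)

  adjacent-block : ∀ {i x y} → Adjacent i x y → y ∈ᵇ block i x
  adjacent-block {i} {x} (inj₁ refl) = next-∈-block i x
  adjacent-block {i} {y = y} (inj₂ refl) = subst (y ∈ᵇ_) (sym (block-next i y)) (∈-block i y)

  -- Every block arises from each of its three points, whence the removal of duplicates.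
  parallelClass : C → List (Triple v)
  parallelClass i = deduplicate _≟ₜ_ (map (block i) (allFin v))

  block-∈-class : ∀ i x → block i x ∈ parallelClass i
  block-∈-class i x = ∈-deduplicate⁺ _≟ₜ_ (∈-map⁺ (block i) (∈-allFin x))

  class-block : ∀ i {t x} → t ∈ parallelClass i → x ∈ᵇ t → t ≡ block i x
  class-block i {t} {x} t∈ x∈t with ∈-map⁻ (block i) (∈-deduplicate⁻ _≟ₜ_ (map (block i) (allFin v)) t∈)
  ... | w , _ , refl = sym (block-unique i w x∈t)

  class-unique : ∀ i → Unique (parallelClass i)
  class-unique i = UniqueDec.deduplicate-! _≟ₜ_ (map (block i) (allFin v))

  isParallelClass : ∀ i → IsParallelClass v (parallelClass i)
  isParallelClass i = class-unique i ,
    λ x → (block i x , block-∈-class i x , ∈-block i x) ,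
          λ t u t∈ u∈ x∈t x∈u → trans (class-block i t∈ x∈t) (sym (class-block i u∈ x∈u))

  class-adjacent : ∀ i {t x y} → t ∈ parallelClass i → x ∈ᵇ t → y ∈ᵇ t → x ≢ y → Adjacent i x y
  class-adjacent i {x = x} {y} t∈ x∈t y∈t = block-adjacent i x (subst (y ∈ᵇ_) (class-block i t∈ x∈t) y∈t)

  same-class : ∀ {i j t u x y} → t ∈ parallelClass i → u ∈ parallelClass j → x ≢ y →
    x ∈ᵇ t → y ∈ᵇ t → x ∈ᵇ u → y ∈ᵇ u → i ≡ j
  same-class {i} {j} t∈ u∈ x≢y x∈t y∈t x∈u y∈u =
    unique (class-adjacent i t∈ x∈t y∈t x≢y) (class-adjacent j u∈ x∈u y∈u x≢y)

  module _ (cs : List C) (cs-unique : Unique cs) (cs-complete : ∀ i → i ∈ cs) where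

    blocks : List (Triple v)
    blocks = concat (map parallelClass cs)

    ∈-blocks⁻ : ∀ {t} → t ∈ blocks → ∃[ i ] t ∈ parallelClass i
    ∈-blocks⁻ t∈ with ∈-concat⁻′ (map parallelClass cs) t∈
    ... | _ , t∈P , P∈ with ∈-map⁻ parallelClass P∈
    ...   | i , _ , refl = i , t∈P

    ∈-blocks⁺ : ∀ {t} i → t ∈ parallelClass i → t ∈ blocks
    ∈-blocks⁺ i t∈ = ∈-concat⁺′ t∈ (∈-map⁺ parallelClass (cs-complete i))

    -- Distinct classes share no triple, since its first two entries would be adjacent in both.
    blocks-unique : Unique blocks
    blocks-unique = Unique.concat⁺ (All.map⁺ (All.universal class-unique cs))
      (AllPairs.map⁺ (AllPairs.map (λ {i} {j} i≢j {t} (t∈i , t∈j) → i≢j (same-class {i} {j} t∈i t∈j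
        (λ eq → ℕ.<⇒≢ (a<b t) (cong toℕ eq)) (inj₁ refl) (inj₂ (inj₁ refl)) (inj₁ refl) (inj₂ (inj₁ refl)))) cs-unique))

    isKTS : IsKTS v blocks
    isKTS = (blocks-unique , λ x y x≢y →
        (let i , adj = covers x≢y in
           block i x , ∈-blocks⁺ i (block-∈-class i x) , ∈-block i x , adjacent-block adj) ,
        λ t u t∈ u∈ x∈t y∈t x∈u y∈u → agree x≢y (∈-blocks⁻ t∈) (∈-blocks⁻ u∈) x∈t y∈t x∈u y∈u) ,
      map parallelClass cs , All.map⁺ (All.universal isParallelClass cs) , ↭-refl
      where
      agree : ∀ {x y t u} → x ≢ y → ∃[ i ] t ∈ parallelClass i → ∃[ j ] u ∈ parallelClass j →
        x ∈ᵇ t → y ∈ᵇ t → x ∈ᵇ u → y ∈ᵇ u → t ≡ u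
      agree x≢y (i , t∈) (j , u∈) x∈t y∈t x∈u y∈u with same-class {i} {j} t∈ u∈ x≢y x∈t y∈t x∈u y∈u
      ... | refl = trans (class-block i t∈ x∈t) (sym (class-block i u∈ x∈u))

module _ {v : ℕ} {C : Set} (K L : Kirkman (Fin v) C) where
  private
    module K = Kirkman K
    module L = Kirkman L
    module KB = ToKTS K
    module LB = ToKTS L

  -- A triple does not record the orientation of the orbit it comes from. Two orbits on the same
  -- three points have equal or opposite orientations, and `Block` admits both.
  common-block : ∀ {i j t} → t ∈ KB.parallelClass i → t ∈ LB.parallelClass j →
    ∃[ x ] ∃[ y ] ∃[ z ] (K.Block x y z × L.Block x y z)
  common-block {i} {j} {t} t∈K t∈L = x , y , z , (i , inj₁ (refl , refl)) , found (in-L (KB.next-∈-block i x)) (in-L (KB.next²-∈-block i x))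
    where
    x y z : Fin v
    x = a t
    y = K.next i x
    z = K.next i y
    t≡K : t ≡ KB.block i x
    t≡K = KB.class-block i t∈K (inj₁ refl)
    t≡L : t ≡ LB.block j x
    t≡L = LB.class-block j t∈L (inj₁ refl)
    in-L : ∀ {w} → w ∈ᵇ KB.block i x → w ≡ x ⊎ (w ≡ L.next j x ⊎ w ≡ L.next j (L.next j x))
    in-L {w} w∈ = LB.block-∈ j x (subst (w ∈ᵇ_) (trans (sym t≡K) t≡L) w∈)
    found : y ≡ x ⊎ (y ≡ L.next j x ⊎ y ≡ L.next j (L.next j x)) →
            z ≡ x ⊎ (z ≡ L.next j x ⊎ z ≡ L.next j (L.next j x)) → L.Block x y z
    found (inj₁ y≡x) _ = ⊥-elim (K.next≢ i x y≡x)
    found _ (inj₁ z≡x) = ⊥-elim (KB.next≢next² i x (sym z≡x))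
    found (inj₂ (inj₁ p)) (inj₂ (inj₁ r)) = ⊥-elim (K.next≢ i y (trans r (sym p)))
    found (inj₂ (inj₂ p)) (inj₂ (inj₂ r)) = ⊥-elim (K.next≢ i y (trans r (sym p)))
    found (inj₂ (inj₁ p)) (inj₂ (inj₂ r)) = j , inj₁ (sym p , trans (cong (L.next j) p) (sym r))
    found (inj₂ (inj₂ p)) (inj₂ (inj₁ r)) = j , inj₂ (trans (cong (L.next j) r) (sym p) , trans (cong (L.next j) p) (L.next³ j x))

build-LKTS : ∀ {v} {I C : Set} (K : I → Kirkman (Fin v) C) → PairwiseDisjoint K →
  (index : Fin (v ∸ 2) → I) → (∀ {i j} → index i ≡ index j → i ≡ j) →
  (cs : List C) → Unique cs → (∀ i → i ∈ cs) → LKTS v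
build-LKTS K disjoint index index-injective cs cs-unique cs-complete =
  (λ i → S.blocks i cs cs-unique cs-complete) ,
  (λ i → S.isKTS i cs cs-unique cs-complete) ,
  λ i j i≢j t t∈i t∈j →
    let i′ , t∈i′ = S.∈-blocks⁻ i cs cs-unique cs-complete t∈i
        j′ , t∈j′ = S.∈-blocks⁻ j cs cs-unique cs-complete t∈j
        x , y , z , bᵢ , bⱼ = common-block (K (index i)) (K (index j)) {i′} {j′} t∈i′ t∈j′
    in i≢j (index-injective (disjoint bᵢ bⱼ))
  where module S i = ToKTS (K (index i))

-- Enumeration of points, directions and classes

Vec↔Fin : ∀ q n → Vec (Fin q) n ↔ Fin (q ℕ.^ n)
Vec↔Fin q n = mk↔ₛ′ (to n) (from n) (to-from n) (from-to n)
  where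
  to : ∀ n → Vec (Fin q) n → Fin (q ℕ.^ n)
  to zero    []      = Fin.zero
  to (suc n) (x ∷ v) = combine x (to n v)
  from : ∀ n → Fin (q ℕ.^ n) → Vec (Fin q) n
  from zero    _ = []
  from (suc n) i = proj₁ (remQuot {q} (q ℕ.^ n) i) ∷ from n (proj₂ (remQuot {q} (q ℕ.^ n) i))
  to-from : ∀ n i → to n (from n i) ≡ i
  to-from zero    Fin.zero = refl
  to-from (suc n) i = trans (cong (combine (proj₁ (remQuot {q} (q ℕ.^ n) i))) (to-from n _)) (Fin.combine-remQuot {q} (q ℕ.^ n) i)
  from-to : ∀ n v → from n (to n v) ≡ v
  from-to zero    [] = refl
  from-to (suc n) (x ∷ v) = cong₂ _∷_ (cong proj₁ rq) (trans (cong (λ p → from n (proj₂ p)) rq) (from-to n v))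
    where
    rq : remQuot {q} (q ℕ.^ n) (combine x (to n v)) ≡ (x , to n v)
    rq = Fin.remQuot-combine x (to n v)

module _ {q s} (𝔽 : FiniteField q s) where
  open LinearAlgebra 𝔽 using (Dir; here; there)

  vectors : ∀ n → List (Vec (Fin q) n)
  vectors n = map (Inverse.from (Vec↔Fin q n)) (allFin (q ℕ.^ n))

  vectors-complete : ∀ {n} v → v ∈ vectors n
  vectors-complete {n} v = subst (_∈ vectors n) (Inverse.strictlyInverseʳ (Vec↔Fin q n) v)
    (∈-map⁺ (Inverse.from (Vec↔Fin q n)) (∈-allFin _))

  vectors-unique : ∀ n → Unique (vectors n)
  vectors-unique n = Unique.map⁺ (λ {i} {j} eq → trans (sym (to-from i)) (trans (cong to eq) (to-from j))) (Unique.allFin⁺ _)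
    where open Inverse (Vec↔Fin q n) using (to) renaming (strictlyInverseˡ to to-from)

  directions : ∀ n → List (Dir n)
  directions zero    = []
  directions (suc n) = map here (vectors n) ++ map there (directions n)

  directions-complete : ∀ {n} (e : Dir n) → e ∈ directions n
  directions-complete (here v)  = ∈-++⁺ˡ (∈-map⁺ here (vectors-complete v))
  directions-complete (there e) = ∈-++⁺ʳ (map here (vectors _)) (∈-map⁺ there (directions-complete e))

  directions-unique : ∀ n → Unique (directions n)
  directions-unique zero    = AllPairs.[]
  directions-unique (suc n) = Unique.++⁺ (Unique.map⁺ (λ { refl → refl }) (vectors-unique n))
    (Unique.map⁺ (λ { refl → refl }) (directions-unique n)) apart
    where
    apart : ∀ {e} → ¬ (e ∈ map here (vectors n) × e ∈ map there (directions n))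
    apart (∈here , ∈there) with ∈-map⁻ here ∈here | ∈-map⁻ there ∈there
    ... | _ , _ , refl | _ , _ , ()

  classes : ∀ n → List (Maybe (Dir n × Fin s))
  classes n = nothing ∷ map just (cartesianProduct (directions n) (allFin s))

  classes-complete : ∀ {n} (i : Maybe (Dir n × Fin s)) → i ∈ classes n
  classes-complete nothing        = Any.here refl
  classes-complete (just (e , j)) = Any.there (∈-map⁺ just (∈-cartesianProduct⁺ (directions-complete e) (∈-allFin j)))

  classes-unique : ∀ n → Unique (classes n)
  classes-unique n = All.tabulate fresh AllPairs.∷
    Unique.map⁺ just-injective (Unique.cartesianProduct⁺ (directions-unique n) (Unique.allFin⁺ s))
    where
    fresh : ∀ {i} → i ∈ map just (cartesianProduct (directions n) (allFin s)) → nothing ≢ i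
    fresh i∈ refl with ∈-map⁻ just i∈
    ... | _ , _ , ()

  large-system : BasedFamily q s → ∀ n → LKTS (q ℕ.^ suc n ℕ.+ 2)
  large-system family n = build-LKTS systems systems-disjoint index index-injective
    (classes (suc n)) (classes-unique (suc n)) classes-complete
    where
    open BasedFamily family
    open Construction 𝔽 K base₁ base₂ disjoint n
    N : ℕ
    N = q ℕ.^ suc n
    V↔Fin = Vec↔Fin q (suc n)
    P↔Fin : Point V ↔ Fin (N ℕ.+ 2)
    P↔Fin = Point↔Fin V↔Fin
    C↔C : Class ↔ Class
    C↔C = mk↔ₛ′ (λ i → i) (λ i → i) (λ _ → refl) (λ _ → refl)
    systems : V → Kirkman (Fin (N ℕ.+ 2)) Class
    systems x = transport-kirkman P↔Fin C↔C (system x)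
    systems-disjoint : PairwiseDisjoint systems
    systems-disjoint {x} {x′} {p} {r} {t} b b′ = system-disjoint
      (transport-block P↔Fin C↔C (system x) {p} {r} {t} b) (transport-block P↔Fin C↔C (system x′) {p} {r} {t} b′)
    index : Fin (N ℕ.+ 2 ∸ 2) → V
    index i = Inverse.from V↔Fin (Fin.cast (ℕ.m+n∸n≡m N 2) i)
    index-injective : ∀ {i j} → index i ≡ index j → i ≡ j
    index-injective {i} {j} eq = Fin.toℕ-injective (trans (sym (Fin.toℕ-cast (ℕ.m+n∸n≡m N 2) i))
      (trans (cong toℕ (trans (sym (to-from _)) (trans (cong to eq) (to-from _)))) (Fin.toℕ-cast (ℕ.m+n∸n≡m N 2) j)))
      where open Inverse V↔Fin using (to) renaming (strictlyInverseˡ to to-from)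

open import Data.Nat using (ℕ; _+_; _^_; _%_; _≥_)

theorem2 : (q : ℕ) → IsPrimePower q → q % 6 ≡ 1 →
    LKTS (q + 2) → (n : ℕ) → n ≥ 2 → LKTS (q ^ n + 2)
theorem2 q q-prime-power q%6≡1 lkts zero ()
theorem2 q q-prime-power q%6≡1 lkts (suc n) _ with finite-field q-prime-power q%6≡1
... | t , q≡1+6t , 𝔽 = large-system 𝔽 (based-family (trans q≡1+6t (cong suc (halves t))) lkts) n
  where
  halves : ∀ t → 6 ℕ.* t ≡ 3 ℕ.* t ℕ.+ 3 ℕ.* t
  halves = ℕ-Solver.solve-∀
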